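{- When each online vertex arrives independently at an early or late stage (the independent random arrival model with $m=2$ stages), the Ranking algorithm is at least $0.6656$-competitive. When each online vertex arrives independently at an early, middle, or late stage ($m=3$), the Ranking algorithm is at least $0.6763$-competitive.
   Context: Online bipartite matching: $G=(L,R,E)$ is a finite bipartite graph; $L$ is the set of offline vertices (known in advance), $R$ is the set of online vertices, and each $v\in L$ has a weight $w_v\ge 0$ (the unweighted case is $w_v=1$ for all $v$). Online vertices arrive one by one; when one arrives, its incident edges are revealed and the algorithm must immediately and irrevocably match it to one of its unmatched neighbors or leave it unmatched. Independent random arrival model with $m$ stages: there are $m$ stages ordered from early to late. Each online vertex arrives at one of the stages, drawn independently and uniformly at random from $\{1,\dots,m\}$. Vertices of earlier stages arrive before vertices of later stages. Among the vertices that arrive at the same stage, their relative order is arbitrary. Ranking: each offline vertex $v$ draws in advance an independent rank $y_v$ uniformly from $[0,1]$. The algorithm is characterized by a function $f:[0,1]^2\to[0,1]$ that is non-increasing in the first coordinate, non-decreasing in the second coordinate, and satisfies $f(x,1)=1$ for $x\in[0,1]$ and $f(1,y)=0$ for $y\in[0,1)$; in the $m$-stage model $f$ is constant in its first coordinate on each interval $[\frac{j-1}{m},\frac{j}{m})$, and arriving at the $j$-th stage corresponds to an arrival time $x_u\in[\frac{j-1}{m},\frac{j}{m})$. Upon the arrival of $u$, it is matched to the unmatched neighbor $v$ (if one exists) with maximum $w_v\cdot(1-f(x_u,y_v))$. On unweighted graphs, any $f$ strictly monotone in the second coordinate gives the classical Ranking algorithm, which matches $u$ to its unmatched neighbor of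 smallest rank. Ranking is $c$-competitive if, for a suitable choice of the function $f$ (not depending on the graph), on every such weighted graph the expected total weight of the offline vertices it matches (over the stages and the ranks) is at least $c$ times the maximum, over all matchings of $G$, of the total weight of the matched offline vertices. -}

module Defs where

open import Algebra.Bundles using (CommutativeRing)
import Algebra.Definitions.RawMonoid as RawMonoidDefinitions
open import Data.Bool.Base using (Bool; true; not; _∧_; if_then_else_)
open import Data.Fin.Base using (Fin; toℕ)
open import Data.Fin.Permutation using (Permutation′; _⟨$⟩ʳ_)
import Data.Fin.Properties as Fin
open import Data.List.Base using (List; []; _∷_; allFin; map; filter; filterᵇ; concatMap; foldl)
open import Data.Maybe.Base using (Maybe; just; nothing; is-just; maybe′)
open import Data.Nat.Base as ℕ using (ℕ; zero; suc; NonZero)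
open import Data.Product.Base using (Σ-syntax; ∃-syntax; _×_)
open import Data.Vec.Base as Vec using (Vec; []; _∷_)
open import Data.Vec.Functional using (Vector; updateAt)
open import Function.Base using (const)
open import Level using (0ℓ)
open import Relation.Binary.Core using (Rel)
open import Relation.Binary.PropositionalEquality using (_≡_)
open import Relation.Binary.Structures using (IsDecTotalOrder)
import Relation.Binary.Construct.NonStrictToStrict as ToStrict
open import Relation.Nullary using (¬_; does)
open import Relation.Unary using (Pred; Satisfiable)

-- The real numbers are characterised axiomatically, as a Dedekind-complete
-- totally ordered field; classically this determines them up to isomorphism.
-- Decidability of the order makes the algorithm's comparisons computable.
record CompleteOrderedField : Set₁ where
  infix  4 _≤_
  infix  9 _⁻¹
  field
    commutativeRing : CommutativeRing 0ℓ 0ℓ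
  open CommutativeRing commutativeRing public
    renaming (Carrier to ℝ)
    hiding (refl; sym; trans; reflexive)
  field
    _≤_             : Rel ℝ 0ℓ
    isDecTotalOrder : IsDecTotalOrder _≈_ _≤_
    +-monoʳ-≤       : ∀ z {x y} → x ≤ y → z + x ≤ z + y
    *-nonNegative   : ∀ {x y} → 0# ≤ x → 0# ≤ y → 0# ≤ x * y
    0≉1             : ¬ 0# ≈ 1#
    _⁻¹             : ℝ → ℝ
    ⁻¹-inverseʳ     : ∀ {x} → ¬ x ≈ 0# → x * x ⁻¹ ≈ 1#

  UpperBound : Pred ℝ 0ℓ → ℝ → Set
  UpperBound P b = ∀ x → P x → x ≤ b

  field
    complete : (P : Pred ℝ 0ℓ) → Satisfiable P → Satisfiable (UpperBound P) →
               ∃[ s ] (UpperBound P s × (∀ b → UpperBound P b → s ≤ b))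

  open IsDecTotalOrder isDecTotalOrder public using (_≤?_)
  open ToStrict _≈_ _≤_ public using (_<_)
  open RawMonoidDefinitions +-rawMonoid public using (sum) renaming (_×_ to _·_)

  fromℕ : ℕ → ℝ
  fromℕ n = n · 1#

  -- Meaningful for q ≠ 0 only.
  infixl 7 _÷_
  _÷_ : ℕ → ℕ → ℝ
  p ÷ q = fromℕ p * fromℕ q ⁻¹

record BipartiteGraph : Set where
  field
    nL nR : ℕ
    edge  : Fin nL → Fin nR → Bool

  -- A (partial) assignment records the partner, if any, of each offline vertex.
  Assignment : Set
  Assignment = Vector (Maybe (Fin nR)) nL

  record IsMatching (M : Assignment) : Set where
    field
      along-edges : ∀ v u → M v ≡ just u → edge v u ≡ true
      injective   : ∀ v v′ u → M v ≡ just u → M v′ ≡ just u → v ≡ v′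

module Model (reals : CompleteOrderedField) where
  open CompleteOrderedField reals

  InUnit : ℝ → Set
  InUnit x = 0# ≤ x × x ≤ 1#

  sumVec : ∀ d n → (Vec (Fin n) d → ℝ) → ℝ
  sumVec zero    n g = g []
  sumVec (suc d) n g = sum {n} (λ k → sumVec d n (λ ks → g (k ∷ ks)))

  -- The expectation of g over d independent uniform draws from Fin n.
  mean : ∀ d n → (Vec (Fin n) d → ℝ) → ℝ
  mean d n g = sumVec d n g * fromℕ (n ℕ.^ d) ⁻¹

  -- F has Riemann integral I over [0,1]ᵈ: the Riemann sums over the grid of
  -- nᵈ equal cubes, with one arbitrary sample point t k in each cube k, tend
  -- to I uniformly in the choice of t.
  IsIntegral : ∀ d → (Vector ℝ d → ℝ) → ℝ → Set
  IsIntegral d F I =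
    ∀ ε → 0# < ε → ∃[ N ] (∀ n → N ℕ.≤ n → .{{_ : NonZero n}} →
      (t : Vec (Fin n) d → Vector ℝ d) →
      (∀ k i → toℕ (Vec.lookup k i) ÷ n ≤ t k i ×
               t k i ≤ suc (toℕ (Vec.lookup k i)) ÷ n) →
      I - ε ≤ mean d n (λ k → F (t k)) × mean d n (λ k → F (t k)) ≤ I + ε)

  -- f is total on ℝ × ℝ, but only its values on [0,1]² are constrained or used.
  record IsRankingFunction (m : ℕ) (f : ℝ → ℝ → ℝ) : Set where
    field
      range     : ∀ {x y} → InUnit x → InUnit y → InUnit (f x y)
      antitone₁ : ∀ {x x′ y} → InUnit x → InUnit x′ → InUnit y →
                  x ≤ x′ → f x′ y ≤ f x y
      monotone₂ : ∀ {x y y′} → InUnit x → InUnit y → InUnit y′ →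
                  y ≤ y′ → f x y ≤ f x y′
      at-y=1    : ∀ {x} → InUnit x → f x 1# ≈ 1#
      at-x=1    : ∀ {y} → 0# ≤ y → y < 1# → f 1# y ≈ 0#
      stepwise  : ∀ (j : Fin m) {x x′ y} → InUnit y →
                  toℕ j ÷ m ≤ x  → x  < suc (toℕ j) ÷ m →
                  toℕ j ÷ m ≤ x′ → x′ < suc (toℕ j) ÷ m →
                  f x y ≈ f x′ y

  module Weighted (G : BipartiteGraph) (w : Fin (BipartiteGraph.nL G) → ℝ) where
    open BipartiteGraph G

    totalWeight : Assignment → ℝ
    totalWeight M = sum (λ v → if is-just (M v) then w v else 0#)

    IsOptimal : Assignment → Set
    IsOptimal M = IsMatching M × (∀ M′ → IsMatching M′ → totalWeight M′ ≤ totalWeight M)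

    -- π orders the online vertices arriving in a common stage; τ breaks ties
    -- between offline vertices of equal value.  Each lists the vertices as
    -- π 0, π 1, …, earlier entries coming first, and neither depends on the
    -- random stages and ranks.
    module Ranking (m : ℕ) (f : ℝ → ℝ → ℝ)
                   (π : Permutation′ nR) (τ : Permutation′ nL) where

      arrivals : Vec (Fin m) nR → List (Fin nR)
      arrivals σ = concatMap
        (λ j → filter (λ u → Vec.lookup σ u Fin.≟ j) (map (π ⟨$⟩ʳ_) (allFin nR)))
        (allFin m)

      -- The first element of v ∷ vs at which score is largest.
      best : (Fin nL → ℝ) → Fin nL → List (Fin nL) → Fin nL
      best score v []        = v
      best score v (v′ ∷ vs) =
        if does (score v′ ≤? score v) then best score v vs else best score v′ vs

      choose : (Fin nL → ℝ) → List (Fin nL) → Maybe (Fin nL)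
      choose score []       = nothing
      choose score (v ∷ vs) = just (best score v vs)

      module _ (σ : Vec (Fin m) nR) (y : Vector ℝ nL) where

        -- Stages are numbered from 0, and f is constant in its first argument
        -- on [j/m, (j+1)/m), so j/m serves as the arrival time for stage j.
        arrivalTime : Fin nR → ℝ
        arrivalTime u = toℕ (Vec.lookup σ u) ÷ m

        available : Assignment → Fin nR → List (Fin nL)
        available M u =
          filterᵇ (λ v → edge v u ∧ not (is-just (M v))) (map (τ ⟨$⟩ʳ_) (allFin nL))

        arrive : Assignment → Fin nR → Assignment
        arrive M u = maybe′ (λ v → updateAt M v (const (just u))) M
          (choose (λ v → w v * (1# - f (arrivalTime u) (y v))) (available M u))

        outcome : Assignment
        outcome = foldl arrive (const nothing) (arrivals σ)

      IsExpectedWeight : ℝ → Set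
      IsExpectedWeight =
        IsIntegral nL (λ y → mean nR m (λ σ → totalWeight (outcome σ y)))

  RankingIsCompetitive : ℕ → ℝ → Set
  RankingIsCompetitive m c =
    Σ[ f ∈ (ℝ → ℝ → ℝ) ] (IsRankingFunction m f ×
      (∀ (G : BipartiteGraph) → let open BipartiteGraph G in
       ∀ (w : Fin nL → ℝ) → (∀ v → 0# ≤ w v) →
       ∀ (π : Permutation′ nR) (τ : Permutation′ nL) →
       let open Weighted G w in
       ∃[ E ] (Ranking.IsExpectedWeight m f π τ E ×
               (∀ M → IsOptimal M → c * totalWeight M ≤ E))))

{-# OPTIONS --safe #-}

-- The function f is a step function with n equal steps in y and the values of an
-- explicit integer table, so that ranks may be taken uniform on n cells.
--
-- When u is matched to v, let v receive w v * f and u receive w v * (1 - f).  Fix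
-- an edge (u, v) and everything except the stage j of u and the rank k of v.
-- Greedy runs are monotone: more offline vertices leave more of them free, and
-- more online vertices leave fewer.  Hence there are thresholds θ 0 ≤ θ 1 ≤ … and
-- β j such that v is matched before u's slot in stage j, in the run without u,
-- iff k < θ j, and then v still finds a partner at least as early once u is added;
-- u always receives at least what it would without v, which is at least
-- w v * (1 - f) at rank β j; and u takes v if θ j ≤ k < β j.
-- Averaging over (j, k) bounds the expected share of the edge by a finite
-- expression in the table, θ and β, which is checked for all θ and β.  Summing
-- over the edges of a matching gives the ratio.
module Submission where

open import Level using (0ℓ)
open import Axiom.ExcludedMiddle using (ExcludedMiddle)
open import Data.Product.Base using (_×_)
open import Defs

import Algebra.Properties.Ring as RingProperties
import Algebra.Properties.Semiring.Mult as SemiringMult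
import Algebra.Properties.Semiring.Sum as SemiringSum
import Algebra.Solver.Ring.NaturalCoefficients.Default as Solver
open import Data.Bool.Base using (Bool; true; false; not; _∧_; if_then_else_; T)
open import Data.Bool.Properties using (T-≡)
open import Data.Fin.Base using (Fin; zero; suc; toℕ)
open import Data.Fin.Permutation using (Permutation′; _⟨$⟩ʳ_; _⟨$⟩ˡ_; inverseʳ; inverseˡ)
import Data.Fin.Properties as Fin
open import Data.List.Base as List using (List; []; _∷_; _++_; allFin; map; filter; filterᵇ; concatMap; tabulate; foldl)
open import Data.List.Membership.Propositional using (_∈_)
open import Data.List.Membership.Propositional.Properties using (∈-map⁺; ∈-allFin; ∈-∃++)
open import Data.List.Properties using (filter-++; filter-≐; filter-accept; filter-reject; foldl-++; ++-assoc; ++-identityʳ)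
open import Data.List.Relation.Binary.Pointwise.Base using (Pointwise; []; _∷_)
open import Data.List.Relation.Unary.All as All using (All; []; _∷_)
import Data.List.Relation.Unary.All.Properties as All
open import Data.List.Relation.Unary.Any using (here; there)
open import Data.List.Relation.Unary.AllPairs using ([]; _∷_)
open import Data.List.Relation.Unary.Unique.Propositional using (Unique)
import Data.List.Relation.Unary.Unique.Propositional.Properties as Unique
open import Data.Maybe.Base using (Maybe; just; nothing; is-just; maybe′)
open import Data.Nat.Base as ℕ using (ℕ; zero; suc; NonZero; z≤n; s≤s)
import Data.Nat.DivMod as ℕ
open import Data.Nat.DivMod using (_mod_)
open import Data.Nat.Divisibility using (n∣m*n)
import Data.Nat.Properties as ℕ
open import Data.Product.Base using (Σ-syntax; ∃-syntax; ∃₂; _,_; proj₁; proj₂)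
open import Data.Sum.Base using (_⊎_; inj₁; inj₂)
open import Data.Unit.Base using (tt)
open import Data.Vec.Base as Vec using (Vec; []; _∷_; lookup; _[_]≔_)
import Data.Vec.Properties as Vec
open import Data.Vec.Properties using (lookup∘update; lookup∘update′)
open import Data.Vec.Functional using (Vector; updateAt)
open import Data.Vec.Functional.Properties using (updateAt-updates; updateAt-minimal)
open import Function.Base using (_∘_; id; const)
open import Function.Bundles using (Equivalence)
open import Relation.Binary.Bundles using (Poset)
open import Relation.Binary.PropositionalEquality as ≡ using (_≡_; _≢_)
import Relation.Binary.Reasoning.PartialOrder as PosetReasoning
import Relation.Binary.Reasoning.Setoid as SetoidReasoning
open import Relation.Binary.Structures using (IsDecTotalOrder)
open import Relation.Nullary using (¬_; Dec; yes; no; does; contradiction)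
open import Relation.Nullary.Decidable using (toWitness)

-- The weight `w v` factors out of the inequality for an edge, and the graph enters it only through
-- θ and β. So one finite check serves all graphs, weights, arrival orders and tie-breaking rules.
-- It is carried out by evaluation during type checking, hence on natural numbers over a common
-- denominator `D`; real arithmetic comes only afterwards. The check is feasible because, once θ is
-- fixed, β j occurs in the sum over stage j alone. The worst β j is then found for each stage
-- separately, and only the nondecreasing tuples θ have to be enumerated. Since the order within a
-- stage is arbitrary, thresholds belong to slots and not to whole stages: slot j is the place that
-- u would take in stage j. All slots are places in one and the same run without u, which makes the
-- θ j comparable with each other. A step function also settles that the expected weight exists: the
-- integrand is constant on cells, so its integral is a finite mean.

module Certificate where
  open import Data.Nat.Base
  open import Data.Nat.ListAction using (sum)
  open import Data.Nat.Properties
  open import Data.Nat.Solver using (module +-*-Solver)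
  open import Relation.Binary.PropositionalEquality

  -- Finite sums and comparisons of natural numbers

  Σ< : ℕ → (ℕ → ℕ) → ℕ
  Σ< zero    f = 0
  Σ< (suc n) f = f 0 + Σ< n (f ∘ suc)

  Σ<-mono : ∀ n {f g : ℕ → ℕ} → (∀ {k} → k < n → f k ≤ g k) → Σ< n f ≤ Σ< n g
  Σ<-mono zero    f≤g = z≤n
  Σ<-mono (suc n) f≤g = +-mono-≤ (f≤g (s≤s z≤n)) (Σ<-mono n (f≤g ∘ s≤s))

  Σ<-cong : ∀ n {f g : ℕ → ℕ} → (∀ {k} → k < n → f k ≡ g k) → Σ< n f ≡ Σ< n g
  Σ<-cong zero    f≡g = refl
  Σ<-cong (suc n) f≡g = cong₂ _+_ (f≡g (s≤s z≤n)) (Σ<-cong n (f≡g ∘ s≤s))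

  Σ<-+ : ∀ n (f g : ℕ → ℕ) → Σ< n (λ k → f k + g k) ≡ Σ< n f + Σ< n g
  Σ<-+ zero    f g = refl
  Σ<-+ (suc n) f g = trans (cong (f 0 + g 0 +_) (Σ<-+ n (f ∘ suc) (g ∘ suc)))
    (solve 4 (λ a b c d → a :+ b :+ (c :+ d) := a :+ c :+ (b :+ d)) refl
      (f 0) (g 0) (Σ< n (f ∘ suc)) (Σ< n (g ∘ suc)))
    where open +-*-Solver

  Σ<-const : ∀ n c → Σ< n (λ _ → c) ≡ n * c
  Σ<-const zero    c = refl
  Σ<-const (suc n) c = cong (c +_) (Σ<-const n c)

  Σ<-snoc : ∀ n (f : ℕ → ℕ) → Σ< (suc n) f ≡ Σ< n f + f n
  Σ<-snoc zero    f = +-comm (f 0) 0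
  Σ<-snoc (suc n) f = trans (cong (f 0 +_) (Σ<-snoc n (f ∘ suc)))
    (sym (+-assoc (f 0) (Σ< n (f ∘ suc)) (f (suc n))))

  Σ<-++ : ∀ k r (f : ℕ → ℕ) → Σ< (k + r) f ≡ Σ< k f + Σ< r (λ i → f (k + i))
  Σ<-++ zero    r f = refl
  Σ<-++ (suc k) r f = trans (cong (f 0 +_) (Σ<-++ k r (f ∘ suc)))
    (sym (+-assoc (f 0) (Σ< k (f ∘ suc)) _))

  -- Built on `<ᵇ`, which evaluates on binary numbers; recursion on successors would be hopeless for
  -- the nine-digit numbers of the scan.
  max : ℕ → ℕ → ℕ
  max x y = if x <ᵇ y then y else x

  x≤max : ∀ x y → x ≤ max x y
  x≤max x y with x <ᵇ y in eq
  ... | true  = <⇒≤ (<ᵇ⇒< x y (Equivalence.from T-≡ eq))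
  ... | false = ≤-refl

  y≤max : ∀ x y → y ≤ max x y
  y≤max x y with x <ᵇ y in eq
  ... | true  = ≤-refl
  ... | false = ≮⇒≥ (λ x<y → subst T eq (<⇒<ᵇ x<y))

  <ᵇ-true : ∀ {x y} → x < y → (x <ᵇ y) ≡ true
  <ᵇ-true x<y = Equivalence.to T-≡ (<⇒<ᵇ x<y)

  <ᵇ-false : ∀ {x y} → y ≤ x → (x <ᵇ y) ≡ false
  <ᵇ-false {x} {y} y≤x with x <ᵇ y in eq
  ... | true  = contradiction (<ᵇ⇒< x y (Equivalence.from T-≡ eq)) (≤⇒≯ y≤x)
  ... | false = refl

  ∧-true : ∀ {x y} → x ∧ y ≡ true → x ≡ true × y ≡ true
  ∧-true {true} y≡true = refl , y≡true

  ≤ᵇ-true : ∀ {x y} → x ≤ y → (x ≤ᵇ y) ≡ true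
  ≤ᵇ-true x≤y = Equivalence.to T-≡ (≤⇒≤ᵇ x≤y)

  ≤ᵇ-false : ∀ {x y} → y < x → (x ≤ᵇ y) ≡ false
  ≤ᵇ-false {suc x} (s≤s y≤x) = <ᵇ-false y≤x

  -- For an edge (u, v): ranks below θ j get v matched before u's slot in stage j,
  -- and at ranks below β j vertex u prefers v to every alternative.  A gain is a
  -- lower bound, in units of w v / D, on the two shares when u arrives in stage j
  -- and v has rank k.
  module Gain (m n D : ℕ) (a : ℕ → ℕ → ℕ) (θ : ℕ → ℕ) where

    -- The first stage `j` with `k < θ j` bounds the stage of the partner of `v` and so yields the
    -- largest guaranteed value. If there is none, `v` may stay unmatched, hence the 0.
    offlineFrom : (j s : ℕ) → ℕ → ℕ
    offlineFrom j zero    k = 0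
    offlineFrom j (suc s) k = if k <ᵇ θ j then a j k else offlineFrom (suc j) s k

    offline : ℕ → ℕ
    offline = offlineFrom 0 m

    gain : (β j k : ℕ) → ℕ
    gain β j k = if (θ j ≤ᵇ k) ∧ (k <ᵇ β) then D else offline k + (D ∸ a j β)

  -- Exhaustive search over the thresholds and its soundness

  module Scan (m n B : ℕ) (a : ℕ → ℕ → ℕ) where

    -- Each term comes with the maximum of the list from there on.
    Annotated : Set
    Annotated = List (ℕ × ℕ)

    top : Annotated → ℕ
    top []            = 0
    top ((_ , s) ∷ _) = s

    -- The helper takes the tail as an argument, so that evaluation can share it between the maximum
    -- and the list.
    annotate : (ℕ → ℕ) → ℕ → ℕ → Annotated
    annotate h k zero    = (h k , h k) ∷ []
    annotate h k (suc r) = annotate₁ (annotate h (suc k) r)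
      where
      annotate₁ : Annotated → Annotated
      annotate₁ l = (h k , max (h k) (top l)) ∷ l

    -- Summed over k, the gains of stage j miss n * D + Σ offline + Σ_{k < θ j} offline
    -- by at most term j (θ j) b + Σ_{k < b} offline, where b = max (θ j) (β j).
    term : ℕ → ℕ → ℕ → ℕ
    term j θ b = (n ∸ (b ∸ θ)) * a j b

    Row : Set
    Row = List (ℕ × Annotated)

    -- Each entry prepares the case that the threshold of stage `j` is placed at that position: the
    -- terms for all `b` from there to `n`. The branches of the scan share these lists.
    row : ℕ → ℕ → ℕ → Row
    row j k zero    = (a j k , annotate (term j k) k zero) ∷ []
    row j k (suc r) = (a j k , annotate (term j k) k (suc r)) ∷ row j (suc k) r

    rows : (j s k r : ℕ) → Vec Row s
    rows j zero    k r = []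
    rows j (suc s) k r = row j k r ∷ rows (suc j) s k r

    tail : ∀ {A : Set} → List A → List A
    tail []       = []
    tail (_ ∷ xs) = xs

    hd : Row → ℕ × Annotated
    hd []      = 0 , []
    hd (x ∷ _) = x

    step : ℕ → ℕ × Annotated → ℕ × Annotated
    step A (r , [])          = r , []
    step A (r , (t , _) ∷ l) = max r (t + A) , l

    -- Beyond the last threshold the sum of `offline` stays at `A`, so the suffix maximum of the
    -- terms settles all remaining `b` at once.
    close : ℕ → List (ℕ × Annotated) → ℕ
    close A []             = 0
    close A ((r , l) ∷ os) = max r (top l + A) + close A os

    -- Enumerates the thresholds in ascending order.  At position k = n ∸ r the last
    -- s thresholds are still to be placed, A is the sum of offline below k, and acc
    -- sums A over the placed thresholds.  Placed stages carry the largest deficit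
    -- for b < k and the terms for b ≥ k, so that b need not be enumerated.
    scan : (s r : ℕ) → Vec Row s → List (ℕ × Annotated) → ℕ → ℕ → Bool
    scan zero    r       []       os A acc = close A os <ᵇ suc (m * A + acc + B)
    scan (suc s) zero    (L ∷ Ls) os A acc =
      scan s zero Ls ((0 , proj₂ (hd L)) ∷ os) A (acc + A)
    scan (suc s) (suc r) (L ∷ Ls) os A acc =
      scan s (suc r) Ls ((0 , proj₂ (hd L)) ∷ os) A (acc + A) ∧
      scan (suc s) r (Vec.map tail (L ∷ Ls)) (List.map (step A) os) (A + proj₁ (hd L)) acc

    check : Bool
    check = scan m n (rows 0 m 0 n) [] 0 0

    top-annotate : ∀ h k r {b} → k ≤ b → b ≤ k + r → h b ≤ top (annotate h k r)
    top-annotate h k zero    {b} k≤b b≤k+r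
      rewrite ≤-antisym k≤b (≤-trans b≤k+r (≤-reflexive (+-identityʳ k))) = ≤-refl
    top-annotate h k (suc r) {b} k≤b b≤k+r with k ≟ b
    ... | yes refl = x≤max (h k) (top (annotate h (suc k) r))
    ... | no  k≢b  = ≤-trans
      (top-annotate h (suc k) r (≤∧≢⇒< k≤b k≢b) (≤-trans b≤k+r (≤-reflexive (+-suc k r))))
      (y≤max (h k) (top (annotate h (suc k) r)))

    rows-tail : ∀ j s k r → Vec.map tail (rows j s k (suc r)) ≡ rows j s (suc k) r
    rows-tail j zero    k r = refl
    rows-tail j (suc s) k r = cong (row j (suc k) r ∷_) (rows-tail (suc j) s k r)

    module Sound (D : ℕ) (θ β : ℕ → ℕ)
      (θ-mono : ∀ {i j} → i ≤ j → θ i ≤ θ j) (β≤n : ∀ j → β j ≤ n)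
      (θ≤β : ∀ j → θ j ≤ β j) where
      open Gain m n D a θ

      P : ℕ → ℕ
      P k = Σ< k offline

      Y : ℕ → ℕ
      Y j = term j (θ j) (β j) + P (β j)

      θ≤n : ∀ j → θ j ≤ n
      θ≤n j = ≤-trans (θ≤β j) (β≤n j)

      skip : ∀ i d s {k} → (∀ {i′} → i′ < i + d → θ i′ ≤ k) →
             offlineFrom i (d + s) k ≡ offlineFrom (i + d) s k
      skip i zero    s below = cong (λ j → offlineFrom j s _) (sym (+-identityʳ i))
      skip i (suc d) s {k} below
        rewrite <ᵇ-false {k} {θ i} (below (m<m+n i (s≤s z≤n))) =
        trans (skip (suc i) d s (λ {i′} i′<1+i+d → below (subst (i′ <_) (sym (+-suc i d)) i′<1+i+d)))
              (cong (λ j → offlineFrom j s k) (sym (+-suc i d)))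

      offline-at : ∀ {j s k} → j + s ≡ m → (∀ {i} → i < j → θ i ≤ k) →
                   offline k ≡ offlineFrom j s k
      offline-at {j} {s} refl below = skip 0 j s below

      -- Past all thresholds no stage guarantees a partner for `v`, so the summands of `P` are 0
      -- from there on.
      P-flat : ∀ {k b} → (∀ {i} → i < m → θ i ≤ k) → k ≤ b → P b ≡ P k
      P-flat {k} {b} below k≤b = begin
        P b                                   ≡⟨ cong P (sym (m+[n∸m]≡n k≤b)) ⟩
        P (k + (b ∸ k))                       ≡⟨ Σ<-++ k (b ∸ k) offline ⟩
        P k + Σ< (b ∸ k) (offline ∘ (k +_))   ≡⟨ cong (P k +_) (Σ<-cong (b ∸ k) λ {i} _ →
                                                   offline-at (+-identityʳ m)
                                                     (λ i<m → ≤-trans (below i<m) (m≤m+n k i))) ⟩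
        P k + Σ< (b ∸ k) (λ _ → 0)            ≡⟨ cong (P k +_) (Σ<-const (b ∸ k) 0) ⟩
        P k + (b ∸ k) * 0                     ≡⟨ cong (P k +_) (*-zeroʳ (b ∸ k)) ⟩
        P k + 0                               ≡⟨ +-identityʳ (P k) ⟩
        P k                                   ∎
        where open ≡-Reasoning

      -- Invariant of a placed stage with deficit `y`: either its `b` lies behind `k` and the
      -- running maximum `x` covers it, or its `b` lies ahead and the term is still in the annotated
      -- list.
      Open : ℕ → ℕ → ℕ × Annotated → ℕ → Set
      Open k r (x , l) y = Σ[ h ∈ (ℕ → ℕ) ] l ≡ annotate h k r ×
        (y ≤ x ⊎ ∃[ b ] k ≤ b × b ≤ n × y ≡ h b + P b)

      Open-step : ∀ {k r xl y} → Open k (suc r) xl y → Open (suc k) r (step (P k) xl) y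
      Open-step {k} {r} {x , _} (h , refl , inj₁ y≤x) =
        h , refl , inj₁ (≤-trans y≤x (x≤max x (h k + P k)))
      Open-step {k} {r} {x , _} (h , refl , inj₂ (b , k≤b , b≤n , refl)) with k ≟ b
      ... | yes refl = h , refl , inj₁ (y≤max x (h k + P k))
      ... | no  k≢b  = h , refl , inj₂ (b , ≤∧≢⇒< k≤b k≢b , b≤n , refl)

      Open-steps : ∀ {k r os ys} → Pointwise (Open k (suc r)) os ys →
                   Pointwise (Open (suc k) r) (List.map (step (P k)) os) ys
      Open-steps []       = []
      Open-steps (o ∷ os) = Open-step o ∷ Open-steps os

      close-sound : ∀ {k r os ys} → k + r ≡ n → (∀ {i} → i < m → θ i ≤ k) →
                    Pointwise (Open k r) os ys → sum ys ≤ close (P k) os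
      close-sound k+r≡n below [] = z≤n
      close-sound {k} {r} {os = (x , _) ∷ _} k+r≡n below ((h , refl , inj₁ y≤x) ∷ os) =
        +-mono-≤ (≤-trans y≤x (x≤max x (top (annotate h k r) + P k))) (close-sound k+r≡n below os)
      close-sound {k} {r} {os = (x , _) ∷ _} k+r≡n below ((h , refl , inj₂ (b , k≤b , b≤n , refl)) ∷ os) =
        +-mono-≤ (≤-trans (+-mono-≤ (top-annotate h k r k≤b (≤-trans b≤n (≤-reflexive (sym k+r≡n))))
                                    (≤-reflexive (P-flat below k≤b)))
                          (y≤max x (top (annotate h k r) + P k)))
                 (close-sound k+r≡n below os)

      -- Invariant of the scan: `j` thresholds lie at or below `k`, the next one has not been
      -- passed, and `ys` are the deficits of the placed stages. The proof follows the branch that θ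
      -- prescribes down to a leaf, whose test is the inequality.
      sound : ∀ s r {j k os ys acc} → j + s ≡ m → k + r ≡ n →
              (∀ {i} → i < j → θ i ≤ k) → k ≤ θ j ⊎ s ≡ 0 →
              Pointwise (Open k r) os ys →
              scan s r (rows j s k r) os (P k) acc ≡ true →
              sum ys + Σ< s (λ i → Y (j + i)) ≤
                m * P n + (acc + Σ< s (λ i → P (θ (j + i)))) + B

      -- The case that the next threshold sits exactly at `k`, common to the interior and the right
      -- end of the range.
      sound-open : ∀ s r {j k os ys acc} → j + suc s ≡ m → k + r ≡ n →
        (∀ {i} → i < j → θ i ≤ k) → θ j ≡ k →
        Pointwise (Open k r) os ys →
        scan s r (rows (suc j) s k r) ((0 , annotate (term j k) k r) ∷ os) (P k) (acc + P k) ≡ true →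
        sum ys + Σ< (suc s) (λ i → Y (j + i)) ≤
          m * P n + (acc + Σ< (suc s) (λ i → P (θ (j + i)))) + B

      sound zero r {j} {k} {os} {ys} {acc} j+0≡m k+r≡n below _ opens ok = begin
        sum ys + 0               ≡⟨ +-identityʳ _ ⟩
        sum ys                   ≤⟨ close-sound k+r≡n below′ opens ⟩
        close (P k) os                ≤⟨ ≤-pred (<ᵇ⇒< _ _ (Equivalence.from T-≡ ok)) ⟩
        m * P k + acc + B             ≡⟨ cong₂ (λ p q → m * p + q + B)
                                           (sym (P-flat below′ (m+n≤o⇒m≤o k (≤-reflexive k+r≡n))))
                                           (sym (+-identityʳ acc)) ⟩
        m * P n + (acc + 0) + B       ∎
        where
        open ≤-Reasoning
        below′ : ∀ {i} → i < m → θ i ≤ k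
        below′ i<m = below (≤-trans i<m (≤-reflexive (trans (sym j+0≡m) (+-identityʳ j))))
      -- At the right end `k` equals `n`, and `θ j ≤ n` forces the threshold to be placed here.
      sound (suc s) zero {j} {k} j+s≡m k+0≡n below (inj₁ k≤θ) opens ok =
        sound-open s zero j+s≡m k+0≡n below
          (≤-antisym (≤-trans (θ≤n j) (≤-reflexive (trans (sym k+0≡n) (+-identityʳ k)))) k≤θ)
          opens ok
      sound (suc s) (suc r) {j} {k} {os} {ys} {acc} j+s≡m k+r≡n below (inj₁ k≤θ) opens ok with k ≟ θ j
      ... | yes k≡θ = sound-open s (suc r) j+s≡m k+r≡n below (sym k≡θ) opens (proj₁ (∧-true ok))
      ... | no  k≢θ = sound (suc s) r j+s≡m (trans (sym (+-suc k r)) k+r≡n)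
        (λ i<j → m≤n⇒m≤1+n (below i<j)) (inj₁ k<θ) (Open-steps opens)
        (trans (cong₂ (λ Ls A → scan (suc s) r (row j (suc k) r ∷ Ls) (List.map (step (P k)) os) A acc)
                  (sym (rows-tail (suc j) s k r)) P-suc)
               (proj₂ (∧-true ok)))
        where
        k<θ : k < θ j
        k<θ = ≤∧≢⇒< k≤θ k≢θ
        -- Earlier thresholds are at most `k` and θ j exceeds it, so stage `j` is the first to
        -- guarantee a partner at rank `k`.
        P-suc : P (suc k) ≡ P k + a j k
        P-suc = trans (Σ<-snoc k offline) (cong (P k +_)
          (trans (offline-at j+s≡m below) (cong (if_then a j k else offlineFrom (suc j) s k) (<ᵇ-true k<θ))))

      sound-open s r {j} {k} {os} {ys} {acc} j+s≡m k+r≡n below θ≡k opens ok = begin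
        sum ys + (Y (j + 0) + Σ< s (λ i → Y (j + suc i)))  ≡⟨ cong (sum ys +_) (cong₂ _+_
                                                                     (cong Y (+-identityʳ j))
                                                                     (Σ<-cong s λ {i} _ → cong Y (+-suc j i))) ⟩
        sum ys + (Y j + rest)                              ≡⟨ solve 3 (λ x y z → x :+ (y :+ z) := y :+ x :+ z) refl
                                                                     (sum ys) (Y j) rest ⟩
        sum (Y j ∷ ys) + rest                              ≤⟨ sound s r (trans (sym (+-suc j s)) j+s≡m) k+r≡n
                                                                     below′ (inj₁ k≤θ) (new ∷ opens) ok ⟩
        m * P n + (acc + P k + rest′) + B                       ≡⟨ cong (λ x → m * P n + x + B) (trans (+-assoc acc (P k) rest′)
                                                                     (cong (acc +_) (sym (cong₂ _+_
                                                                       (cong P (trans (cong θ (+-identityʳ j)) θ≡k))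
                                                                       (Σ<-cong s λ {i} _ → cong (P ∘ θ) (+-suc j i)))))) ⟩
        m * P n + (acc + (P (θ (j + 0)) + Σ< s (λ i → P (θ (j + suc i))))) + B ∎
        where
        open ≤-Reasoning
        open +-*-Solver
        rest rest′ : ℕ
        rest  = Σ< s (λ i → Y (suc j + i))
        rest′ = Σ< s (λ i → P (θ (suc j + i)))
        below′ : ∀ {i} → i < suc j → θ i ≤ k
        below′ i≤j = ≤-trans (θ-mono (≤-pred i≤j)) (≤-reflexive θ≡k)
        k≤θ : k ≤ θ (suc j)
        k≤θ = ≤-trans (≤-reflexive (sym θ≡k)) (θ-mono (n≤1+n j))
        new : Open k r (0 , annotate (term j k) k r) (Y j)
        new = term j k , refl , inj₂ (β j , ≤-trans (≤-reflexive (sym θ≡k)) (θ≤β j) , β≤n j ,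
          cong (λ t → term j t (β j) + P (β j)) θ≡k)

      Σ<-restrict : ∀ {b} (f : ℕ → ℕ) → b ≤ n → Σ< n (λ k → if k <ᵇ b then f k else 0) ≡ Σ< b f
      Σ<-restrict {b} f b≤n = begin
        Σ< n g                                       ≡⟨ cong (λ n → Σ< n g) (sym (m+[n∸m]≡n b≤n)) ⟩
        Σ< (b + (n ∸ b)) g                           ≡⟨ Σ<-++ b (n ∸ b) g ⟩
        Σ< b g + Σ< (n ∸ b) (g ∘ (b +_))             ≡⟨ cong₂ _+_
          (Σ<-cong b λ {k} k<b → cong (if_then f k else 0) (<ᵇ-true k<b))
          (Σ<-cong (n ∸ b) λ {i} _ → cong (if_then f (b + i) else 0) (<ᵇ-false (m≤m+n b i))) ⟩
        Σ< b f + Σ< (n ∸ b) (λ _ → 0)                ≡⟨ cong (Σ< b f +_) (trans (Σ<-const (n ∸ b) 0) (*-zeroʳ (n ∸ b))) ⟩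
        Σ< b f + 0                                   ≡⟨ +-identityʳ _ ⟩
        Σ< b f                                       ∎
        where
        open ≡-Reasoning
        g : ℕ → ℕ
        g k = if k <ᵇ b then f k else 0

    module GainBound (D target : ℕ) (θ β : ℕ → ℕ)
      (a-mono : ∀ j {k k′} → k ≤ k′ → a j k ≤ a j k′)
      (θ-mono : ∀ {i j} → i ≤ j → θ i ≤ θ j) (θ≤n : ∀ j → θ j ≤ n) (β≤n : ∀ j → β j ≤ n) where
      open Gain m n D a θ

      -- If β j is below θ j, the interval on which `u` takes `v` is empty. Raising β j to θ j keeps
      -- it empty and only weakens the bound, as `a` is nondecreasing in the rank.
      b : ℕ → ℕ
      b j = θ j ⊔ β j

      b≤n : ∀ j → b j ≤ n
      b≤n j = ⊔-lub (θ≤n j) (β≤n j)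

      θ≤b : ∀ j → θ j ≤ b j
      θ≤b j = m≤m⊔n (θ j) (β j)

      open Sound D θ b θ-mono b≤n θ≤b using (P; Y; sound; Σ<-restrict)

      k<β : ∀ j {k} → ¬ k < θ j → k < b j → k < β j
      k<β j k≮θ k<b with ⊔-sel (θ j) (β j)
      ... | inj₁ b≡θ = contradiction (subst (_ <_) b≡θ k<b) k≮θ
      ... | inj₂ b≡β = subst (_ <_) b≡β k<b

      -- The inequality of `stage` before summation, with negative terms moved across. Below θ j and
      -- from `b j` on it amounts to `D ≤ x + (D ∸ x)` and the monotonicity of `a`; in between both
      -- sides are equal.
      pointwise : ∀ j k →
        offline k + D + (if k <ᵇ θ j then offline k else 0) + (if k <ᵇ b j then a j (b j) else 0) ≤
        gain (β j) j k + a j (b j) + (if k <ᵇ θ j then a j (b j) else 0) + (if k <ᵇ b j then offline k else 0)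
      pointwise j k with k <? θ j
      ... | yes k<θ rewrite <ᵇ-true k<θ | <ᵇ-true (<-≤-trans k<θ (θ≤b j)) | ≤ᵇ-false k<θ = begin
        o + D + o + x                  ≤⟨ +-monoˡ-≤ x (+-monoˡ-≤ o (+-monoʳ-≤ o (m≤n+m∸n D x))) ⟩
        o + (x + (D ∸ x)) + o + x      ≤⟨ +-monoˡ-≤ x (+-monoˡ-≤ o (+-monoʳ-≤ o (+-monoʳ-≤ x
                                            (∸-monoʳ-≤ D (a-mono j (m≤n⊔m (θ j) (β j))))))) ⟩
        o + (x + (D ∸ y)) + o + x      ≡⟨ solve 3 (λ o x z → o :+ (x :+ z) :+ o :+ x := o :+ z :+ x :+ x :+ o) refl o x (D ∸ y) ⟩
        o + (D ∸ y) + x + x + o        ∎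
        where
        open ≤-Reasoning
        open +-*-Solver
        o x y : ℕ
        o = offline k
        x = a j (b j)
        y = a j (β j)
      ... | no k≮θ with k <? b j
      ...   | yes k<b rewrite <ᵇ-false (≮⇒≥ k≮θ) | <ᵇ-true k<b | ≤ᵇ-true (≮⇒≥ k≮θ)
                            | <ᵇ-true (k<β j k≮θ k<b) =
        ≤-reflexive (solve 3 (λ o D x → o :+ D :+ con 0 :+ x := D :+ x :+ con 0 :+ o) refl (offline k) D (a j (b j)))
        where open +-*-Solver
      ...   | no k≮b rewrite <ᵇ-false (≮⇒≥ k≮θ) | <ᵇ-false (≮⇒≥ k≮b) | ≤ᵇ-true (≮⇒≥ k≮θ)
                           | <ᵇ-false {k} {β j} (≤-trans (m≤n⊔m (θ j) (β j)) (≮⇒≥ k≮b)) = begin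
        o + D + 0 + 0                  ≤⟨ +-monoˡ-≤ 0 (+-monoˡ-≤ 0 (+-monoʳ-≤ o (m≤n+m∸n D x))) ⟩
        o + (x + (D ∸ x)) + 0 + 0      ≤⟨ +-monoˡ-≤ 0 (+-monoˡ-≤ 0 (+-monoʳ-≤ o (+-monoʳ-≤ x
                                            (∸-monoʳ-≤ D (a-mono j (m≤n⊔m (θ j) (β j))))))) ⟩
        o + (x + (D ∸ y)) + 0 + 0      ≡⟨ solve 3 (λ o x z → o :+ (x :+ z) :+ con 0 :+ con 0 := o :+ z :+ x :+ con 0 :+ con 0) refl o x (D ∸ y) ⟩
        o + (D ∸ y) + x + 0 + 0        ∎
        where
        open ≤-Reasoning
        open +-*-Solver
        o x y : ℕ
        o = offline k
        x = a j (b j)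
        y = a j (β j)

      Σ₄ : ∀ f g h i → Σ< n (λ k → f k + g k + h k + i k) ≡ Σ< n f + Σ< n g + Σ< n h + Σ< n i
      Σ₄ f g h i = trans (Σ<-+ n _ i) (cong (_+ Σ< n i)
        (trans (Σ<-+ n _ h) (cong (_+ Σ< n h) (Σ<-+ n f g))))

      stage : ∀ j → P n + P (θ j) + n * D ≤ Σ< n (gain (β j) j) + Y j
      -- Summing `pointwise` gives the claim with `b j * x` added on both sides.
      stage j = +-cancelʳ-≤ (b j * x) _ _ (begin
        P n + P (θ j) + n * D + b j * x       ≡⟨ solve 4 (λ p q d b → p :+ q :+ d :+ b := p :+ d :+ q :+ b) refl
                                                   (P n) (P (θ j)) (n * D) (b j * x) ⟩
        P n + n * D + P (θ j) + b j * x       ≡⟨ cong₂ _+_ (cong₂ _+_ (cong (P n +_) (sym (Σ<-const n D)))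
                                                   (sym (Σ<-restrict offline (θ≤n j)))) (sym (restrict-const (b≤n j))) ⟩
        _                                     ≡⟨ sym (Σ₄ offline (λ _ → D) _ _) ⟩
        _                                     ≤⟨ Σ<-mono n (λ {k} _ → pointwise j k) ⟩
        _                                     ≡⟨ Σ₄ (gain (β j) j) (λ _ → x) _ _ ⟩
        _                                     ≡⟨ cong₂ _+_ (cong₂ _+_ (cong (G +_) (Σ<-const n x))
                                                   (restrict-const (θ≤n j))) (Σ<-restrict offline (b≤n j)) ⟩
        G + n * x + θ j * x + P (b j)         ≡⟨ solve 4 (λ g n t p → g :+ n :+ t :+ p := g :+ (n :+ t) :+ p) refl
                                                   G (n * x) (θ j * x) (P (b j)) ⟩
        G + (n * x + θ j * x) + P (b j)       ≡⟨ cong (λ z → G + z + P (b j)) weight ⟩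
        G + (w + b j * x) + P (b j)           ≡⟨ solve 4 (λ g w b p → g :+ (w :+ b) :+ p := g :+ (w :+ p) :+ b) refl
                                                   G w (b j * x) (P (b j)) ⟩
        G + (w + P (b j)) + b j * x           ∎)
        where
        open ≤-Reasoning
        open +-*-Solver
        x w G : ℕ
        x = a j (b j)
        w = term j (θ j) (b j)
        G = Σ< n (gain (β j) j)
        restrict-const : ∀ {c} → c ≤ n → Σ< n (λ k → if k <ᵇ c then x else 0) ≡ c * x
        restrict-const {c} c≤n = trans (Σ<-restrict (λ _ → x) c≤n) (Σ<-const c x)
        weight : n * x + θ j * x ≡ w + b j * x
        weight = trans (sym (*-distribʳ-+ x n (θ j))) (trans (cong (_* x)
          (sym (begin-equality
            n ∸ d + b j            ≡⟨ cong (n ∸ d +_) (sym (m∸n+n≡m (θ≤b j))) ⟩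
            n ∸ d + (d + θ j)      ≡⟨ sym (+-assoc (n ∸ d) d (θ j)) ⟩
            n ∸ d + d + θ j        ≡⟨ cong (_+ θ j) (m∸n+n≡m (≤-trans (m∸n≤m (b j) (θ j)) (b≤n j))) ⟩
            n + θ j                ∎)))
          (*-distribʳ-+ x (n ∸ d) (b j)))
          where
          d : ℕ
          d = b j ∸ θ j

      -- `B` is the loss that the target permits: with full shares, the `m * n` choices of stage and
      -- rank would add up to `m * (n * D)`.
      total : check ≡ true → target + B ≡ m * (n * D) → target ≤ Σ< m (λ j → Σ< n (gain (β j) j))
      total ok target+B = +-cancelʳ-≤ (B + m * P n + ΣP) _ _ (begin
        target + (B + m * P n + ΣP)      ≡⟨ solve 4 (λ t b p q → t :+ (b :+ p :+ q) := p :+ q :+ (t :+ b)) refl target B (m * P n) ΣP ⟩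
        m * P n + ΣP + (target + B)      ≡⟨ cong₂ (λ p q → p + ΣP + q) (sym (Σ<-const m (P n))) (trans target+B (sym (Σ<-const m (n * D)))) ⟩
        Σ< m (λ _ → P n) + ΣP + Σ< m (λ _ → n * D)
                                         ≡⟨ sym (trans (Σ<-+ m _ _) (cong (_+ Σ< m (λ _ → n * D)) (Σ<-+ m _ _))) ⟩
        Σ< m (λ j → P n + P (θ j) + n * D) ≤⟨ Σ<-mono m (λ {j} _ → stage j) ⟩
        Σ< m (λ j → G j + Y j)           ≡⟨ Σ<-+ m _ _ ⟩
        Σ< m G + Σ< m Y                  ≤⟨ +-monoʳ-≤ (Σ< m G) (sound m n refl refl (λ ()) (inj₁ z≤n) [] ok) ⟩
        Σ< m G + (m * P n + ΣP + B)      ≡⟨ solve 4 (λ g p q b → g :+ (p :+ q :+ b) := g :+ (b :+ p :+ q)) refl (Σ< m G) (m * P n) ΣP B ⟩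
        Σ< m G + (B + m * P n + ΣP)      ∎)
        where
        open ≤-Reasoning
        open +-*-Solver
        G : ℕ → ℕ
        G j = Σ< n (gain (β j) j)
        ΣP : ℕ
        ΣP = Σ< m (λ j → P (θ j))

  -- Row j < m and column k < n hold D times the value of f in stage j on
  -- [k/n,(k+1)/n); column n stands for y = 1 and row m for x = 1.
  record Table (m n D : ℕ) : Set where
    field
      a         : ℕ → ℕ → ℕ
      a-suc-≥   : ∀ j k → a (suc j) k ≤ a j k
      a-suc-≤   : ∀ j k → a j k ≤ a j (suc k)
      a-at-y=1  : ∀ j → a j n ≡ D
      a-at-x=1  : ∀ {k} → k < n → a m k ≡ 0

    a-antitone : ∀ {j j′} k → j ≤ j′ → a j′ k ≤ a j k
    a-antitone k j≤j′ = go (≤⇒≤′ j≤j′)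
      where
      go : ∀ {j j′} → j ≤′ j′ → a j′ k ≤ a j k
      go ≤′-refl          = ≤-refl
      go (≤′-step j≤j′) = ≤-trans (a-suc-≥ _ k) (go j≤j′)

    a-monotone : ∀ j {k k′} → k ≤ k′ → a j k ≤ a j k′
    a-monotone j k≤k′ = go (≤⇒≤′ k≤k′)
      where
      go : ∀ {k k′} → k ≤′ k′ → a j k ≤ a j k′
      go ≤′-refl          = ≤-refl
      go (≤′-step k≤k′) = ≤-trans (go k≤k′) (a-suc-≤ j _)

    a≤D : ∀ j {k} → k ≤ n → a j k ≤ D
    a≤D j k≤n = ≤-trans (a-monotone j k≤n) (≤-reflexive (a-at-y=1 j))

    open Gain m n D a public

    Guarantees : ℕ → Set
    Guarantees target = ∀ (θ β : ℕ → ℕ) → (∀ {i j} → i ≤ j → θ i ≤ θ j) → (∀ j → θ j ≤ n) → (∀ j → β j ≤ n) →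
      target ≤ Σ< m (λ j → Σ< n (gain θ (β j) j))

  -- From lists of values to tables

  nth : {A : Set} → A → List A → ℕ → A
  nth d []       k       = d
  nth d (x ∷ xs) zero    = x
  nth d (x ∷ xs) (suc k) = nth d xs k

  module Verify (m n D B target : ℕ) (values : List (List ℕ)) where

    -- The boundary values at x = 1 and y = 1 are supplied here. The column is tested first, because
    -- at the corner x = y = 1 the value has to be `D` and not 0.
    entry : ℕ → ℕ → ℕ
    entry j k = if k <ᵇ n then (if j <ᵇ m then nth 0 (nth [] values j) k else 0) else D

    Increasing Decreasing : Set
    Increasing = ∀ {j} → j < m → ∀ {k} → k < n → entry j k ≤ entry j (suc k)
    Decreasing = ∀ {j} → j < m → ∀ {k} → k < n → entry (suc j) k ≤ entry j k

    increasing? : Dec Increasing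
    increasing? = allUpTo? (λ j → allUpTo? (λ k → entry j k ≤? entry j (suc k)) n) m

    decreasing? : Dec Decreasing
    decreasing? = allUpTo? (λ j → allUpTo? (λ k → entry (suc j) k ≤? entry j k) n) m

    entry-at-end : ∀ j {k} → n ≤ k → entry j k ≡ D
    entry-at-end j {k} n≤k = cong (if_then (if j <ᵇ m then nth 0 (nth [] values j) k else 0) else D) (<ᵇ-false n≤k)

    entry-beyond : ∀ {j k} → m ≤ j → k < n → entry j k ≡ 0
    entry-beyond {j} {k} m≤j k<n rewrite <ᵇ-true k<n | <ᵇ-false {j} {m} m≤j = refl

    module _ (increasing : Increasing) (decreasing : Decreasing) where

      table : Table m n D
      table = record
        { a        = entry
        ; a-suc-≥  = suc-≥
        ; a-suc-≤  = suc-≤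
        ; a-at-y=1 = λ j → entry-at-end j ≤-refl
        ; a-at-x=1 = entry-beyond ≤-refl
        }
        where
        suc-≥ : ∀ j k → entry (suc j) k ≤ entry j k
        suc-≥ j k with k <? n | j <? m
        ... | no k≮n  | _       = ≤-reflexive (trans (entry-at-end (suc j) (≮⇒≥ k≮n)) (sym (entry-at-end j (≮⇒≥ k≮n))))
        ... | yes k<n | yes j<m = decreasing j<m k<n
        ... | yes k<n | no j≮m  = ≤-trans (≤-reflexive (entry-beyond (m≤n⇒m≤1+n (≮⇒≥ j≮m)) k<n)) z≤n
        suc-≤ : ∀ j k → entry j k ≤ entry j (suc k)
        suc-≤ j k with k <? n | j <? m
        ... | no k≮n  | _       = ≤-reflexive (trans (entry-at-end j (≮⇒≥ k≮n)) (sym (entry-at-end j (m≤n⇒m≤1+n (≮⇒≥ k≮n)))))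
        ... | yes k<n | yes j<m = increasing j<m k<n
        ... | yes k<n | no j≮m  = ≤-trans (≤-reflexive (entry-beyond (≮⇒≥ j≮m) k<n)) z≤n

      -- The first hypothesis is to be met by evaluation; this is where all tuples of thresholds are
      -- visited.
      guarantees : Scan.check m n B entry ≡ true → target + B ≡ m * (n * D) → Table.Guarantees table target
      guarantees ok target+B θ β θ-mono θ≤n β≤n =
        Scan.GainBound.total m n B entry D target θ β (Table.a-monotone table) θ-mono θ≤n β≤n ok target+B

open Certificate

-- Arrival orders

module _ {A : Set} where

  cat : (ℕ → List A) → ℕ → ℕ → List A
  cat B i zero    = []
  cat B i (suc t) = B i ++ cat B (suc i) t

  cat-cong : ∀ {B B′ : ℕ → List A} i t → (∀ {k} → i ℕ.≤ k → k ℕ.< i ℕ.+ t → B k ≡ B′ k) → cat B i t ≡ cat B′ i t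
  cat-cong i zero    B≡B′ = ≡.refl
  cat-cong i (suc t) B≡B′ = ≡.cong₂ _++_ (B≡B′ ℕ.≤-refl (ℕ.m<m+n i (s≤s z≤n)))
    (cat-cong (suc i) t λ {k} i<k k< → B≡B′ (ℕ.<⇒≤ i<k) (≡.subst (k ℕ.<_) (≡.sym (ℕ.+-suc i t)) k<))

  cat-+ : ∀ (B : ℕ → List A) i s t → cat B i (s ℕ.+ t) ≡ cat B i s ++ cat B (i ℕ.+ s) t
  cat-+ B i zero    t = ≡.cong (λ k → cat B k t) (≡.sym (ℕ.+-identityʳ i))
  cat-+ B i (suc s) t = ≡.trans (≡.cong (B i ++_) (≡.trans (cat-+ B (suc i) s t)
    (≡.cong (λ k → cat B (suc i) s ++ cat B k t) (≡.sym (ℕ.+-suc i s))))) (≡.sym (++-assoc (B i) _ _))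

  cat-All : ∀ {P : A → Set} {B : ℕ → List A} i t → (∀ {k} → k ℕ.< i ℕ.+ t → All P (B k)) → All P (cat B i t)
  cat-All i zero    all = []
  cat-All i (suc t) all = All.++⁺ (all (ℕ.m<m+n i (s≤s z≤n)))
    (cat-All (suc i) t λ {k} k< → all (≡.subst (k ℕ.<_) (≡.sym (ℕ.+-suc i t)) k<))

  concatMap-tabulate : ∀ {l m} (g : Fin l → List A) (h : Fin m → Fin l) (B : ℕ → List A) k →
    (∀ i → g (h i) ≡ B (k ℕ.+ toℕ i)) → concatMap g (tabulate h) ≡ cat B k m
  concatMap-tabulate {m = zero}  g h B k eq = ≡.refl
  concatMap-tabulate {m = suc m} g h B k eq = ≡.cong₂ _++_
    (≡.trans (eq zero) (≡.cong B (ℕ.+-identityʳ k)))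
    (concatMap-tabulate g (h ∘ suc) B (suc k) (λ i → ≡.trans (eq (suc i)) (≡.cong B (ℕ.+-suc k (toℕ i)))))

module Split {m r : ℕ} (π : Permutation′ r) (u : Fin r) (σ : Vec (Fin m) r) where

  online : List (Fin r)
  online = map (π ⟨$⟩ʳ_) (allFin r)

  order : Vec (Fin m) r → List (Fin r)
  order σ = concatMap (λ j → filter (λ x → lookup σ x Fin.≟ j) online) (allFin m)

  split : ∃₂ λ L R → online ≡ L ++ u ∷ R
  split = ∈-∃++ (≡.subst (_∈ online) (inverseʳ π) (∈-map⁺ (π ⟨$⟩ʳ_) (∈-allFin (π ⟨$⟩ˡ u))))

  L R : List (Fin r)
  L = proj₁ split
  R = proj₁ (proj₂ split)

  online≡ : online ≡ L ++ u ∷ R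
  online≡ = proj₂ (proj₂ split)

  online-unique : Unique online
  online-unique = Unique.map⁺ (λ eq → ≡.trans (≡.sym (inverseˡ π)) (≡.trans (≡.cong (π ⟨$⟩ˡ_) eq) (inverseˡ π))) (Unique.allFin⁺ r)

  around : ∀ L {R} → Unique (L ++ u ∷ R) → All (_≢ u) L × All (_≢ u) R
  around []      (u≢R ∷ _)  = [] , All.map (λ u≢x x≡u → u≢x (≡.sym x≡u)) u≢R
  around (x ∷ L) (x≢ ∷ rest) with L≢ , R≢ ← around L rest = All.head (All.++⁻ʳ L x≢) ∷ L≢ , R≢

  L≢u : All (_≢ u) L
  L≢u = proj₁ (around L (≡.subst Unique online≡ online-unique))

  R≢u : All (_≢ u) R
  R≢u = proj₂ (around L (≡.subst Unique online≡ online-unique))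

  stage : Fin r → ℕ
  stage x = toℕ (lookup σ x)

  block : (Fin r → ℕ) → ℕ → List (Fin r) → List (Fin r)
  block s i = filter (λ x → s x ℕ.≟ i)

  -- The arrivals of stage `i` other than `u`, in order of arrival. The entry of `σ` at `u` has no
  -- influence on them.
  B : ℕ → List (Fin r)
  B i = block stage i L ++ block stage i R

  -- pre j ++ post j are the arrivals without u, cut where u arrives if its stage is j.
  pre post : ℕ → List (Fin r)
  pre j  = cat B 0 j ++ block stage j L
  post j = block stage j R ++ cat B (suc j) (m ℕ.∸ suc j)

  pre-+ : ∀ i d → pre (i ℕ.+ suc d) ≡ pre i ++ (block stage i R ++ cat B (suc i) d) ++ block stage (i ℕ.+ suc d) L
  pre-+ i d = begin
    cat B 0 (i ℕ.+ suc d) ++ S                             ≡⟨ ≡.cong (_++ S) (cat-+ B 0 i (suc d)) ⟩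
    (cat B 0 i ++ (Li ++ Ri) ++ C) ++ S                    ≡⟨ ≡.cong (λ l → (cat B 0 i ++ l) ++ S) (++-assoc Li Ri C) ⟩
    (cat B 0 i ++ Li ++ Ri ++ C) ++ S                      ≡⟨ ≡.cong (_++ S) (++-assoc (cat B 0 i) Li (Ri ++ C)) ⟨
    (pre i ++ Ri ++ C) ++ S                                ≡⟨ ++-assoc (pre i) (Ri ++ C) S ⟩
    pre i ++ (Ri ++ C) ++ S                                ∎
    where
    open ≡.≡-Reasoning
    S Li Ri C : List (Fin r)
    S  = block stage (i ℕ.+ suc d) L
    Li = block stage i L
    Ri = block stage i R
    C  = cat B (suc i) d

  pre-extends : ∀ {i j} → i ℕ.≤ j → ∃[ X ] pre j ≡ pre i ++ X
  pre-extends {i} {j} i≤j with ℕ.m≤n⇒m<n∨m≡n i≤j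
  ... | inj₂ ≡.refl = [] , ≡.sym (++-identityʳ (pre i))
  ... | inj₁ i<j    = _ , ≡.trans (≡.cong pre (≡.sym (j≡ i<j))) (pre-+ i (j ℕ.∸ suc i))
    where
    j≡ : i ℕ.< j → i ℕ.+ suc (j ℕ.∸ suc i) ≡ j
    j≡ i<j = ≡.trans (ℕ.+-suc i (j ℕ.∸ suc i)) (ℕ.m+[n∸m]≡n i<j)

  -- `X` lists the arrivals between slots `j` and `i`. It ends the run without `u` up to slot `i`,
  -- and it also follows `u` when `u` arrives in stage `j`; this makes the two runs comparable.
  post-splits : ∀ {i j} → j ℕ.< i → i ℕ.< m → ∃₂ λ X Y → pre i ≡ pre j ++ X × post j ≡ X ++ Y
  post-splits {i} {j} j<i i<m = X , post i , ≡.trans (≡.cong pre i≡) (≡.trans (pre-+ j d) (≡.cong (λ k → pre j ++ (Rj ++ C) ++ block stage k L) (≡.sym i≡))) , (begin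
    Rj ++ cat B (suc j) (m ℕ.∸ suc j)                          ≡⟨ ≡.cong (λ t → Rj ++ cat B (suc j) t) t≡ ⟩
    Rj ++ cat B (suc j) (d ℕ.+ suc (m ℕ.∸ suc i))              ≡⟨ ≡.cong (Rj ++_) (cat-+ B (suc j) d _) ⟩
    Rj ++ C ++ cat B (suc j ℕ.+ d) (suc (m ℕ.∸ suc i))         ≡⟨ ≡.cong (λ k → Rj ++ C ++ cat B k (suc (m ℕ.∸ suc i))) (ℕ.m+[n∸m]≡n j<i) ⟩
    Rj ++ C ++ (Li ++ Ri) ++ E                                 ≡⟨ ≡.cong (λ l → Rj ++ C ++ l) (++-assoc Li Ri E) ⟩
    Rj ++ C ++ Li ++ post i                                    ≡⟨ ++-assoc Rj C (Li ++ post i) ⟨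
    (Rj ++ C) ++ Li ++ post i                                  ≡⟨ ++-assoc (Rj ++ C) Li (post i) ⟨
    X ++ post i                                                ∎)
    where
    open ≡.≡-Reasoning
    d : ℕ
    d = i ℕ.∸ suc j
    Rj Li Ri C E X : List (Fin r)
    Rj = block stage j R
    Li = block stage i L
    Ri = block stage i R
    C  = cat B (suc j) d
    E  = cat B (suc i) (m ℕ.∸ suc i)
    X  = (Rj ++ C) ++ Li
    i≡ : i ≡ j ℕ.+ suc d
    i≡ = ≡.sym (≡.trans (ℕ.+-suc j d) (ℕ.m+[n∸m]≡n j<i))
    t≡ : m ℕ.∸ suc j ≡ d ℕ.+ suc (m ℕ.∸ suc i)
    t≡ = ℕ.+-cancelˡ-≡ (suc j) _ _ (≡.trans (ℕ.m+[n∸m]≡n (ℕ.<-trans j<i i<m))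
      (≡.sym (≡.trans (≡.sym (ℕ.+-assoc (suc j) d _))
        (≡.trans (≡.cong (ℕ._+ suc (m ℕ.∸ suc i)) (ℕ.m+[n∸m]≡n j<i))
        (≡.trans (ℕ.+-suc i _) (ℕ.m+[n∸m]≡n i<m))))))

  block-All : ∀ i {M} → All (_≢ u) M → All (λ x → stage x ≡ i × x ≢ u) (block stage i M)
  block-All i {M} all = All.zip (All.all-filter (λ x → stage x ℕ.≟ i) M , All.filter⁺ (λ x → stage x ℕ.≟ i) all)

  pre-All : ∀ i → All (λ x → stage x ℕ.≤ i × x ≢ u) (pre i)
  pre-All i = All.++⁺
    (cat-All 0 i λ {k} k<i → All.map (λ (eq , x≢u) → ℕ.≤-trans (ℕ.≤-reflexive eq) (ℕ.<⇒≤ k<i) , x≢u)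
      (All.++⁺ (block-All k L≢u) (block-All k R≢u)))
    (All.map (λ (eq , x≢u) → ℕ.≤-reflexive eq , x≢u) (block-All i L≢u))

  module _ (j : Fin m) where

    σ′ : Vec (Fin m) r
    σ′ = σ [ u ]≔ j

    stage′ : Fin r → ℕ
    stage′ x = toℕ (lookup σ′ x)

    block-same : ∀ i {M} → All (_≢ u) M → block stage′ i M ≡ block stage i M
    block-same i []         = ≡.refl
    -- `filter` decides equality of stages through `≡ᵇ`, so splitting on this boolean reduces both
    -- sides.
    block-same i {x ∷ M} (x≢u ∷ all) rewrite lookup∘update′ x≢u σ j with stage x ℕ.≡ᵇ i
    ... | true  = ≡.cong (x ∷_) (block-same i all)
    ... | false = block-same i all

    B′ : ℕ → List (Fin r)
    B′ i = block stage′ i online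

    stage′-u : stage′ u ≡ toℕ j
    stage′-u = ≡.cong toℕ (lookup∘update u σ j)

    B′-split : ∀ i → B′ i ≡ block stage i L ++ block stage′ i (u ∷ R)
    B′-split i = ≡.trans (≡.cong (block stage′ i) online≡)
      (≡.trans (filter-++ (λ x → stage′ x ℕ.≟ i) L (u ∷ R)) (≡.cong (_++ block stage′ i (u ∷ R)) (block-same i L≢u)))

    B′-other : ∀ {i} → i ≢ toℕ j → B′ i ≡ B i
    B′-other {i} i≢j = ≡.trans (B′-split i) (≡.cong (block stage i L ++_)
      (≡.trans (filter-reject (λ x → stage′ x ℕ.≟ i) (λ eq → i≢j (≡.trans (≡.sym eq) stage′-u))) (block-same i R≢u)))

    B′-own : B′ (toℕ j) ≡ block stage (toℕ j) L ++ u ∷ block stage (toℕ j) R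
    B′-own = ≡.trans (B′-split (toℕ j)) (≡.cong (block stage (toℕ j) L ++_)
      (≡.trans (filter-accept (λ x → stage′ x ℕ.≟ toℕ j) stage′-u) (≡.cong (u ∷_) (block-same (toℕ j) R≢u))))

    -- Only block `j` changes when `u` is put into stage `j`, and `u` cuts it where it cuts the list
    -- of all online vertices.
    order-split : order σ′ ≡ pre (toℕ j) ++ u ∷ post (toℕ j)
    order-split = begin
      order σ′                                              ≡⟨ concatMap-tabulate _ id B′ 0 (λ i → filter-≐ _ _ (≡.cong toℕ , Fin.toℕ-injective) online) ⟩
      cat B′ 0 m                                            ≡⟨ ≡.cong (cat B′ 0) m≡ ⟨
      cat B′ 0 (k ℕ.+ suc t)                                ≡⟨ cat-+ B′ 0 k (suc t) ⟩
      cat B′ 0 k ++ B′ k ++ cat B′ (suc k) t                ≡⟨ ≡.cong₂ _++_ (cat-cong 0 k λ _ i<k → B′-other (ℕ.<⇒≢ i<k))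
                                                                 (≡.cong₂ _++_ B′-own (cat-cong (suc k) t λ k<i _ → B′-other (ℕ.>⇒≢ k<i))) ⟩
      cat B 0 k ++ (Lk ++ u ∷ Rk) ++ cat B (suc k) t        ≡⟨ ≡.cong (cat B 0 k ++_) (++-assoc Lk (u ∷ Rk) _) ⟩
      cat B 0 k ++ Lk ++ u ∷ post k                         ≡⟨ ++-assoc (cat B 0 k) Lk _ ⟨
      pre k ++ u ∷ post k                                   ∎
      where
      open ≡.≡-Reasoning
      k t : ℕ
      k = toℕ j
      t = m ℕ.∸ suc k
      Lk Rk : List (Fin r)
      Lk = block stage k L
      Rk = block stage k R
      m≡ : k ℕ.+ suc t ≡ m
      m≡ = ≡.trans (ℕ.+-suc k t) (ℕ.m+[n∸m]≡n (Fin.toℕ<n j))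

-- Ordered fields and averages

module OrderedField (reals : CompleteOrderedField) where
  open CompleteOrderedField reals public hiding (zero)
  open IsDecTotalOrder isDecTotalOrder public using (total; antisym; isPartialOrder; module Eq)
    renaming (refl to ≤-refl; trans to ≤-trans; reflexive to ≤-reflexive; _≟_ to _≈?_)
  open Eq public using () renaming (refl to ≈-refl; sym to ≈-sym; trans to ≈-trans; reflexive to ≈-reflexive)
  open RingProperties ring using (-‿distribˡ-*; -‿involutive)
  open SemiringSum semiring public
    using (sum-cong-≋; ∑-distrib-+; ∑-comm; *-distribˡ-sum; *-distribʳ-sum; sum-replicate-zero)
  import Algebra.Solver.Ring.NaturalCoefficients.Default as Solver
  module S = Solver commutativeSemiring

  ≤-poset : Poset 0ℓ 0ℓ 0ℓ
  ≤-poset = record { isPartialOrder = isPartialOrder }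
  module ≤-Reasoning = PosetReasoning ≤-poset
  module ≈-Reasoning = SetoidReasoning setoid

  ≰⇒≥ : ∀ {x y} → ¬ x ≤ y → y ≤ x
  ≰⇒≥ {x} {y} x≰y with total x y
  ... | inj₁ x≤y = contradiction x≤y x≰y
  ... | inj₂ y≤x = y≤x

  ≰⇒> : ∀ {x y} → ¬ x ≤ y → y < x
  ≰⇒> x≰y = ≰⇒≥ x≰y , λ y≈x → x≰y (≤-reflexive (≈-sym y≈x))

  <⇒≱ : ∀ {x y} → x < y → ¬ y ≤ x
  <⇒≱ (x≤y , x≉y) y≤x = x≉y (antisym x≤y y≤x)

  <-≤-trans : ∀ {x y z} → x < y → y ≤ z → x < z
  <-≤-trans x<y y≤z = ≤-trans (proj₁ x<y) y≤z , λ x≈z → <⇒≱ x<y (≤-trans y≤z (≤-reflexive (≈-sym x≈z)))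

  ≤-<-trans : ∀ {x y z} → x ≤ y → y < z → x < z
  ≤-<-trans x≤y y<z = ≤-trans x≤y (proj₁ y<z) , λ x≈z → <⇒≱ y<z (≤-trans (≤-reflexive (≈-sym x≈z)) x≤y)

  +-monoˡ-≤ : ∀ z {x y} → x ≤ y → x + z ≤ y + z
  +-monoˡ-≤ z {x} {y} x≤y = begin
    x + z ≈⟨ +-comm x z ⟩
    z + x ≤⟨ +-monoʳ-≤ z x≤y ⟩
    z + y ≈⟨ +-comm z y ⟩
    y + z ∎
    where open ≤-Reasoning

  +-mono-≤ : ∀ {w x y z} → w ≤ x → y ≤ z → w + y ≤ x + z
  +-mono-≤ {w} {x} {y} {z} w≤x y≤z = ≤-trans (+-monoʳ-≤ w y≤z) (+-monoˡ-≤ z w≤x)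

  x≤x+y : ∀ {x y} → 0# ≤ y → x ≤ x + y
  x≤x+y {x} 0≤y = ≤-trans (≤-reflexive (≈-sym (+-identityʳ x))) (+-monoʳ-≤ x 0≤y)

  x≤y+x : ∀ {x y} → 0# ≤ y → x ≤ y + x
  x≤y+x {x} {y} 0≤y = ≤-trans (x≤x+y 0≤y) (≤-reflexive (+-comm x y))

  +-nonNegative : ∀ {x y} → 0# ≤ x → 0# ≤ y → 0# ≤ x + y
  +-nonNegative 0≤x 0≤y = ≤-trans 0≤x (x≤x+y 0≤y)

  x-y+y : ∀ x y → (x - y) + y ≈ x
  x-y+y x y = ≈-trans (+-assoc x (- y) y) (≈-trans (+-congˡ (-‿inverseˡ y)) (+-identityʳ x))

  x+y-y : ∀ x y → (x + y) - y ≈ x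
  x+y-y x y = ≈-trans (+-assoc x y (- y)) (≈-trans (+-congˡ (-‿inverseʳ y)) (+-identityʳ x))

  ≤+⇒-≤ : ∀ {x y z} → x ≤ z + y → x - y ≤ z
  ≤+⇒-≤ {x} {y} {z} x≤z+y = ≤-trans (+-monoˡ-≤ (- y) x≤z+y) (≤-reflexive (x+y-y z y))

  +≤⇒≤- : ∀ {x y z} → x + y ≤ z → x ≤ z - y
  +≤⇒≤- {x} {y} {z} x+y≤z = ≤-trans (≤-reflexive (≈-sym (x+y-y x y))) (+-monoˡ-≤ (- y) x+y≤z)

  0≤y-x : ∀ {x y} → x ≤ y → 0# ≤ y - x
  0≤y-x {x} x≤y = +≤⇒≤- (≤-trans (≤-reflexive (+-identityˡ x)) x≤y)

  *-monoˡ-≤ : ∀ {z x y} → 0# ≤ z → x ≤ y → x * z ≤ y * z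
  *-monoˡ-≤ {z} {x} {y} 0≤z x≤y = begin
    x * z                   ≈⟨ +-identityˡ (x * z) ⟨
    0# + x * z              ≤⟨ +-monoˡ-≤ (x * z) (*-nonNegative (0≤y-x x≤y) 0≤z) ⟩
    (y - x) * z + x * z     ≈⟨ distribʳ z (y - x) x ⟨
    ((y - x) + x) * z       ≈⟨ *-congʳ (x-y+y y x) ⟩
    y * z                   ∎
    where open ≤-Reasoning

  *-monoʳ-≤ : ∀ {z x y} → 0# ≤ z → x ≤ y → z * x ≤ z * y
  *-monoʳ-≤ {z} {x} {y} 0≤z x≤y = begin
    z * x ≈⟨ *-comm z x ⟩
    x * z ≤⟨ *-monoˡ-≤ 0≤z x≤y ⟩
    y * z ≈⟨ *-comm y z ⟩
    z * y ∎
    where open ≤-Reasoning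

  0≤1 : 0# ≤ 1#
  0≤1 with total 0# 1#
  ... | inj₁ 0≤1 = 0≤1
  ... | inj₂ 1≤0 = begin
    0#                ≤⟨ *-nonNegative 0≤-1 0≤-1 ⟩
    (- 1#) * (- 1#)   ≈⟨ -‿distribˡ-* 1# (- 1#) ⟨
    - (1# * (- 1#))   ≈⟨ -‿cong (*-identityˡ (- 1#)) ⟩
    - (- 1#)          ≈⟨ -‿involutive 1# ⟩
    1#                ∎
    where
    open ≤-Reasoning
    0≤-1 : 0# ≤ - 1#
    0≤-1 = ≤-trans (0≤y-x 1≤0) (≤-reflexive (+-identityˡ (- 1#)))

  open SemiringMult semiring using (×1-homo-*; ×-homo-+)

  fromℕ-+ : ∀ x y → fromℕ (x ℕ.+ y) ≈ fromℕ x + fromℕ y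
  fromℕ-+ x y = ×-homo-+ 1# x y

  fromℕ-* : ∀ x y → fromℕ (x ℕ.* y) ≈ fromℕ x * fromℕ y
  fromℕ-* = ×1-homo-*

  0≤fromℕ : ∀ n → 0# ≤ fromℕ n
  0≤fromℕ zero    = ≤-refl
  0≤fromℕ (suc n) = +-nonNegative 0≤1 (0≤fromℕ n)

  fromℕ-mono-≤ : ∀ {x y} → x ℕ.≤ y → fromℕ x ≤ fromℕ y
  fromℕ-mono-≤ {y = y} z≤n       = 0≤fromℕ y
  fromℕ-mono-≤         (s≤s x≤y) = +-monoʳ-≤ 1# (fromℕ-mono-≤ x≤y)

  fromℕ-mono-< : ∀ {x y} → x ℕ.< y → fromℕ x < fromℕ y
  fromℕ-mono-< {x} {y} x<y = fromℕ-mono-≤ (ℕ.<⇒≤ x<y) , λ x≈y → <⇒≱ {fromℕ x} {fromℕ (suc x)}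
    (x≤y+x 0≤1 , λ eq → 0≉1 (+-cancelʳ-≈ (≈-trans (+-identityˡ _) eq)))
    (≤-trans (fromℕ-mono-≤ x<y) (≤-reflexive (≈-sym x≈y)))
    where
    +-cancelʳ-≈ : ∀ {a b c} → a + c ≈ b + c → a ≈ b
    +-cancelʳ-≈ {a} {b} {c} eq = ≈-trans (≈-sym (x+y-y a c)) (≈-trans (+-congʳ eq) (x+y-y b c))

  fromℕ≉0 : ∀ n → .{{NonZero n}} → ¬ fromℕ n ≈ 0#
  fromℕ≉0 (suc n) eq = proj₂ (fromℕ-mono-< {0} {suc n} (s≤s z≤n)) (≈-sym eq)

  ⁻¹-inverseˡ : ∀ {x} → ¬ x ≈ 0# → x ⁻¹ * x ≈ 1#
  ⁻¹-inverseˡ {x} x≉0 = ≈-trans (*-comm (x ⁻¹) x) (⁻¹-inverseʳ x≉0)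

  0≤x⁻¹ : ∀ {x} → 0# ≤ x → ¬ x ≈ 0# → 0# ≤ x ⁻¹
  0≤x⁻¹ {x} 0≤x x≉0 with total 0# (x ⁻¹)
  ... | inj₁ 0≤x⁻¹ = 0≤x⁻¹
  ... | inj₂ x⁻¹≤0 = contradiction (antisym 0≤1 (begin
    1#         ≈⟨ ⁻¹-inverseʳ x≉0 ⟨
    x * x ⁻¹   ≤⟨ *-monoʳ-≤ 0≤x x⁻¹≤0 ⟩
    x * 0#     ≈⟨ zeroʳ x ⟩
    0#         ∎)) 0≉1
    where open ≤-Reasoning

  infixl 7 _/ℕ_
  _/ℕ_ : ℝ → ℕ → ℝ
  x /ℕ n = x * fromℕ n ⁻¹

  0≤/ℕ : ∀ n → .{{NonZero n}} → 0# ≤ fromℕ n ⁻¹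
  0≤/ℕ n = 0≤x⁻¹ (0≤fromℕ n) (fromℕ≉0 n)

  /ℕ-mono : ∀ n → .{{_ : NonZero n}} → ∀ {x y} → x ≤ y → x /ℕ n ≤ y /ℕ n
  /ℕ-mono n = *-monoˡ-≤ (0≤/ℕ n)

  /ℕ-cancel : ∀ n → .{{_ : NonZero n}} → ∀ x → x /ℕ n * fromℕ n ≈ x
  /ℕ-cancel n x = ≈-trans (*-assoc x _ _) (≈-trans (*-congˡ (⁻¹-inverseˡ (fromℕ≉0 n))) (*-identityʳ x))

  */ℕ-cancel : ∀ n → .{{_ : NonZero n}} → ∀ x → x * fromℕ n /ℕ n ≈ x
  */ℕ-cancel n x = ≈-trans (*-assoc x _ _) (≈-trans (*-congˡ (⁻¹-inverseʳ (fromℕ≉0 n))) (*-identityʳ x))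

  *-cancelʳ-≤ : ∀ n → .{{_ : NonZero n}} → ∀ {x y} → x * fromℕ n ≤ y * fromℕ n → x ≤ y
  *-cancelʳ-≤ n {x} {y} le = begin
    x                  ≈⟨ */ℕ-cancel n x ⟨
    x * fromℕ n /ℕ n   ≤⟨ /ℕ-mono n le ⟩
    y * fromℕ n /ℕ n   ≈⟨ */ℕ-cancel n y ⟩
    y                  ∎
    where open ≤-Reasoning

  *-cancelʳ-≈ : ∀ n → .{{_ : NonZero n}} → ∀ {x y} → x * fromℕ n ≈ y * fromℕ n → x ≈ y
  *-cancelʳ-≈ n eq = antisym (*-cancelʳ-≤ n (≤-reflexive eq)) (*-cancelʳ-≤ n (≤-reflexive (≈-sym eq)))

  ÷-cross : ∀ p q s → .{{_ : NonZero q}} → .{{_ : NonZero s}} →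
            p ÷ q * fromℕ (q ℕ.* s) ≈ fromℕ (p ℕ.* s)
  ÷-cross p q s = begin
    p ÷ q * fromℕ (q ℕ.* s)                  ≈⟨ *-congˡ (fromℕ-* q s) ⟩
    p ÷ q * (fromℕ q * fromℕ s)              ≈⟨ *-assoc _ _ _ ⟨
    p ÷ q * fromℕ q * fromℕ s                ≈⟨ *-congʳ (/ℕ-cancel q (fromℕ p)) ⟩
    fromℕ p * fromℕ s                        ≈⟨ fromℕ-* p s ⟨
    fromℕ (p ℕ.* s)                          ∎
    where open ≈-Reasoning

  module _ (p q r s : ℕ) .{{_ : NonZero q}} .{{_ : NonZero s}} where
    private
      instance
        q*s≢0 : NonZero (q ℕ.* s)
        q*s≢0 = ℕ.m*n≢0 q s

      right : r ÷ s * fromℕ (q ℕ.* s) ≈ fromℕ (r ℕ.* q)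
      right = ≈-trans (*-congˡ (≈-reflexive (≡.cong fromℕ (ℕ.*-comm q s)))) (÷-cross r s q)

    ÷-mono-≤ : p ℕ.* s ℕ.≤ r ℕ.* q → p ÷ q ≤ r ÷ s
    ÷-mono-≤ le = *-cancelʳ-≤ (q ℕ.* s) (begin
      p ÷ q * fromℕ (q ℕ.* s)   ≈⟨ ÷-cross p q s ⟩
      fromℕ (p ℕ.* s)           ≤⟨ fromℕ-mono-≤ le ⟩
      fromℕ (r ℕ.* q)           ≈⟨ right ⟨
      r ÷ s * fromℕ (q ℕ.* s)   ∎)
      where open ≤-Reasoning

    ÷-mono-< : p ℕ.* s ℕ.< r ℕ.* q → p ÷ q < r ÷ s
    ÷-mono-< lt = ÷-mono-≤ (ℕ.<⇒≤ lt) , λ eq → proj₂ (fromℕ-mono-< lt)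
      (≈-trans (≈-sym (÷-cross p q s)) (≈-trans (*-congʳ eq) right))

  -- Otherwise the naturals would have a supremum `s`, and `s - 1#` would also bound them, as they
  -- are closed under successor.
  archimedean : ExcludedMiddle 0ℓ → ∀ x → ∃[ n ] x ≤ fromℕ n
  archimedean em x with em {∃[ n ] x ≤ fromℕ n}
  ... | yes ∃n = ∃n
  ... | no ∄n = contradiction (proj₂ (proj₂ sup) (s - 1#) below) (<⇒≱ s-1<s)
    where
    IsNat : ℝ → Set
    IsNat y = ∃[ n ] y ≡ fromℕ n
    sup : ∃[ s ] (UpperBound IsNat s × (∀ b → UpperBound IsNat b → s ≤ b))
    sup = complete IsNat (0# , 0 , ≡.refl) (x , λ { _ (n , ≡.refl) → ≰⇒≥ (λ x≤n → ∄n (n , x≤n)) })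
    s : ℝ
    s = proj₁ sup
    below : UpperBound IsNat (s - 1#)
    below _ (n , ≡.refl) = +≤⇒≤- (≤-trans (≤-reflexive (+-comm (fromℕ n) 1#))
      (proj₁ (proj₂ sup) _ (suc n , ≡.refl)))
    s-1<s : s - 1# < s
    s-1<s = ≤+⇒-≤ (x≤x+y 0≤1) , λ eq → 0≉1 (≈-trans (≈-sym (-‿inverseˡ s))
      (≈-trans (+-congˡ (≈-trans (≈-sym (x-y+y s 1#)) (+-congʳ eq)))
      (≈-trans (≈-sym (+-assoc (- s) s 1#)) (≈-trans (+-congʳ (-‿inverseˡ s)) (+-identityˡ 1#)))))

module Averages (reals : CompleteOrderedField) where
  open OrderedField reals public
  open Model reals public

  sum-mono : ∀ {n} {f g : Vector ℝ n} → (∀ i → f i ≤ g i) → sum f ≤ sum g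
  sum-mono {zero}  f≤g = ≤-refl
  sum-mono {suc n} f≤g = +-mono-≤ (f≤g zero) (sum-mono (f≤g ∘ suc))

  sum-const : ∀ n x → sum {n} (λ _ → x) ≈ x * fromℕ n
  sum-const zero    x = ≈-sym (zeroʳ x)
  sum-const (suc n) x = begin
    x + sum {n} (λ _ → x)     ≈⟨ +-cong (≈-sym (*-identityʳ x)) (sum-const n x) ⟩
    x * 1# + x * fromℕ n      ≈⟨ distribˡ x 1# (fromℕ n) ⟨
    x * (1# + fromℕ n)        ∎
    where open ≈-Reasoning

  sum-nonNegative : ∀ {n} {f : Vector ℝ n} → (∀ i → 0# ≤ f i) → 0# ≤ sum f
  sum-nonNegative {n} 0≤f = ≤-trans (≤-reflexive (≈-sym (sum-replicate-zero n))) (sum-mono 0≤f)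

  term≤sum : ∀ {n} {f : Vector ℝ n} → (∀ i → 0# ≤ f i) → ∀ i → f i ≤ sum f
  term≤sum 0≤f zero    = x≤x+y (sum-nonNegative (0≤f ∘ suc))
  term≤sum 0≤f (suc i) = ≤-trans (term≤sum (0≤f ∘ suc) i) (x≤y+x (0≤f zero))

  -- An indicator of the partner, which turns sums over a matching into double sums whose order can
  -- be exchanged.
  when : ∀ {l} → Maybe (Fin l) → Fin l → ℝ → ℝ
  when nothing  i g = 0#
  when (just j) i g = if does (j Fin.≟ i) then g else 0#

  when-≡ : ∀ {l} (j : Fin l) g → when (just j) j g ≡ g
  when-≡ j g with j Fin.≟ j
  ... | yes _  = ≡.refl
  ... | no j≢j = contradiction ≡.refl j≢j

  0≤when : ∀ {l} (x : Maybe (Fin l)) i {g} → 0# ≤ g → 0# ≤ when x i g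
  0≤when nothing  i 0≤g = ≤-refl
  0≤when (just j) i 0≤g with j Fin.≟ i
  ... | yes _ = 0≤g
  ... | no  _ = ≤-refl

  sum-zero : ∀ {n} {f : Vector ℝ n} → (∀ i → f i ≈ 0#) → sum f ≈ 0#
  sum-zero {n} f≈0 = ≈-trans (sum-cong-≋ f≈0) (sum-replicate-zero n)

  sum-when : ∀ {l} j (g : Vector ℝ l) → sum (λ i → when (just j) i (g i)) ≈ g j
  sum-when {suc l} zero g = ≈-trans (+-congˡ (sum-zero {l} λ _ → ≈-refl)) (+-identityʳ (g zero))
  sum-when {suc l} (suc j) g = ≈-trans (+-identityˡ _)
    (≈-trans (sum-cong-≋ shift) (sum-when j (g ∘ suc)))
    where
    shift : ∀ i → when (just (suc j)) (suc i) (g (suc i)) ≈ when (just j) i (g (suc i))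
    shift i with j Fin.≟ i
    ... | yes _ = ≈-refl
    ... | no  _ = ≈-refl

  avg : ∀ n → Vector ℝ n → ℝ
  avg n f = sum f /ℕ n

  avg-cong : ∀ n {f g : Vector ℝ n} → (∀ i → f i ≈ g i) → avg n f ≈ avg n g
  avg-cong n f≈g = *-congʳ (sum-cong-≋ f≈g)

  sumVec-mono : ∀ d n {f g} → (∀ k → f k ≤ g k) → sumVec d n f ≤ sumVec d n g
  sumVec-mono zero    n f≤g = f≤g []
  sumVec-mono (suc d) n f≤g = sum-mono λ k → sumVec-mono d n λ ks → f≤g (k ∷ ks)

  module _ (n : ℕ) .{{_ : NonZero n}} where

    avg-mono : {f g : Vector ℝ n} → (∀ i → f i ≤ g i) → avg n f ≤ avg n g
    avg-mono f≤g = /ℕ-mono n (sum-mono f≤g)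

    avg-const : ∀ x → avg n (λ _ → x) ≈ x
    avg-const x = ≈-trans (*-congʳ (sum-const n x)) (*/ℕ-cancel n x)

    private instance
      n^d≢0 : ∀ {d} → NonZero (n ℕ.^ d)
      n^d≢0 {d} = ℕ.m^n≢0 n d

    mean-mono : ∀ d {f g} → (∀ k → f k ≤ g k) → mean d n f ≤ mean d n g
    mean-mono d f≤g = /ℕ-mono (n ℕ.^ d) {{n^d≢0 {d}}} (sumVec-mono d n f≤g)

    mean-cong : ∀ d {f g} → (∀ k → f k ≈ g k) → mean d n f ≈ mean d n g
    mean-cong d f≈g = antisym (mean-mono d (≤-reflexive ∘ f≈g)) (mean-mono d (≤-reflexive ∘ ≈-sym ∘ f≈g))

    mean-zero : ∀ f → mean 0 n f ≈ f []
    mean-zero f = *-cancelʳ-≈ 1 (≈-trans (/ℕ-cancel 1 (f []))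
      (≈-sym (≈-trans (*-congˡ (+-identityʳ 1#)) (*-identityʳ (f [])))))

    mean-suc : ∀ d f → mean (suc d) n f ≈ avg n (λ k → mean d n (λ ks → f (k ∷ ks)))
    mean-suc d f = *-cancelʳ-≈ (n ℕ.^ suc d) {{n^d≢0 {suc d}}} (begin
      mean (suc d) n f * fromℕ (n ℕ.^ suc d)              ≈⟨ /ℕ-cancel (n ℕ.^ suc d) {{n^d≢0 {suc d}}} _ ⟩
      sum (λ k → sumVec d n (f ∘ (k ∷_)))                 ≈⟨ sum-cong-≋ {n} (λ k → ≈-sym (/ℕ-cancel (n ℕ.^ d) {{n^d≢0 {d}}} (sumVec d n (f ∘ (k ∷_))))) ⟩
      sum (λ k → mean d n (f ∘ (k ∷_)) * fromℕ (n ℕ.^ d)) ≈⟨ *-distribʳ-sum (fromℕ (n ℕ.^ d)) M ⟨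
      sum M * fromℕ (n ℕ.^ d)                             ≈⟨ *-congʳ (/ℕ-cancel n (sum M)) ⟨
      avg n M * fromℕ n * fromℕ (n ℕ.^ d)                 ≈⟨ *-assoc _ _ _ ⟩
      avg n M * (fromℕ n * fromℕ (n ℕ.^ d))               ≈⟨ *-congˡ (fromℕ-* n (n ℕ.^ d)) ⟨
      avg n M * fromℕ (n ℕ.^ suc d)                       ∎)
      where
      open ≈-Reasoning
      M : Vector ℝ n
      M k = mean d n (f ∘ (k ∷_))

    avg-+ : ∀ (f g : Vector ℝ n) → avg n (λ k → f k + g k) ≈ avg n f + avg n g
    avg-+ f g = ≈-trans (*-congʳ (∑-distrib-+ f g)) (distribʳ _ _ _)

    mean-const : ∀ d x → mean d n (λ _ → x) ≈ x
    mean-const zero    x = mean-zero (λ _ → x)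
    mean-const (suc d) x = ≈-trans (mean-suc d (λ _ → x)) (≈-trans (avg-cong n (λ _ → mean-const d x)) (avg-const x))

    mean-+ : ∀ d f g → mean d n (λ k → f k + g k) ≈ mean d n f + mean d n g
    mean-+ zero    f g = ≈-trans (mean-zero (λ k → f k + g k)) (≈-sym (+-cong (mean-zero f) (mean-zero g)))
    mean-+ (suc d) f g = begin
      mean (suc d) n (λ k → f k + g k)                       ≈⟨ mean-suc d (λ k → f k + g k) ⟩
      avg n (λ k → mean d n (λ ks → f (k ∷ ks) + g (k ∷ ks))) ≈⟨ avg-cong n (λ k → mean-+ d (f ∘ (k ∷_)) (g ∘ (k ∷_))) ⟩
      avg n (λ k → mean d n (f ∘ (k ∷_)) + mean d n (g ∘ (k ∷_))) ≈⟨ avg-+ _ _ ⟩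
      avg n (λ k → mean d n (f ∘ (k ∷_))) + avg n (λ k → mean d n (g ∘ (k ∷_))) ≈⟨ +-cong (mean-suc d f) (mean-suc d g) ⟨
      mean (suc d) n f + mean (suc d) n g                    ∎
      where open ≈-Reasoning

    mean-*ʳ : ∀ d f x → mean d n (λ k → f k * x) ≈ mean d n f * x
    mean-*ʳ zero    f x = ≈-trans (mean-zero (λ k → f k * x)) (≈-sym (*-congʳ (mean-zero f)))
    mean-*ʳ (suc d) f x = begin
      mean (suc d) n (λ k → f k * x)                       ≈⟨ mean-suc d (λ k → f k * x) ⟩
      avg n (λ k → mean d n (λ ks → f (k ∷ ks) * x))       ≈⟨ avg-cong n (λ k → mean-*ʳ d (f ∘ (k ∷_)) x) ⟩
      sum (λ k → M k * x) * fromℕ n ⁻¹                     ≈⟨ *-congʳ (*-distribʳ-sum x M) ⟨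
      sum M * x * fromℕ n ⁻¹                               ≈⟨ *-assoc _ _ _ ⟩
      sum M * (x * fromℕ n ⁻¹)                             ≈⟨ *-congˡ (*-comm _ _) ⟩
      sum M * (fromℕ n ⁻¹ * x)                             ≈⟨ *-assoc _ _ _ ⟨
      avg n M * x                                          ≈⟨ *-congʳ (mean-suc d f) ⟨
      mean (suc d) n f * x                                 ∎
      where
      open ≈-Reasoning
      M : Vector ℝ n
      M k = mean d n (f ∘ (k ∷_))

    mean-sum : ∀ d l (f : Fin l → Vec (Fin n) d → ℝ) →
               mean d n (λ k → sum (λ i → f i k)) ≈ sum (λ i → mean d n (f i))
    mean-sum d zero    f = mean-const d 0#
    mean-sum d (suc l) f = ≈-trans (mean-+ d _ _) (+-congˡ (mean-sum d l (f ∘ suc)))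

    mean-avg : ∀ d l (f : Fin l → Vec (Fin n) d → ℝ) →
               mean d n (λ k → avg l (λ i → f i k)) ≈ avg l (λ i → mean d n (f i))
    mean-avg d l f = ≈-trans (mean-*ʳ d _ _) (*-congʳ (mean-sum d l f))

    -- Allows all draws to be held fixed except the stage of `u` and the rank of `v`, which are
    -- drawn afresh without changing the expectation.
    mean-resample : ∀ d (i : Fin d) f →
                    mean d n f ≈ mean d n (λ ks → avg n (λ k → f (ks [ i ]≔ k)))
    mean-resample (suc d) zero f = begin
      mean (suc d) n f                                          ≈⟨ mean-suc d f ⟩
      avg n (λ k → mean d n (λ ks → f (k ∷ ks)))                ≈⟨ avg-const _ ⟨
      avg n (λ _ → avg n (λ k → mean d n (λ ks → f (k ∷ ks))))  ≈⟨ avg-cong n (λ _ → mean-avg d n (λ k ks → f (k ∷ ks))) ⟨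
      avg n (λ _ → mean d n (λ ks → avg n (λ k → f (k ∷ ks))))  ≈⟨ mean-suc d (λ ks → avg n (λ k → f (ks [ zero ]≔ k))) ⟨
      mean (suc d) n (λ ks → avg n (λ k → f (ks [ zero ]≔ k)))  ∎
      where open ≈-Reasoning
    mean-resample (suc d) (suc i) f = begin
      mean (suc d) n f                                                       ≈⟨ mean-suc d f ⟩
      avg n (λ k′ → mean d n (λ ks → f (k′ ∷ ks)))                           ≈⟨ avg-cong n (λ k′ → mean-resample d i (f ∘ (k′ ∷_))) ⟩
      avg n (λ k′ → mean d n (λ ks → avg n (λ k → f (k′ ∷ (ks [ i ]≔ k)))))  ≈⟨ mean-suc d (λ ks → avg n (λ k → f (ks [ suc i ]≔ k))) ⟨
      mean (suc d) n (λ ks → avg n (λ k → f (ks [ suc i ]≔ k)))              ∎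
      where open ≈-Reasoning

-- Riemann integrals of step functions

module Integrals (em : ExcludedMiddle 0ℓ) (reals : CompleteOrderedField) where
  open Averages reals public

  Near : ℝ → ℝ → ℝ → Set
  Near e x y = x ≤ y + e × y ≤ x + e

  near-trans : ∀ {e e′ x y z} → Near e x y → Near e′ y z → Near (e + e′) x z
  near-trans {e} {e′} {x} {y} {z} (x≤ , y≤x) (y≤z , z≤) = (begin
    x               ≤⟨ x≤ ⟩
    y + e           ≤⟨ +-monoˡ-≤ e y≤z ⟩
    z + e′ + e      ≈⟨ S.solve 3 (λ z e e′ → z S.:+ e′ S.:+ e S.:= z S.:+ (e S.:+ e′)) ≈-refl z e e′ ⟩
    z + (e + e′)    ∎) , (begin
    z               ≤⟨ z≤ ⟩
    y + e′          ≤⟨ +-monoˡ-≤ e′ y≤x ⟩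
    x + e + e′      ≈⟨ +-assoc x e e′ ⟩
    x + (e + e′)    ∎)
    where open ≤-Reasoning

  near-resp : ∀ {e e′ x x′ y y′} → e ≤ e′ → x ≈ x′ → y ≈ y′ → Near e x y → Near e′ x′ y′
  near-resp {e} {e′} e≤ x≈ y≈ (p , q) =
    ≤-trans (≤-reflexive (≈-sym x≈)) (≤-trans p (+-mono-≤ (≤-reflexive y≈) e≤)) ,
    ≤-trans (≤-reflexive (≈-sym y≈)) (≤-trans q (+-mono-≤ (≤-reflexive x≈) e≤))

  near-refl : ∀ {e x} → 0# ≤ e → Near e x x
  near-refl 0≤e = x≤x+y 0≤e , x≤x+y 0≤e

  near-between : ∀ {W x y} → 0# ≤ x → x ≤ W → 0# ≤ y → y ≤ W → Near W x y
  near-between 0≤x x≤W 0≤y y≤W = ≤-trans x≤W (x≤y+x 0≤y) , ≤-trans y≤W (x≤y+x 0≤x)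

  near-mean : ∀ n → .{{_ : NonZero n}} → ∀ d {e f g} → (∀ k → Near (e k) (f k) (g k)) →
              Near (mean d n e) (mean d n f) (mean d n g)
  near-mean n d {e} {f} {g} near =
    ≤-trans (mean-mono n d (proj₁ ∘ near)) (≤-reflexive (mean-+ n d g e)) ,
    ≤-trans (mean-mono n d (proj₂ ∘ near)) (≤-reflexive (mean-+ n d f e))

  near-avg : ∀ n → .{{_ : NonZero n}} → ∀ {e f g : Vector ℝ n} → (∀ k → Near (e k) (f k) (g k)) →
             Near (avg n e) (avg n f) (avg n g)
  near-avg n {e} {f} {g} near =
    ≤-trans (avg-mono n (proj₁ ∘ near)) (≤-reflexive (avg-+ n g e)) ,
    ≤-trans (avg-mono n (proj₂ ∘ near)) (≤-reflexive (avg-+ n f e))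

  sum-++ : ∀ a b (g : ℕ → ℝ) → sum {a ℕ.+ b} (g ∘ toℕ) ≈ sum {a} (g ∘ toℕ) + sum {b} (λ j → g (a ℕ.+ toℕ j))
  sum-++ zero    b g = ≈-sym (+-identityˡ _)
  sum-++ (suc a) b g = ≈-trans (+-congˡ (sum-++ a b (g ∘ suc))) (≈-sym (+-assoc _ _ _))

  sum-* : ∀ a b (g : ℕ → ℝ) →
          sum {a} (λ i → sum {b} (λ j → g (toℕ i ℕ.* b ℕ.+ toℕ j))) ≈ sum {a ℕ.* b} (g ∘ toℕ)
  sum-* zero    b g = ≈-refl
  sum-* (suc a) b g = ≈-trans (+-congˡ (≈-trans
    (sum-cong-≋ {a} λ i → sum-cong-≋ {b} λ j → ≈-reflexive (≡.cong g (ℕ.+-assoc b (toℕ i ℕ.* b) (toℕ j))))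
    (sum-* a b (g ∘ (b ℕ.+_))))) (≈-sym (sum-++ b (a ℕ.* b) g))

  -- Both sides average `g` over the numbers below `a * b`, cut into blocks of `b` or of `a`. This
  -- compares two grids through their common refinement.
  avg-regroup : ∀ a b (g : ℕ → ℝ) →
    avg a (λ i → avg b (λ j → g (toℕ i ℕ.* b ℕ.+ toℕ j))) ≈
    avg b (λ j → avg a (λ i → g (toℕ j ℕ.* a ℕ.+ toℕ i)))
  avg-regroup a b g = begin
    avg a (λ i → avg b (λ j → g (toℕ i ℕ.* b ℕ.+ toℕ j)))   ≈⟨ flatten a b ⟩
    sum {a ℕ.* b} (g ∘ toℕ) /ℕ b /ℕ a                        ≈⟨ *-congʳ (*-congʳ (≈-reflexive (≡.cong (λ c → sum {c} (g ∘ toℕ)) (ℕ.*-comm a b)))) ⟩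
    sum {b ℕ.* a} (g ∘ toℕ) /ℕ b /ℕ a                        ≈⟨ S.solve 3 (λ x y z → x S.:* y S.:* z S.:= x S.:* z S.:* y) ≈-refl _ _ _ ⟩
    sum {b ℕ.* a} (g ∘ toℕ) /ℕ a /ℕ b                        ≈⟨ flatten b a ⟨
    avg b (λ j → avg a (λ i → g (toℕ j ℕ.* a ℕ.+ toℕ i)))   ∎
    where
    open ≈-Reasoning
    flatten : ∀ a b → avg a (λ i → avg b (λ j → g (toℕ i ℕ.* b ℕ.+ toℕ j))) ≈ sum {a ℕ.* b} (g ∘ toℕ) /ℕ b /ℕ a
    flatten a b = *-congʳ (≈-trans (≈-sym (*-distribʳ-sum {a} (fromℕ b ⁻¹) (λ i → sum {b} (λ j → g (toℕ i ℕ.* b ℕ.+ toℕ j))))) (*-congʳ (sum-* a b g)))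

  telescope : ∀ N (φ : ℕ → ℕ) → (∀ k → φ k ℕ.≤ φ (suc k)) →
              sum {N} (λ k → fromℕ (φ (suc (toℕ k)) ℕ.∸ φ (toℕ k))) + fromℕ (φ 0) ≈ fromℕ (φ N)
  telescope zero    φ φ-mono = +-identityˡ _
  telescope (suc N) φ φ-mono = begin
    fromℕ (φ 1 ℕ.∸ φ 0) + rest + fromℕ (φ 0)     ≈⟨ S.solve 3 (λ x y z → x S.:+ y S.:+ z S.:= y S.:+ (x S.:+ z)) ≈-refl _ _ _ ⟩
    rest + (fromℕ (φ 1 ℕ.∸ φ 0) + fromℕ (φ 0))   ≈⟨ +-congˡ (fromℕ-+ (φ 1 ℕ.∸ φ 0) (φ 0)) ⟨
    rest + fromℕ (φ 1 ℕ.∸ φ 0 ℕ.+ φ 0)           ≈⟨ +-congˡ (≈-reflexive (≡.cong fromℕ (ℕ.m∸n+n≡m (φ-mono 0)))) ⟩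
    rest + fromℕ (φ 1)                           ≈⟨ telescope N (φ ∘ suc) (φ-mono ∘ suc) ⟩
    fromℕ (φ (suc N))                            ∎
    where
    open ≈-Reasoning
    rest : ℝ
    rest = sum {N} (λ k → fromℕ (φ (suc (suc (toℕ k))) ℕ.∸ φ (suc (toℕ k))))

  toℕ-mod : ∀ n → .{{_ : NonZero n}} → ∀ {x} → x ℕ.< n → toℕ (x mod n) ≡ x
  toℕ-mod n x<n = ≡.trans (Fin.toℕ-fromℕ< _) (ℕ.m<n⇒m%n≡m x<n)

  -- φ k is the cell of size 1/n that contains k/N.  An interval [k/N,(k+1)/N] lies
  -- inside one cell unless φ jumps, and the jumps telescope to n, so all but a
  -- vanishing fraction of the sample points see the value of their cell.
  module Grid (n N : ℕ) .{{_ : NonZero n}} .{{_ : NonZero N}} where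

    φ : ℕ → ℕ
    φ k = k ℕ.* n ℕ./ N

    φ-mono : ∀ {k k′} → k ℕ.≤ k′ → φ k ℕ.≤ φ k′
    φ-mono k≤k′ = ℕ./-monoˡ-≤ N (ℕ.*-monoˡ-≤ n k≤k′)

    φ< : ∀ k → φ (toℕ {N} k) ℕ.< n
    φ< k = ℕ.m<n*o⇒m/o<n (≡.subst (toℕ k ℕ.* n ℕ.<_) (ℕ.*-comm N n) (ℕ.*-monoˡ-< n (Fin.toℕ<n k)))

    q : Fin N → Fin n
    q k = φ (toℕ k) mod n

    bad : Fin N → ℕ
    bad k = φ (suc (toℕ k)) ℕ.∸ φ (toℕ k)

    badness : ∀ {d} → Vec (Fin N) d → ℕ
    badness []       = 0
    badness (k ∷ ks) = bad k ℕ.+ badness ks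

    e : ℝ
    e = fromℕ n /ℕ N

    avg-bad : avg N (fromℕ ∘ bad) ≈ e
    avg-bad = *-congʳ (begin
      sum {N} (fromℕ ∘ bad)                    ≈⟨ +-identityʳ _ ⟨
      sum {N} (fromℕ ∘ bad) + 0#               ≈⟨ +-congˡ (≈-reflexive (≡.cong fromℕ (ℕ.0/n≡0 N))) ⟨
      sum {N} (fromℕ ∘ bad) + fromℕ (φ 0)      ≈⟨ telescope N φ (λ k → φ-mono (ℕ.n≤1+n k)) ⟩
      fromℕ (φ N)                              ≈⟨ ≈-reflexive (≡.cong fromℕ (≡.trans (≡.cong (λ x → x ℕ./ N) (ℕ.*-comm N n)) (ℕ.m*n/n≡m n N))) ⟩
      fromℕ n                                  ∎)
      where open ≈-Reasoning

    mean-badness : ∀ d → mean d N (fromℕ ∘ badness) ≈ fromℕ d * e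
    mean-badness zero    = ≈-trans (mean-zero N (fromℕ ∘ badness)) (≈-sym (zeroˡ e))
    mean-badness (suc d) = begin
      mean (suc d) N (fromℕ ∘ badness)                              ≈⟨ mean-suc N d (fromℕ ∘ badness) ⟩
      avg N (λ k → mean d N (λ ks → fromℕ (bad k ℕ.+ badness ks)))  ≈⟨ avg-cong N (λ k → ≈-trans
        (mean-cong N d (λ ks → fromℕ-+ (bad k) (badness ks)))
        (≈-trans (mean-+ N d (λ _ → fromℕ (bad k)) (fromℕ ∘ badness)) (+-cong (mean-const N d _) (mean-badness d)))) ⟩
      avg N (λ k → fromℕ (bad k) + fromℕ d * e)                     ≈⟨ avg-+ N _ _ ⟩
      avg N (fromℕ ∘ bad) + avg N (λ _ → fromℕ d * e)               ≈⟨ +-cong avg-bad (avg-const N _) ⟩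
      e + fromℕ d * e                                               ≈⟨ +-congʳ (*-identityˡ e) ⟨
      1# * e + fromℕ d * e                                          ≈⟨ distribʳ e 1# (fromℕ d) ⟨
      fromℕ (suc d) * e                                             ∎
      where open ≈-Reasoning

    module _ (W : ℝ) (0≤W : 0# ≤ W) where

      Bounded : ℝ → Set
      Bounded x = 0# ≤ x × x ≤ W

      near-bad : ∀ b {x y} → Bounded x → Bounded y → (b ≡ 0 → x ≈ y) → Near (W * fromℕ b) x y
      near-bad zero    bx by eq = near-resp ≤-refl ≈-refl (eq ≡.refl)
        (near-refl (*-nonNegative 0≤W (0≤fromℕ 0)))
      near-bad (suc b) (0≤x , x≤W) (0≤y , y≤W) eq = near-resp W≤ ≈-refl ≈-refl (near-between 0≤x x≤W 0≤y y≤W)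
        where
        W≤ : W ≤ W * fromℕ (suc b)
        W≤ = ≤-trans (≤-reflexive (≈-sym (*-identityʳ W))) (*-monoʳ-≤ 0≤W (x≤x+y (0≤fromℕ b)))

      -- Cutting each sample interval into `n` parts and each cell into `N` parts gives the same
      -- parts. All parts of a good interval lie in its cell, and a bad interval errs by at most
      -- `W`.
      near-line : (h : Fin n → ℝ) → (∀ c → Bounded (h c)) → Near (W * e) (avg N (h ∘ q)) (avg n h)
      near-line h bounded = near-resp (≤-reflexive error)
        (avg-cong N (λ k → avg-const n _)) regroup
        (near-avg N λ k → near-avg n λ r → near-bad (bad k) (bounded _) (bounded _)
          λ bad≡0 → ≈-reflexive (≡.cong (λ x → h (x mod n)) (ℕ.≤-antisym
            (ℕ./-monoˡ-≤ N (ℕ.m≤m+n (toℕ k ℕ.* n) (toℕ r)))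
            (ℕ.≤-trans (ℕ./-monoˡ-≤ N (ℕ.≤-trans (ℕ.+-monoʳ-≤ (toℕ k ℕ.* n) (ℕ.<⇒≤ (Fin.toℕ<n r)))
                                        (ℕ.≤-reflexive (ℕ.+-comm (toℕ k ℕ.* n) n))))
                       (ℕ.m∸n≡0⇒m≤n bad≡0)))))
        where
        error : avg N (λ k → avg n (λ _ → W * fromℕ (bad k))) ≈ W * e
        error = ≈-trans (avg-cong N (λ k → avg-const n _))
          (≈-trans (*-congʳ (≈-sym (*-distribˡ-sum W (fromℕ ∘ bad)))) (≈-trans (*-assoc _ _ _) (*-congˡ avg-bad)))
        cell : ∀ (c : Fin n) (r : Fin N) → ((toℕ c ℕ.* N ℕ.+ toℕ r) ℕ./ N) mod n ≡ c
        cell c r = ≡.trans (≡.cong (_mod n) quotient) (Fin.toℕ-injective (toℕ-mod n (Fin.toℕ<n c)))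
          where
          quotient : (toℕ c ℕ.* N ℕ.+ toℕ r) ℕ./ N ≡ toℕ c
          quotient = ≡.trans (ℕ.+-distrib-/-∣ˡ (toℕ r) (n∣m*n (toℕ c)))
            (≡.trans (≡.cong₂ ℕ._+_ (ℕ.m*n/n≡m (toℕ c) N) (ℕ.m<n⇒m/n≡0 (Fin.toℕ<n r))) (ℕ.+-identityʳ (toℕ c)))
        regroup : avg N (λ k → avg n (λ r → h ((toℕ k ℕ.* n ℕ.+ toℕ r) ℕ./ N mod n))) ≈ avg n h
        regroup = ≈-trans (avg-regroup N n (λ K → h (K ℕ./ N mod n)))
          (avg-cong n λ c → ≈-trans (avg-cong N λ r → ≈-reflexive (≡.cong h (cell c r))) (avg-const N (h c)))

      -- The coordinates pass from the sample grid to the cells one by one, each at a cost of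
      -- `W * e` by `near-line`.
      near-cells : ∀ d (Φ : Vec (Fin n) d → ℝ) → (∀ κ → Bounded (Φ κ)) →
                   Near (fromℕ d * (W * e)) (mean d N (Φ ∘ Vec.map q)) (mean d n Φ)
      near-cells zero    Φ bounded = near-resp (≤-reflexive (≈-sym (zeroˡ _))) (≈-sym (mean-zero N (Φ ∘ Vec.map q)))
        (≈-sym (mean-zero n Φ)) (near-refl ≤-refl)
      near-cells (suc d) Φ bounded = near-resp (≤-reflexive error)
        (≈-sym (mean-suc N d (Φ ∘ Vec.map q))) (≈-sym (mean-suc n d Φ))
        (near-trans (near-avg N λ k → near-cells d (Φ ∘ (q k ∷_)) (bounded ∘ (q k ∷_)))
                    (near-line (λ c → mean d n (Φ ∘ (c ∷_))) λ c →
                      ≤-trans (≤-reflexive (≈-sym (mean-const n d 0#))) (mean-mono n d (λ κ → proj₁ (bounded (c ∷ κ)))) ,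
                      ≤-trans (mean-mono n d (λ κ → proj₂ (bounded (c ∷ κ)))) (≤-reflexive (mean-const n d W))))
        where
        error : avg N (λ _ → fromℕ d * (W * e)) + W * e ≈ fromℕ (suc d) * (W * e)
        error = ≈-trans (+-congʳ (avg-const N _)) (≈-trans (+-comm _ _)
          (≈-trans (+-congʳ (≈-sym (*-identityˡ (W * e)))) (≈-sym (distribʳ (W * e) 1# (fromℕ d)))))

  module _ (n : ℕ) .{{_ : NonZero n}} where

    -- There are two errors: sample points outside the cell assigned to their cube, and cells that
    -- contain unequal numbers of cubes. Each is at most d n W / N.
    step-integral : ∀ d (F : Vector ℝ d → ℝ) (Φ : Vec (Fin n) d → ℝ) W → 0# ≤ W →
      (∀ y → 0# ≤ F y × F y ≤ W) → (∀ κ → 0# ≤ Φ κ × Φ κ ≤ W) →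
      (∀ y κ → (∀ i → toℕ (Vec.lookup κ i) ÷ n ≤ y i × y i < suc (toℕ (Vec.lookup κ i)) ÷ n) → F y ≈ Φ κ) →
      IsIntegral d F (mean d n Φ)
    step-integral d F Φ W 0≤W F-bounded Φ-bounded agree ε (0≤ε , 0≉ε) = N₀ , λ N N₀≤N t in-cube →
      let near = near-resp (error N N₀≤N) ≈-refl ≈-refl
                   (near-trans (near-mean N d λ k → near-sample N t in-cube k) (Grid.near-cells n N W 0≤W d Φ Φ-bounded))
      in ≤+⇒-≤ (proj₂ near) , proj₁ near
      where
      -- The two errors add up to C / N, so any N from C / ε on will do.
      C : ℝ
      C = fromℕ d * fromℕ n * W + fromℕ d * fromℕ n * W
      bound : ∃[ N₀ ] C * ε ⁻¹ ≤ fromℕ N₀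
      bound = archimedean em (C * ε ⁻¹)
      N₀ : ℕ
      N₀ = proj₁ bound
      C≤ : C ≤ fromℕ N₀ * ε
      C≤ = begin
        C                ≈⟨ *-identityʳ C ⟨
        C * 1#           ≈⟨ *-congˡ (⁻¹-inverseˡ (0≉ε ∘ ≈-sym)) ⟨
        C * (ε ⁻¹ * ε)   ≈⟨ *-assoc C (ε ⁻¹) ε ⟨
        C * ε ⁻¹ * ε     ≤⟨ *-monoˡ-≤ 0≤ε (proj₂ bound) ⟩
        fromℕ N₀ * ε     ∎
        where open ≤-Reasoning
      error : ∀ N → N₀ ℕ.≤ N → .{{_ : NonZero N}} →
              mean d N (λ k → W * fromℕ (Grid.badness n N k)) + fromℕ d * (W * Grid.e n N) ≤ ε
      error N N₀≤N = begin
        mean d N (λ k → W * fromℕ (badness k)) + fromℕ d * (W * e)   ≈⟨ +-congʳ (≈-trans (mean-cong N d λ k → *-comm W _)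
                                                                          (≈-trans (mean-*ʳ N d (fromℕ ∘ badness) W) (*-congʳ (mean-badness d)))) ⟩
        fromℕ d * e * W + fromℕ d * (W * e)                          ≈⟨ S.solve 4 (λ d n W i →
                                                                          d S.:* (n S.:* i) S.:* W S.:+ d S.:* (W S.:* (n S.:* i)) S.:=
                                                                          (d S.:* n S.:* W S.:+ d S.:* n S.:* W) S.:* i)
                                                                          ≈-refl (fromℕ d) (fromℕ n) W (fromℕ N ⁻¹) ⟩
        C /ℕ N                                                       ≤⟨ /ℕ-mono N (≤-trans C≤ (*-monoˡ-≤ 0≤ε (fromℕ-mono-≤ N₀≤N))) ⟩
        fromℕ N * ε /ℕ N                                             ≈⟨ *-congʳ (*-comm _ _) ⟩
        ε * fromℕ N /ℕ N                                             ≈⟨ */ℕ-cancel N ε ⟩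
        ε                                                            ∎
        where
        open ≤-Reasoning
        open Grid n N
      near-sample : ∀ N → .{{_ : NonZero N}} → (t : Vec (Fin N) d → Vector ℝ d) →
        (∀ k i → toℕ (Vec.lookup k i) ÷ N ≤ t k i × t k i ≤ suc (toℕ (Vec.lookup k i)) ÷ N) →
        ∀ k → Near (W * fromℕ (Grid.badness n N k)) (F (t k)) (Φ (Vec.map (Grid.q n N) k))
      near-sample N t in-cube k = near-bad W 0≤W (badness k) (F-bounded (t k)) (Φ-bounded _)
        λ good → agree (t k) (Vec.map q k) λ i →
          ≡.subst (λ c → toℕ c ÷ n ≤ t k i × t k i < suc (toℕ c) ÷ n) (≡.sym (Vec.lookup-map i q k))
            (cell i (bad≡0 k i good))
        where
        open Grid n N
        bad≡0 : ∀ {d} (k : Vec (Fin N) d) i → badness k ≡ 0 → bad (Vec.lookup k i) ≡ 0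
        bad≡0 (k ∷ ks) zero    eq = ℕ.m+n≡0⇒m≡0 (bad k) eq
        bad≡0 (k ∷ ks) (suc i) eq = bad≡0 ks i (ℕ.m+n≡0⇒n≡0 (bad k) eq)
        cell : ∀ i → bad (Vec.lookup k i) ≡ 0 →
               toℕ (q (Vec.lookup k i)) ÷ n ≤ t k i × t k i < suc (toℕ (q (Vec.lookup k i))) ÷ n
        cell i eq rewrite toℕ-mod n (φ< (Vec.lookup k i)) =
          ≤-trans (÷-mono-≤ (φ κ) n κ N (ℕ.m/n*n≤m (κ ℕ.* n) N)) (proj₁ (in-cube k i)) ,
          -- The function `φ` jumps already when the right end point of the interval meets a cell
          -- boundary. So a closed interval without jump lies in a half-open cell.
          ≤-<-trans (proj₂ (in-cube k i)) (÷-mono-< (suc κ) N (suc (φ κ)) n (begin-strict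
            suc κ ℕ.* n                                             ≡⟨ ℕ.m≡m%n+[m/n]*n (suc κ ℕ.* n) N ⟩
            suc κ ℕ.* n ℕ.% N ℕ.+ φ (suc κ) ℕ.* N                   <⟨ ℕ.+-monoˡ-< (φ (suc κ) ℕ.* N) (ℕ.m%n<n (suc κ ℕ.* n) N) ⟩
            N ℕ.+ φ (suc κ) ℕ.* N                                   ≤⟨ ℕ.+-monoʳ-≤ N (ℕ.*-monoˡ-≤ N (ℕ.m∸n≡0⇒m≤n {φ (suc κ)} {φ κ} eq)) ⟩
            suc (φ κ) ℕ.* N                                         ∎))
          where
          open ℕ.≤-Reasoning
          κ : ℕ
          κ = toℕ (Vec.lookup k i)

-- Ranking functions given by integer tables

module Steps (em : ExcludedMiddle 0ℓ) (reals : CompleteOrderedField) where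
  open Integrals em reals public

  below : ℕ → ℕ → ℝ → ℕ
  below q zero    x = 0
  below q (suc b) x = if does (suc b ÷ q ≤? x) then suc b else below q b x

  below-≤ : ∀ q b x → below q b x ℕ.≤ b
  below-≤ q zero    x = z≤n
  below-≤ q (suc b) x with suc b ÷ q ≤? x
  ... | yes _ = ℕ.≤-refl
  ... | no  _ = ℕ.m≤n⇒m≤1+n (below-≤ q b x)

  below-mono : ∀ q b {x x′} → x ≤ x′ → below q b x ℕ.≤ below q b x′
  below-mono q zero    x≤x′ = z≤n
  below-mono q (suc b) {x} {x′} x≤x′ with suc b ÷ q ≤? x | suc b ÷ q ≤? x′
  ... | yes _ | yes _   = ℕ.≤-refl
  ... | yes p | no ¬p   = contradiction (≤-trans p x≤x′) ¬p
  ... | no _  | yes _   = ℕ.m≤n⇒m≤1+n (below-≤ q b x)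
  ... | no _  | no _    = below-mono q b x≤x′

  module _ (q : ℕ) .{{q≢0 : NonZero q}} where

    p≤r⇒÷ : ∀ {p r} → p ℕ.≤ r → p ÷ q ≤ r ÷ q
    p≤r⇒÷ {p} {r} p≤r = /ℕ-mono q (fromℕ-mono-≤ p≤r)

    p<r⇒÷ : ∀ {p r} → p ℕ.< r → p ÷ q < r ÷ q
    p<r⇒÷ {p} {r} p<r = ÷-mono-< p q r q (ℕ.*-monoˡ-< q p<r)

    0÷q : 0 ÷ q ≈ 0#
    0÷q = zeroˡ _

    q÷q : q ÷ q ≈ 1#
    q÷q = ⁻¹-inverseʳ (fromℕ≉0 q)

    below-≡ : ∀ b c {x} → c ℕ.≤ b → c ÷ q ≤ x → x < suc c ÷ q ⊎ c ≡ b → below q b x ≡ c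
    below-≡ zero    zero z≤n c≤x x< = ≡.refl
    below-≡ (suc b) c {x} c≤b c≤x x< with suc b ÷ q ≤? x | ℕ.m≤n⇒m<n∨m≡n c≤b | x<
    ... | yes _ | inj₂ c≡b     | _      = ≡.sym c≡b
    ... | yes p | inj₁ c<b     | inj₁ lt = contradiction (≤-trans (p≤r⇒÷ c<b) p) (<⇒≱ lt)
    ... | yes p | inj₁ c<b     | inj₂ c≡b = ≡.sym c≡b
    ... | no ¬p | inj₂ ≡.refl  | _      = contradiction c≤x ¬p
    ... | no ¬p | inj₁ (s≤s c≤b′) | inj₁ lt = below-≡ b c c≤b′ c≤x (inj₁ lt)
    ... | no ¬p | inj₁ c<b     | inj₂ ≡.refl = contradiction ≡.refl (ℕ.<⇒≢ c<b)

    -- The floor of q x, cut off at 0 and q. The point 1 thus gets the index q for itself, which is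
    -- the additional row or column of a table.
    cell : ℝ → ℕ
    cell = below q q

    cell-1 : cell 1# ≡ q
    cell-1 = below-≡ q q ℕ.≤-refl (≤-reflexive q÷q) (inj₂ ≡.refl)

    cell-fin : ∀ (c : Fin q) {x} → toℕ c ÷ q ≤ x → x < suc (toℕ c) ÷ q → cell x ≡ toℕ c
    cell-fin c c≤x x< = below-≡ q (toℕ c) (ℕ.<⇒≤ (Fin.toℕ<n c)) c≤x (inj₁ x<)

    cell-÷ : ∀ (c : Fin q) → cell (toℕ c ÷ q) ≡ toℕ c
    cell-÷ c = cell-fin c ≤-refl (p<r⇒÷ (ℕ.n<1+n (toℕ c)))

    cell< : ∀ {x} → x < 1# → cell x ℕ.< q
    cell< {x} x<1 = ℕ.≤∧≢⇒< (below-≤ q q x) λ eq → <⇒≱ x<1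
      (≤-trans (≤-reflexive (≈-sym q÷q)) (reached eq (above q)))
      where
      reached : cell x ≡ q → cell x ÷ q ≤ x ⊎ cell x ≡ 0 → q ÷ q ≤ x
      reached eq (inj₁ le)  = ≡.subst (λ c → c ÷ q ≤ x) eq le
      reached eq (inj₂ eq′) = contradiction (≡.trans (≡.sym eq) eq′) (ℕ.≢-nonZero⁻¹ q)
      above : ∀ b → below q b x ÷ q ≤ x ⊎ below q b x ≡ 0
      above zero = inj₂ ≡.refl
      above (suc b) with suc b ÷ q ≤? x
      ... | yes p = inj₁ p
      ... | no  _ = above b

  module TableFunction {m n D : ℕ} .{{_ : NonZero m}} .{{_ : NonZero n}} .{{_ : NonZero D}} (table : Table m n D) where
    open Table table

    value : ℕ → ℕ → ℝ
    value j k = a j k ÷ D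

    0≤value : ∀ j k → 0# ≤ value j k
    0≤value j k = *-nonNegative (0≤fromℕ (a j k)) (0≤/ℕ D)

    value≤1 : ∀ j {k} → k ℕ.≤ n → value j k ≤ 1#
    value≤1 j k≤n = ≤-trans (p≤r⇒÷ D (a≤D j k≤n)) (≤-reflexive (q÷q D))

    value-n : ∀ j → value j n ≈ 1#
    value-n j = ≈-trans (≈-reflexive (≡.cong (_÷ D) (a-at-y=1 j))) (q÷q D)

    f : ℝ → ℝ → ℝ
    f x y = value (cell m x) (cell n y)

    isRankingFunction : IsRankingFunction m f
    isRankingFunction = record
      { range     = λ {x} {y} _ _ → 0≤value (cell m x) (cell n y) , value≤1 (cell m x) (below-≤ n n y)
      ; antitone₁ = λ {x} {x′} {y} _ _ _ x≤x′ → p≤r⇒÷ D (a-antitone (cell n y) (below-mono m m x≤x′))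
      ; monotone₂ = λ {x} _ _ _ y≤y′ → p≤r⇒÷ D (a-monotone (cell m x) (below-mono n n y≤y′))
      ; at-y=1    = λ {x} _ → ≈-trans (≈-reflexive (≡.cong (value (cell m x)) (cell-1 n))) (value-n (cell m x))
      ; at-x=1    = λ {y} _ y<1 → ≈-trans (≈-reflexive (≡.cong (λ j → value j (cell n y)) (cell-1 m)))
                      (≈-trans (≈-reflexive (≡.cong (_÷ D) (a-at-x=1 (cell< n y<1)))) (0÷q D))
      ; stepwise  = λ j {x} {x′} {y} _ j≤x x<j j≤x′ x′<j → ≈-reflexive (≡.cong (λ i → value i (cell n y))
                      (≡.trans (cell-fin m j j≤x x<j) (≡.sym (cell-fin m j j≤x′ x′<j))))
      }

-- Greedy runs

module Greedy (em : ExcludedMiddle 0ℓ) (reals : CompleteOrderedField) where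
  open Steps em reals public

  module Runs (G : BipartiteGraph) (w : Fin (BipartiteGraph.nL G) → ℝ)
    (m : ℕ) (f : ℝ → ℝ → ℝ)
    (π : Permutation′ (BipartiteGraph.nR G)) (τ : Permutation′ (BipartiteGraph.nL G)) where
    open BipartiteGraph G public
    open Weighted G w public
    open Ranking m f π τ public

    -- The first maximiser among the options, described without the accumulator of `best`. Earlier
    -- options are strictly worse and later ones no better, so it is unique even under ties.
    data Best (option : Fin nL → Bool) (score : Fin nL → ℝ) (r : Fin nL) : List (Fin nL) → Set where
      here  : ∀ {l} → option r ≡ true → All (λ p → option p ≡ true → score p ≤ score r) l →
              Best option score r (r ∷ l)
      there : ∀ {p l} → (option p ≡ true → ¬ score r ≤ score p) → Best option score r l →
              Best option score r (p ∷ l)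

    module _ {option : Fin nL → Bool} {score : Fin nL → ℝ} where

      -- The current candidate `h` precedes the list and wins ties, so whatever replaces it must
      -- beat it strictly.
      best-spec : ∀ h l {r} → best score h (filterᵇ option l) ≡ r →
        (r ≡ h × All (λ p → option p ≡ true → score p ≤ score h) l) ⊎
        (Best option score r l × ¬ score r ≤ score h)
      best-spec h []      ≡.refl = inj₁ (≡.refl , [])
      best-spec h (x ∷ l) eq with option x in opt
      ... | false with best-spec h l eq
      ...   | inj₁ (r≡h , all) = inj₁ (r≡h , (λ opt′ → contradiction (≡.trans (≡.sym opt) opt′) λ ()) ∷ all)
      ...   | inj₂ (b , r≰h)   = inj₂ (there (λ opt′ → contradiction (≡.trans (≡.sym opt) opt′) λ ()) b , r≰h)
      best-spec h (x ∷ l) eq | true with score x ≤? score h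
      ... | yes x≤h with best-spec h l eq
      ...   | inj₁ (r≡h , all) = inj₁ (r≡h , (λ _ → x≤h) ∷ all)
      ...   | inj₂ (b , r≰h)   = inj₂ (there (λ _ r≤x → r≰h (≤-trans r≤x x≤h)) b , r≰h)
      best-spec h (x ∷ l) eq | true | no x≰h with best-spec x l eq
      ...   | inj₁ (≡.refl , all) = inj₂ (here opt all , x≰h)
      ...   | inj₂ (b , r≰x)      = inj₂ (there (λ _ → r≰x) b , λ r≤h → r≰x (≤-trans r≤h (≰⇒≥ x≰h)))

      choose-best : ∀ l {r} → choose score (filterᵇ option l) ≡ just r → Best option score r l
      choose-best (x ∷ l) eq with option x in opt
      ... | false = there (λ opt′ → contradiction (≡.trans (≡.sym opt) opt′) λ ()) (choose-best l eq)
      choose-best (x ∷ l) ≡.refl | true with best-spec x l ≡.refl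
      ... | inj₁ (r≡x , all) rewrite r≡x = here opt all
      ... | inj₂ (b , r≰x)   = there (λ _ → r≰x) b

      choose-nothing : ∀ l → choose score (filterᵇ option l) ≡ nothing → All (λ p → option p ≡ false) l
      choose-nothing []      eq = []
      choose-nothing (x ∷ l) eq with option x in opt
      ... | false = opt ∷ choose-nothing l eq

      best-option : ∀ {l r} → Best option score r l → option r ≡ true
      best-option (here opt _) = opt
      best-option (there _ b)  = best-option b

      best-∈ : ∀ {l r} → Best option score r l → r ∈ l
      best-∈ (here _ _)  = here ≡.refl
      best-∈ (there _ b) = there (best-∈ b)

      best-unique : ∀ {l r r′} → Best option score r l → Best option score r′ l → r ≡ r′
      best-unique (here _ _)     (here _ _)     = ≡.refl
      best-unique (here opt all) (there ¬≤ b)  = contradiction (All.lookup all (best-∈ b) (best-option b)) (¬≤ opt)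
      best-unique (there ¬≤ b)   (here opt all) = contradiction (All.lookup all (best-∈ b) (best-option b)) (¬≤ opt)
      best-unique (there _ b)    (there _ b′)   = best-unique b b′

      best-max : ∀ {l r z} → Best option score r l → z ∈ l → option z ≡ true → score z ≤ score r
      best-max (here _ all) (here ≡.refl) opt = ≤-refl
      best-max (here _ all) (there z∈l)   opt = All.lookup all z∈l opt
      best-max (there ¬≤ b) (here ≡.refl) opt = ≰⇒≥ (¬≤ opt)
      best-max (there _ b)  (there z∈l)   opt = best-max b z∈l opt

      best-choose : ∀ l {r} → Best option score r l → choose score (filterᵇ option l) ≡ just r
      best-choose l b with choose score (filterᵇ option l) in eq
      ... | just r′ = ≡.cong just (best-unique (choose-best l eq) b)
      ... | nothing = contradiction (≡.trans (≡.sym (best-option b)) (All.lookup (choose-nothing l eq) (best-∈ b))) λ ()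

    -- The winner is not dethroned when rivals disappear or lose score while its own score stays.
    -- All comparisons of greedy runs rest on this.
    best-transfer : ∀ {option option′ score score′ r l} → Best option score r l →
      option′ r ≡ true → score′ r ≡ score r →
      (∀ z → option′ z ≡ true → option z ≡ true × score′ z ≤ score z) →
      Best option′ score′ r l
    best-transfer (here _ all) opt′ eq sub = here opt′ (All.map
      (λ h opt → ≤-trans (proj₂ (sub _ opt)) (≤-trans (h (proj₁ (sub _ opt))) (≤-reflexive (≈-reflexive (≡.sym eq))))) all)
    best-transfer {score′ = score′} (there ¬≤ b) opt′ eq sub = there
      (λ opt r≤p → ¬≤ (proj₁ (sub _ opt)) (≤-trans (≤-reflexive (≈-reflexive (≡.sym eq))) (≤-trans r≤p (proj₂ (sub _ opt)))))
      (best-transfer b opt′ eq sub)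

    Score : Set
    Score = Fin nR → Fin nL → ℝ

    order : List (Fin nL)
    order = map (τ ⟨$⟩ʳ_) (allFin nL)

    ∈-order : ∀ z → z ∈ order
    ∈-order z = ≡.subst (_∈ order) (inverseʳ τ) (∈-map⁺ (τ ⟨$⟩ʳ_) (∈-allFin (τ ⟨$⟩ˡ z)))

    isOption : Assignment → Fin nR → Fin nL → Bool
    isOption M u v = edge v u ∧ not (is-just (M v))

    pick : Score → Assignment → Fin nR → Maybe (Fin nL)
    pick sc M u = choose (sc u) (filterᵇ (isOption M u) order)

    _[_≔_] : Assignment → Fin nL → Fin nR → Assignment
    M [ v ≔ u ] = updateAt M v (const (just u))

    serve : Score → Assignment → Fin nR → Assignment
    serve sc M u = maybe′ (λ v → M [ v ≔ u ]) M (pick sc M u)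

    run : Score → Assignment → List (Fin nR) → Assignment
    run sc = foldl (serve sc)

    option⇒ : ∀ M {u z} → isOption M u z ≡ true → edge z u ≡ true × M z ≡ nothing
    option⇒ M {u} {z} opt with edge z u | M z
    ... | true | nothing = ≡.refl , ≡.refl

    option⇐ : ∀ M {u z} → edge z u ≡ true → M z ≡ nothing → isOption M u z ≡ true
    option⇐ M {u} {z} edge≡ free with edge z u | M z
    option⇐ M ≡.refl ≡.refl | true | nothing = ≡.refl

    module _ {sc : Score} {M : Assignment} {u : Fin nR} where

      pick-best : ∀ {r} → pick sc M u ≡ just r → Best (isOption M u) (sc u) r order
      pick-best = choose-best order

      pick-edge : ∀ {r} → pick sc M u ≡ just r → edge r u ≡ true
      pick-edge eq = proj₁ (option⇒ M (best-option (pick-best eq)))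

      pick-free : ∀ {r} → pick sc M u ≡ just r → M r ≡ nothing
      pick-free eq = proj₂ (option⇒ M (best-option (pick-best eq)))

      pick-max : ∀ {r} → pick sc M u ≡ just r → ∀ {z} → edge z u ≡ true → M z ≡ nothing → sc u z ≤ sc u r
      pick-max eq {z} edge≡ free = best-max (pick-best eq) (∈-order z) (option⇐ M edge≡ free)

      pick-nothing : pick sc M u ≡ nothing → ∀ {z} → edge z u ≡ true → ¬ M z ≡ nothing
      pick-nothing eq {z} edge≡ free = contradiction
        (≡.trans (≡.sym (option⇐ M edge≡ free)) (All.lookup (choose-nothing order eq) (∈-order z))) λ ()

      pick-transfer : ∀ {sc′ M′ r} → pick sc M u ≡ just r → M′ r ≡ nothing → sc′ u r ≡ sc u r →
        (∀ z → M′ z ≡ nothing → M z ≡ nothing × sc′ u z ≤ sc u z) → pick sc′ M′ u ≡ just r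
      pick-transfer {sc′} {M′} eq free eq′ sub = best-choose order (best-transfer (pick-best eq)
        (option⇐ M′ (pick-edge eq) free) eq′
        λ z opt → let edge≡ , free′ = option⇒ M′ opt ; free″ , le = sub z free′ in option⇐ M edge≡ free″ , le)

      pick-nothing-transfer : ∀ {sc′ M′} → pick sc M u ≡ nothing →
        (∀ z → M′ z ≡ nothing → M z ≡ nothing) → pick sc′ M′ u ≡ nothing
      pick-nothing-transfer {sc′} {M′} eq sub with pick sc′ M′ u in eq′
      ... | nothing = ≡.refl
      ... | just r with b ← choose-best order eq′ =
        let edge≡ , free = option⇒ M′ (best-option b) in contradiction (sub r free) (pick-nothing eq edge≡)

    serve-nothing : ∀ sc M u → pick sc M u ≡ nothing → serve sc M u ≡ M
    serve-nothing sc M u eq = ≡.cong (maybe′ (λ v → M [ v ≔ u ]) M) eq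

    serve-just : ∀ sc M u {r} → pick sc M u ≡ just r → serve sc M u ≡ M [ r ≔ u ]
    serve-just sc M u eq = ≡.cong (maybe′ (λ v → M [ v ≔ u ]) M) eq

    just≢nothing : ∀ {A : Set} {x : A} {y : Maybe A} → y ≡ just x → ¬ y ≡ nothing
    just≢nothing ≡.refl ()

    serve-keeps : ∀ sc M u {v x} → M v ≡ just x → serve sc M u v ≡ just x
    serve-keeps sc M u {v} eq with pick sc M u in pick≡
    ... | nothing = eq
    ... | just r with v Fin.≟ r
    ...   | yes ≡.refl = contradiction (pick-free {sc} pick≡) (just≢nothing eq)
    ...   | no v≢r     = ≡.trans (updateAt-minimal v r M v≢r) eq

    run-keeps : ∀ sc M L {v x} → M v ≡ just x → run sc M L v ≡ just x
    run-keeps sc M []      eq = eq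
    run-keeps sc M (u ∷ L) eq = run-keeps sc (serve sc M u) L (serve-keeps sc M u eq)

    run-free : ∀ sc M L {v} → run sc M L v ≡ nothing → M v ≡ nothing
    run-free sc M L {v} free with M v in eq
    ... | nothing = ≡.refl
    ... | just x  = contradiction free (just≢nothing (run-keeps sc M L eq))

    serve-free : ∀ sc M u {v} → serve sc M u v ≡ nothing → M v ≡ nothing
    serve-free sc M u = run-free sc M (u ∷ [])

    run-partner : ∀ {P : Fin nR → Set} sc M L → All P L → ∀ {v} → (∀ {x} → M v ≡ just x → P x) →
                  ∀ {x} → run sc M L v ≡ just x → P x
    run-partner sc M []      []       before eq = before eq
    run-partner {P} sc M (u ∷ L) (pu ∷ pL) {v} before eq = run-partner sc (serve sc M u) L pL after eq
      where
      after : ∀ {x} → serve sc M u v ≡ just x → P x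
      after eq with pick sc M u
      ... | nothing = before eq
      ... | just r with v Fin.≟ r
      ...   | yes ≡.refl with ≡.refl ← ≡.trans (≡.sym eq) (updateAt-updates v M) = pu
      ...   | no v≢r = before (≡.trans (≡.sym (updateAt-minimal v r M v≢r)) eq)

    -- Compares only which vertices are matched, since partners may differ between two runs.
    _⊒_ : Assignment → Assignment → Set
    M′ ⊒ M = ∀ z → M′ z ≡ nothing → M z ≡ nothing

    serve-⊒ : ∀ sc M u → serve sc M u ⊒ M
    serve-⊒ sc M u z = serve-free sc M u

    -- If the pick `r` in `M` is still free in `M′`, it meets fewer rivals there and is picked
    -- again. So it is matched afterwards on both sides.
    serve-mono : ∀ {sc sc′ M M′ u} → M′ ⊒ M → (∀ z → M′ z ≡ nothing → sc′ u z ≡ sc u z) →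
                 serve sc′ M′ u ⊒ serve sc M u
    serve-mono {sc} {sc′} {M} {M′} {u} sub agree z free with pick sc M u in eq
    ... | nothing = sub z (serve-free sc′ M′ u free)
    ... | just r with z Fin.≟ r
    ...   | no z≢r     = ≡.trans (updateAt-minimal z r M z≢r) (sub z (serve-free sc′ M′ u free))
    ...   | yes ≡.refl = contradiction free (just≢nothing taken)
      where
      free′ : M′ z ≡ nothing
      free′ = serve-free sc′ M′ u free
      taken : serve sc′ M′ u z ≡ just u
      taken = ≡.trans (≡.cong-app (serve-just sc′ M′ u (pick-transfer {sc} {M} {u} {sc′} {M′} eq free′ (agree z free′)
        λ z free → sub z free , ≤-reflexive (≈-reflexive (agree z free)))) z) (updateAt-updates z M′)

    -- Agreement of scores is asked only where `M′` is free, so that `v` may be matched in advance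
    -- in `M′` and scored differently.
    run-mono : ∀ {sc sc′ M M′} L → M′ ⊒ M → All (λ u → ∀ z → M′ z ≡ nothing → sc′ u z ≡ sc u z) L →
               run sc′ M′ L ⊒ run sc M L
    run-mono []      sub []        = sub
    run-mono {sc} {sc′} {M} {M′} (u ∷ L) sub (au ∷ aL) = run-mono {sc} {sc′} L (serve-mono {sc} {sc′} sub au)
      (All.map (λ a z free → a z (serve-free sc′ M′ u free)) aL)

    serve-transfer : ∀ {sc sc′ M M′ u} v →
      (∀ z → z ≢ v → sc′ u z ≡ sc u z) → (∀ z → z ≢ v → M′ z ≡ M z) →
      (M′ v ≡ nothing → sc′ u v ≤ sc u v) → serve sc M u v ≡ nothing →
      (∀ z → z ≢ v → serve sc′ M′ u z ≡ serve sc M u z) × serve sc′ M′ u v ≡ M′ v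
    serve-transfer {sc} {sc′} {M} {M′} {u} v agree same lower free with pick sc M u in eq
    ... | nothing = (λ z z≢v → ≡.trans (≡.cong-app serve≡ z) (same z z≢v)) , ≡.cong-app serve≡ v
      where
      still-free : M′ ⊒ M
      still-free z free′ with z Fin.≟ v
      ... | yes ≡.refl = free
      ... | no z≢v     = ≡.trans (≡.sym (same z z≢v)) free′
      serve≡ : serve sc′ M′ u ≡ M′
      serve≡ = serve-nothing sc′ M′ u (pick-nothing-transfer {sc} {M} {u} {sc′} {M′} eq still-free)
    ... | just r = (λ z z≢v → ≡.trans (≡.cong-app serve≡ z) (both z z≢v)) ,
                   ≡.trans (≡.cong-app serve≡ v) (updateAt-minimal v r M′ (r≢v ∘ ≡.sym))
      where
      r≢v : r ≢ v
      r≢v ≡.refl = contradiction free (just≢nothing (updateAt-updates r M))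
      still-free : ∀ z → M′ z ≡ nothing → M z ≡ nothing × sc′ u z ≤ sc u z
      still-free z free′ with z Fin.≟ v
      ... | yes ≡.refl = ≡.trans (≡.sym (updateAt-minimal v r M (r≢v ∘ ≡.sym))) free , lower free′
      ... | no z≢v     = ≡.trans (≡.sym (same z z≢v)) free′ , ≤-reflexive (≈-reflexive (agree z z≢v))
      serve≡ : serve sc′ M′ u ≡ M′ [ r ≔ u ]
      serve≡ = serve-just sc′ M′ u (pick-transfer {sc} {M} {u} {sc′} {M′} eq
        (≡.trans (same r r≢v) (pick-free {sc} eq)) (agree r r≢v) still-free)
      both : ∀ z → z ≢ v → (M′ [ r ≔ u ]) z ≡ (M [ r ≔ u ]) z
      both z z≢v with z Fin.≟ r
      ... | yes ≡.refl = ≡.trans (updateAt-updates z M′) (≡.sym (updateAt-updates z M))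
      ... | no z≢r     = ≡.trans (updateAt-minimal z r M′ z≢r) (≡.trans (same z z≢v) (≡.sym (updateAt-minimal z r M z≢r)))

    -- An offline vertex that is never matched influences nothing, also when its
    -- scores are lowered or when it is removed.
    run-transfer : ∀ {sc sc′ M M′} v L →
      All (λ u → ∀ z → z ≢ v → sc′ u z ≡ sc u z) L → (∀ z → z ≢ v → M′ z ≡ M z) →
      (M′ v ≡ nothing → All (λ u → sc′ u v ≤ sc u v) L) →
      run sc M L v ≡ nothing →
      (∀ z → z ≢ v → run sc′ M′ L z ≡ run sc M L z) × run sc′ M′ L v ≡ M′ v
    run-transfer v []      []        same lower free = same , ≡.refl
    run-transfer {sc} {sc′} {M} {M′} v (u ∷ L) (au ∷ aL) same lower free =
      let same′ , v≡  = serve-transfer {sc} {sc′} v au same (All.head ∘ lower) (run-free sc (serve sc M u) L free)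
          same″ , v≡′ = run-transfer {sc} {sc′} v L aL same′ (All.tail ∘ lower ∘ ≡.trans (≡.sym v≡)) free
      in same″ , ≡.trans v≡′ v≡

    -- Function extensionality is avoided, since `pick-transfer` reads scores pointwise.
    pick-cong : ∀ {sc sc′} M u → (∀ z → sc u z ≡ sc′ u z) → pick sc M u ≡ pick sc′ M u
    pick-cong {sc} {sc′} M u agree with pick sc M u in eq
    ... | nothing = ≡.sym (pick-nothing-transfer {sc} {M} {u} {sc′} {M} eq λ _ → id)
    ... | just r  = ≡.sym (pick-transfer {sc} {M} {u} {sc′} {M} eq (pick-free {sc} eq) (≡.sym (agree r))
      λ z free → free , ≤-reflexive (≈-reflexive (≡.sym (agree z))))

    run-cong : ∀ {sc sc′} M L → All (λ u → ∀ z → sc u z ≡ sc′ u z) L → run sc M L ≡ run sc′ M L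
    run-cong M []      []        = ≡.refl
    run-cong {sc} {sc′} M (u ∷ L) (au ∷ aL) rewrite pick-cong {sc} {sc′} M u au = run-cong {sc} {sc′} (serve sc′ M u) L aL

-- The shares of one edge

-- The length of the longest initial segment of 0, ..., n - 1 on which `p` holds. That `p` fails
-- everywhere above it has to come from monotonicity.
threshold : (ℕ → Bool) → ℕ → ℕ
threshold p zero    = 0
threshold p (suc n) = if p 0 then suc (threshold (p ∘ suc) n) else 0

threshold-≤ : ∀ p n → threshold p n ℕ.≤ n
threshold-≤ p zero    = z≤n
threshold-≤ p (suc n) with p 0
... | true  = s≤s (threshold-≤ (p ∘ suc) n)
... | false = z≤n

<threshold : ∀ p n {k} → k ℕ.< threshold p n → p k ≡ true
<threshold p (suc n) {k} k< with p 0 in eq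
<threshold p (suc n) {zero}  k<       | true = eq
<threshold p (suc n) {suc k} (s≤s k<) | true = <threshold (p ∘ suc) n k<

threshold-fails : ∀ p n → threshold p n ℕ.< n → p (threshold p n) ≡ false
threshold-fails p (suc n) t<n with p 0 in eq
threshold-fails p (suc n) (s≤s t<n) | true = threshold-fails (p ∘ suc) n t<n
threshold-fails p (suc n) t<n       | false = eq

module Edges (em : ExcludedMiddle 0ℓ) (reals : CompleteOrderedField) where
  open Greedy em reals public

  module Sharing (G : BipartiteGraph) (w : Fin (BipartiteGraph.nL G) → ℝ) (0≤w : ∀ v → 0# ≤ w v)
    {m n D : ℕ} {{_ : NonZero m}} {{_ : NonZero n}} {{_ : NonZero D}} (table : Table m n D)
    (π : Permutation′ (BipartiteGraph.nR G)) (τ : Permutation′ (BipartiteGraph.nL G)) where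
    open Table table public
    open TableFunction table public
    open Runs G w m f π τ public

    score : (Fin nR → ℕ) → (Fin nL → ℕ) → Score
    score s ρ x z = w z * (1# - value (s x) (ρ z))

    ∅ : Assignment
    ∅ = const nothing

    1-value : ∀ j k → k ℕ.≤ n → fromℕ (D ℕ.∸ a j k) /ℕ D ≤ 1# - value j k
    1-value j k k≤n = +≤⇒≤- (≤-reflexive (≈-trans (≈-sym (distribʳ _ _ _))
      (≈-trans (*-congʳ (≈-trans (≈-sym (fromℕ-+ (D ℕ.∸ a j k) (a j k))) (≈-reflexive (≡.cong fromℕ (ℕ.m∸n+n≡m (a≤D j k≤n))))))
      (q÷q D))))

    0≤1-value : ∀ j {k} → k ℕ.≤ n → 0# ≤ 1# - value j k
    0≤1-value j k≤n = 0≤y-x (value≤1 j k≤n)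

    value-antimono : ∀ {j k k′} → k ℕ.≤ k′ → 1# - value j k′ ≤ 1# - value j k
    value-antimono {j} {k} {k′} k≤k′ = ≤+⇒-≤ (begin
      1#                                   ≈⟨ x-y+y 1# (value j k) ⟨
      (1# - value j k) + value j k         ≤⟨ +-monoʳ-≤ _ (p≤r⇒÷ D (a-monotone j k≤k′)) ⟩
      (1# - value j k) + value j k′        ∎)
      where open ≤-Reasoning

    paidOffline : (Fin nR → ℕ) → (Fin nL → ℕ) → Assignment → Fin nL → ℕ
    paidOffline s ρ O v = maybe′ (λ x → a (s x) (ρ v)) 0 (O v)

    offlineShare : (Fin nR → ℕ) → (Fin nL → ℕ) → Assignment → Fin nL → ℝ
    offlineShare s ρ O v = w v * (fromℕ (paidOffline s ρ O v) /ℕ D)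

    -- Assignments are indexed by offline vertices, so the partner of `u` is reached by a sum over
    -- all of them.
    onlineShare : (Fin nR → ℕ) → (Fin nL → ℕ) → Assignment → Fin nR → ℝ
    onlineShare s ρ O u = sum (λ z → when (O z) u (score s ρ u z))

    module Resample (u : Fin nR) (v : Fin nL) (edge≡ : edge v u ≡ true)
      (σ : Vec (Fin m) nR) (ρ : Fin nL → ℕ) (ρ≤n : ∀ z → ρ z ℕ.≤ n) where
      open Split π u σ using (pre; post; pre-extends; post-splits; pre-All) renaming (stage to s)

      rank : ℕ → Fin nL → ℕ
      rank k z = if does (z Fin.≟ v) then k else ρ z

      rank-v : ∀ k → rank k v ≡ k
      rank-v k with v Fin.≟ v
      ... | yes _  = ≡.refl
      ... | no v≢v = contradiction ≡.refl v≢v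

      rank-other : ∀ k {z} → z ≢ v → rank k z ≡ ρ z
      rank-other k {z} z≢v with z Fin.≟ v
      ... | yes z≡v = contradiction z≡v z≢v
      ... | no _    = ≡.refl

      rank≤n : ∀ {k} → k ℕ.≤ n → ∀ z → rank k z ℕ.≤ n
      rank≤n {k} k≤n z with z Fin.≟ v
      ... | yes _ = k≤n
      ... | no _  = ρ≤n z

      stage : ℕ → Fin nR → ℕ
      stage j x = if does (x Fin.≟ u) then j else s x

      stage-u : ∀ j → stage j u ≡ j
      stage-u j with u Fin.≟ u
      ... | yes _  = ≡.refl
      ... | no u≢u = contradiction ≡.refl u≢u

      stage-other : ∀ j {x} → x ≢ u → stage j x ≡ s x
      stage-other j {x} x≢u with x Fin.≟ u
      ... | yes x≡u = contradiction x≡u x≢u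
      ... | no _    = ≡.refl

      score-u : ∀ j ρ z → score (stage j) ρ u z ≡ w z * (1# - value j (ρ z))
      score-u j ρ z = ≡.cong (λ i → w z * (1# - value i (ρ z))) (stage-u j)

      score-otherˡ : ∀ j ρ {x} → x ≢ u → ∀ z → score (stage j) ρ x z ≡ score s ρ x z
      score-otherˡ j ρ x≢u z = ≡.cong (λ i → w z * (1# - value i (ρ z))) (stage-other j x≢u)

      score-otherʳ : ∀ s k x {z} → z ≢ v → score s (rank k) x z ≡ score s ρ x z
      score-otherʳ s k x {z} z≢v = ≡.cong (λ i → w z * (1# - value (s x) i)) (rank-other k z≢v)

      pre≢u : ∀ i → All (_≢ u) (pre i)
      pre≢u i = All.map proj₂ (pre-All i)

      -- The outcome just before slot i, without u and with rank k for v.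
      solo : ℕ → ℕ → Assignment
      solo k i = run (score s (rank k)) ∅ (pre i)

      matched : ℕ → ℕ → Bool
      matched i k = is-just (solo k i v)

      θ : ℕ → ℕ
      θ i = threshold (matched i) n

      -- A larger rank never raises a score of `v`, and a vertex that stays unmatched influences
      -- nothing, so `run-transfer` applies.
      solo-mono : ∀ {k k′} i → k′ ℕ.≤ k → solo k′ i v ≡ nothing → solo k i v ≡ nothing
      solo-mono {k} {k′} i k′≤k free = proj₂ (run-transfer {score s (rank k′)} {score s (rank k)} {∅} {∅} v (pre i)
        (All.universal (λ x z z≢v → ≡.trans (score-otherʳ s k x z≢v) (≡.sym (score-otherʳ s k′ x z≢v))) (pre i))
        (λ _ _ → ≡.refl)
        (λ _ → All.universal lower (pre i)) free)
        where
        lower : ∀ x → score s (rank k) x v ≤ score s (rank k′) x v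
        lower x rewrite rank-v k | rank-v k′ = *-monoʳ-≤ (0≤w v) (value-antimono k′≤k)

      is-just-true : ∀ {A : Set} {x : Maybe A} → is-just x ≡ true → ¬ x ≡ nothing
      is-just-true {x = just _} _ ()

      is-just-false : ∀ {A : Set} {x : Maybe A} → is-just x ≡ false → x ≡ nothing
      is-just-false {x = nothing} _ = ≡.refl

      k<θ : ∀ {i k} → k ℕ.< n → ¬ solo k i v ≡ nothing → k ℕ.< θ i
      k<θ {i} {k} k<n taken = ℕ.≰⇒> λ θ≤k → taken (solo-mono i θ≤k
        (is-just-false (threshold-fails (matched i) n (ℕ.≤-<-trans θ≤k k<n))))

      k<θ⇒taken : ∀ {i k} → k ℕ.< θ i → ¬ solo k i v ≡ nothing
      k<θ⇒taken {i} k<θ = is-just-true (<threshold (matched i) n k<θ)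

      solo-extends : ∀ {i i′ k} → i ℕ.≤ i′ → solo k i′ v ≡ nothing → solo k i v ≡ nothing
      solo-extends {i} {i′} {k} i≤i′ free with X , eq ← pre-extends i≤i′ = run-free sc (solo k i) X
        (≡.trans (≡.sym (≡.cong-app (≡.trans (≡.cong (run sc ∅) eq) (foldl-++ (serve sc) ∅ (pre i) X)) v)) free)
        where
        sc : Score
        sc = score s (rank k)

      -- Otherwise, at rank `θ i′`, vertex `v` would be matched before slot `i` and yet free at the
      -- later slot `i′`.
      θ-mono : ∀ {i i′} → i ℕ.≤ i′ → θ i ℕ.≤ θ i′
      θ-mono {i} {i′} i≤i′ = ℕ.≮⇒≥ λ θ′<θ → k<θ⇒taken {i} θ′<θ (solo-extends i≤i′
        (is-just-false (threshold-fails (matched i′) n (ℕ.<-≤-trans θ′<θ (threshold-≤ (matched i) n)))))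

      N₀ : Assignment
      N₀ = ∅ [ v ≔ u ]

      N₀-free : ∀ {z} → N₀ z ≡ nothing → z ≢ v
      N₀-free free ≡.refl = contradiction free (just≢nothing (updateAt-updates v ∅))

      -- Likewise without v, which N₀ removes by declaring it matched in advance.
      rest : ℕ → Assignment
      rest j = run (score s ρ) N₀ (pre j)

      alternative : ℕ → Maybe (Fin nL)
      alternative j = pick (score (stage j) ρ) (rest j) u

      V : ℕ → ℝ
      V j = maybe′ (score (stage j) ρ u) 0# (alternative j)

      β : ℕ → ℕ
      β j = threshold (λ k → not (does (w v * (1# - value j k) ≤? V j))) n

      0≤V : ∀ j → 0# ≤ V j
      0≤V j with alternative j
      ... | nothing = ≤-refl
      ... | just r  = *-nonNegative (0≤w r) (0≤1-value (stage j u) (ρ≤n r))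

      k<β : ∀ {j k} → k ℕ.< β j → ¬ w v * (1# - value j k) ≤ V j
      k<β {j} {k} k<β le with w v * (1# - value j k) ≤? V j | <threshold (λ k → not (does (w v * (1# - value j k) ≤? V j))) n k<β
      ... | no ¬le | _ = ¬le le

      -- If the threshold is `n`, the column for y = 1 makes the left side 0; if not, the search
      -- stopped because this comparison holds.
      at-β : ∀ j → w v * (1# - value j (β j)) ≤ V j
      at-β j with ℕ.m≤n⇒m<n∨m≡n (threshold-≤ (λ k → not (does (w v * (1# - value j k) ≤? V j))) n)
      ... | inj₂ β≡n = ≤-trans (≤-reflexive (≈-trans (*-congˡ (≈-trans
        (+-congˡ (-‿cong (≈-trans (≈-reflexive (≡.cong (value j) β≡n)) (value-n j)))) (-‿inverseʳ 1#))) (zeroʳ (w v)))) (0≤V j)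
      ... | inj₁ β<n with w v * (1# - value j (β j)) ≤? V j | threshold-fails (λ k → not (does (w v * (1# - value j k) ≤? V j))) n β<n
      ...   | yes le | _ = le

      module Outcome (j k : ℕ) (j<m : j ℕ.< m) (k<n : k ℕ.< n) where

        sc : Score
        sc = score (stage j) (rank k)

        before : Assignment
        before = run sc ∅ (pre j)

        O : Assignment
        O = run sc ∅ (pre j ++ u ∷ post j)

        O≡ : O ≡ run sc (serve sc before u) (post j)
        O≡ = foldl-++ (serve sc) ∅ (pre j) (u ∷ post j)

        agree : ∀ {L} → All (_≢ u) L → All (λ x → ∀ z → sc x z ≡ score s (rank k) x z) L
        agree = All.map (score-otherˡ j (rank k))

        before≡ : before ≡ solo k j
        before≡ = run-cong ∅ (pre j) (agree (pre≢u j))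

        O-keeps : ∀ {z x} → serve sc before u z ≡ just x → O z ≡ just x
        O-keeps {z} eq = ≡.trans (≡.cong-app O≡ z) (run-keeps sc (serve sc before u) (post j) eq)

        α : ℕ
        α = paidOffline (stage j) (rank k) O v

        util : ℝ
        util = onlineShare (stage j) (rank k) O u

        α-≡ : ∀ {x} → O v ≡ just x → α ≡ a (stage j x) k
        α-≡ {x} eq = ≡.trans (≡.cong (maybe′ (λ x → a (stage j x) (rank k v)) 0) eq) (≡.cong (a (stage j x)) (rank-v k))

        α-≥ : ∀ {x i} → O v ≡ just x → stage j x ℕ.≤ i → a i k ℕ.≤ α
        α-≥ {x} {i} eq le = ℕ.≤-trans (a-antitone k le) (ℕ.≤-reflexive (≡.sym (α-≡ eq)))

        pre-stages : ∀ i → All (λ x → stage j x ℕ.≤ i) (pre i)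
        pre-stages i = All.map (λ (le , x≢u) → ℕ.≤-trans (ℕ.≤-reflexive (stage-other j x≢u)) le) (pre-All i)

        -- The partner that `v` has after a prefix is final and has stage at most `i`, and values do
        -- not grow with the stage.
        served : ∀ {i L R} → pre j ++ u ∷ post j ≡ L ++ R → All (λ x → stage j x ℕ.≤ i) L →
                 ¬ run sc ∅ L v ≡ nothing → a i k ℕ.≤ α
        served {i} {L} {R} eq all taken with run sc ∅ L v in eq′
        ... | nothing = contradiction ≡.refl taken
        ... | just x  = α-≥ O≡just (run-partner sc ∅ L all (λ ()) eq′)
          where
          O≡just : O v ≡ just x
          O≡just = ≡.trans (≡.cong-app (≡.trans (≡.cong (run sc ∅) eq) (foldl-++ (serve sc) ∅ L R)) v)
            (run-keeps sc (run sc ∅ L) R eq′)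

        -- Up to slot `i ≤ j` the presence of `u` is not felt. For a later slot, `u` is inserted
        -- before the arrivals `X`, and by `run-mono` this leaves no more vertices free.
        offline-share : ∀ {i} → i ℕ.< m → k ℕ.< θ i → a i k ℕ.≤ α
        offline-share {i} i<m k<θ with i ℕ.≤? j
        ... | yes i≤j with X , eq ← pre-extends i≤j =
          served {L = pre i} {R = X ++ u ∷ post j} (≡.trans (≡.cong (_++ u ∷ post j) eq) (++-assoc (pre i) X _)) (pre-stages i)
            λ free → k<θ⇒taken {i} k<θ (≡.trans (≡.sym (≡.cong-app (run-cong ∅ (pre i) (agree (pre≢u i))) v)) free)
        ... | no i≰j with X , Y , eq , eq′ ← post-splits (ℕ.≰⇒> i≰j) i<m =
          served {L = pre j ++ u ∷ X} {R = Y} (≡.trans (≡.cong (λ l → pre j ++ u ∷ l) eq′) (≡.sym (++-assoc (pre j) (u ∷ X) Y)))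
            (All.++⁺ (All.++⁻ˡ (pre j) stages) (ℕ.≤-trans (ℕ.≤-reflexive (stage-u j)) (ℕ.<⇒≤ (ℕ.≰⇒> i≰j)) ∷ All.++⁻ʳ (pre j) stages))
            λ free → k<θ⇒taken {i} k<θ (≡.trans (≡.sym (≡.cong-app (run-cong ∅ (pre i) (agree (pre≢u i))) v))
              (≡.trans (≡.cong-app (≡.trans (≡.cong (run sc ∅) eq) (foldl-++ (serve sc) ∅ (pre j) X)) v)
              (run-mono {sc} {sc} X (serve-⊒ sc before u) (All.universal (λ _ _ _ → ≡.refl) X) v
                (≡.trans (≡.sym (≡.cong-app (foldl-++ (serve sc) ∅ (pre j) (u ∷ X)) v)) free))))
          where
          stages : All (λ x → stage j x ℕ.≤ i) (pre j ++ X)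
          stages = ≡.subst (All _) eq (pre-stages i)

        0≤sc : ∀ x z → 0# ≤ sc x z
        0≤sc x z = *-nonNegative (0≤w z) (0≤1-value (stage j x) (rank≤n (ℕ.<⇒≤ k<n) z))

        0≤util : 0# ≤ util
        0≤util = sum-nonNegative λ z → 0≤when (O z) u (0≤sc u z)

        O-pick : ∀ {r} → pick sc before u ≡ just r → O r ≡ just u
        O-pick {r} eq = O-keeps (≡.trans (≡.cong-app (serve-just sc before u eq) r) (updateAt-updates r before))

        pick≤util : ∀ {r} → pick sc before u ≡ just r → sc u r ≤ util
        pick≤util {r} eq = ≤-trans (≤-reflexive (≈-reflexive (≡.sym (≡.trans (≡.cong (λ o → when o u (sc u r)) (O-pick eq)) (when-≡ u (sc u r))))))
          (term≤sum (λ z → 0≤when (O z) u (0≤sc u z)) r)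

        -- Scores are compared only at vertices free in `N₀`, hence other than `v`, where the rank
        -- `k` is invisible.
        rest⊒before : rest j ⊒ before
        rest⊒before = run-mono {sc} {score s ρ} (pre j) (λ _ _ → ≡.refl)
          (All.map (λ {x} x≢u z free → ≡.sym (≡.trans (score-otherˡ j (rank k) x≢u z) (score-otherʳ s k x (N₀-free free)))) (pre≢u j))

        rest-free : ∀ {z} → rest j z ≡ nothing → z ≢ v
        rest-free free = N₀-free (run-free (score s ρ) N₀ (pre j) free)

        -- The alternative is still free when `v` takes part, so `u` picks something at least as
        -- good.
        V≤util : V j ≤ util
        V≤util with alternative j in eq
        ... | nothing = 0≤util
        ... | just r with pick sc before u in eq′
        ...   | nothing = contradiction (rest⊒before r (pick-free {score (stage j) ρ} eq)) (pick-nothing {sc} eq′ (pick-edge {score (stage j) ρ} eq))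
        ...   | just r′ = begin
          score (stage j) ρ u r   ≈⟨ ≈-reflexive (≡.sym (score-otherʳ (stage j) k u (rest-free (pick-free {score (stage j) ρ} eq)))) ⟩
          sc u r                  ≤⟨ pick-max {sc} eq′ (pick-edge {score (stage j) ρ} eq) (rest⊒before r (pick-free {score (stage j) ρ} eq)) ⟩
          sc u r′                 ≤⟨ pick≤util eq′ ⟩
          util                    ∎
          where open ≤-Reasoning

        sc-uv : sc u v ≡ w v * (1# - value j k)
        sc-uv = ≡.trans (score-u j (rank k) v) (≡.cong (λ k → w v * (1# - value j k)) (rank-v k))

        -- As `θ j ≤ k`, vertex `v` is free when `u` arrives and has influenced nothing, so the
        -- others are as in `rest j`. As `k < β j`, it beats them strictly, and ties do not matter.
        pick-middle : θ j ℕ.≤ k → k ℕ.< β j → pick sc before u ≡ just v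
        pick-middle θ≤k k<β′ = unique (pick sc before u) ≡.refl
          where
          free-v : before v ≡ nothing
          free-v with before v in eq
          ... | nothing = ≡.refl
          ... | just x  = contradiction θ≤k (ℕ.<⇒≱ (k<θ {j} k<n λ free → just≢nothing eq (≡.trans (≡.cong-app before≡ v) free)))
          rest≡before : ∀ z → z ≢ v → rest j z ≡ before z
          rest≡before = proj₁ (run-transfer {sc} {score s ρ} {∅} {N₀} v (pre j)
            (All.map (λ {x} x≢u z z≢v → ≡.sym (≡.trans (score-otherˡ j (rank k) x≢u z) (score-otherʳ s k x z≢v))) (pre≢u j))
            (λ z z≢v → updateAt-minimal z v ∅ z≢v)
            (λ free → contradiction ≡.refl (N₀-free free)) free-v)
          V≥ : ∀ {r} → edge r u ≡ true → rest j r ≡ nothing → score (stage j) ρ u r ≤ V j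
          V≥ edge-r free with alternative j in eq
          ... | nothing = contradiction free (pick-nothing {score (stage j) ρ} eq edge-r)
          ... | just r′ = pick-max {score (stage j) ρ} eq edge-r free
          unique : ∀ p → pick sc before u ≡ p → p ≡ just v
          unique nothing  eq = contradiction free-v (pick-nothing {sc} eq edge≡)
          unique (just r) eq with r Fin.≟ v
          ... | yes r≡v = ≡.cong just r≡v
          ... | no r≢v  = contradiction (begin
            w v * (1# - value j k)     ≈⟨ ≈-reflexive (≡.sym sc-uv) ⟩
            sc u v                     ≤⟨ pick-max {sc} eq edge≡ free-v ⟩
            sc u r                     ≈⟨ ≈-reflexive (score-otherʳ (stage j) k u r≢v) ⟩
            score (stage j) ρ u r      ≤⟨ V≥ (pick-edge {sc} eq) (≡.trans (rest≡before r r≢v) (pick-free {sc} eq)) ⟩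
            V j                        ∎) (k<β k<β′)
            where open ≤-Reasoning

        share : ℝ
        share = offlineShare (stage j) (rank k) O v + util

        middle-share : θ j ℕ.≤ k → k ℕ.< β j → w v ≤ share
        middle-share θ≤k k<β = begin
          w v                                               ≈⟨ *-identityʳ (w v) ⟨
          w v * 1#                                          ≈⟨ *-congˡ (x-y+y 1# (value j k)) ⟨
          w v * ((1# - value j k) + value j k)              ≈⟨ *-congˡ (+-comm _ _) ⟩
          w v * (value j k + (1# - value j k))              ≈⟨ distribˡ (w v) _ _ ⟩
          w v * value j k + w v * (1# - value j k)          ≈⟨ +-cong (*-congˡ (≈-reflexive (≡.cong (_÷ D) (≡.sym α≡)))) (≈-reflexive (≡.sym sc-uv)) ⟩
          w v * (fromℕ α /ℕ D) + sc u v                     ≤⟨ +-monoʳ-≤ _ (pick≤util (pick-middle θ≤k k<β)) ⟩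
          share                                             ∎
          where
          open ≤-Reasoning
          α≡ : α ≡ a j k
          α≡ = ≡.trans (α-≡ (O-pick (pick-middle θ≤k k<β))) (≡.cong (λ i → a i k) (stage-u j))

        outer-share : w v * (fromℕ (offline θ k ℕ.+ (D ℕ.∸ a j (β j))) /ℕ D) ≤ share
        outer-share = begin
          w v * (fromℕ (offline θ k ℕ.+ x) /ℕ D)                 ≈⟨ *-congˡ (≈-trans (*-congʳ (fromℕ-+ (offline θ k) x)) (distribʳ _ _ _)) ⟩
          w v * (fromℕ (offline θ k) /ℕ D + fromℕ x /ℕ D)        ≈⟨ distribˡ _ _ _ ⟩
          w v * (fromℕ (offline θ k) /ℕ D) + w v * (fromℕ x /ℕ D) ≤⟨ +-mono-≤
            (*-monoʳ-≤ (0≤w v) (/ℕ-mono D (fromℕ-mono-≤ (offline≤ 0 m (λ i<m → i<m)))))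
            (≤-trans (*-monoʳ-≤ (0≤w v) (1-value j (β j) (threshold-≤ _ n))) (≤-trans (at-β j) V≤util)) ⟩
          share                                                  ∎
          where
          open ≤-Reasoning
          x : ℕ
          x = D ℕ.∸ a j (β j)
          offline≤ : ∀ i t → (∀ {i′} → i′ ℕ.< i ℕ.+ t → i′ ℕ.< m) → offlineFrom θ i t k ℕ.≤ α
          offline≤ i zero    <m = z≤n
          offline≤ i (suc t) <m with k ℕ.<ᵇ θ i in eq
          ... | true  = offline-share (<m (ℕ.m<m+n i (s≤s z≤n))) (ℕ.<ᵇ⇒< k (θ i) (Equivalence.from T-≡ eq))
          ... | false = offline≤ (suc i) t λ {i′} i′< → <m (≡.subst (i′ ℕ.<_) (≡.sym (ℕ.+-suc i t)) i′<)

        gain≤share : w v * (fromℕ (gain θ (β j) j k) /ℕ D) ≤ share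
        gain≤share with θ j ℕ.≤ᵇ k in eq | k ℕ.<ᵇ β j in eq′
        ... | true  | true  = ≤-trans (≤-reflexive (≈-trans (*-congˡ (q÷q D)) (*-identityʳ (w v))))
          (middle-share (ℕ.≤ᵇ⇒≤ (θ j) k (Equivalence.from T-≡ eq)) (ℕ.<ᵇ⇒< k (β j) (Equivalence.from T-≡ eq′)))
        ... | true  | false = outer-share
        ... | false | true  = outer-share
        ... | false | false = outer-share

-- Summation over the edges of a matching

module Competitive (em : ExcludedMiddle 0ℓ) (reals : CompleteOrderedField) where
  open Edges em reals public

  fromℕ-Σ< : ∀ n f → fromℕ (Σ< n f) ≈ sum {n} (λ i → fromℕ (f (toℕ i)))
  fromℕ-Σ< zero    f = ≈-refl
  fromℕ-Σ< (suc n) f = ≈-trans (fromℕ-+ (f 0) (Σ< n (f ∘ suc))) (+-congˡ (fromℕ-Σ< n (f ∘ suc)))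

  when-≢ : ∀ {l} {x : Maybe (Fin l)} {i} g → x ≢ just i → when x i g ≈ 0#
  when-≢ {x = nothing}     g x≢i = ≈-refl
  when-≢ {x = just j} {i} g x≢i with j Fin.≟ i
  ... | yes ≡.refl = contradiction ≡.refl x≢i
  ... | no _       = ≈-refl

  sum-when-injective : ∀ {l r} (M : Fin l → Maybe (Fin r)) i {g} → 0# ≤ g →
    (∀ v v′ → M v ≡ just i → M v′ ≡ just i → v ≡ v′) → sum (λ v → when (M v) i g) ≤ g
  sum-when-injective {zero}  M i 0≤g inj = 0≤g
  sum-when-injective {suc l} M i {g} 0≤g inj with Maybe-≡? (M zero)
    where
    Maybe-≡? : ∀ x → x ≡ just i ⊎ x ≢ just i
    Maybe-≡? nothing = inj₂ λ ()
    Maybe-≡? (just j) with j Fin.≟ i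
    ... | yes ≡.refl = inj₁ ≡.refl
    ... | no j≢i     = inj₂ λ { ≡.refl → j≢i ≡.refl }
  ... | inj₁ M0≡i = begin
    when (M zero) i g + sum (λ v → when (M (suc v)) i g)   ≈⟨ +-cong (≈-reflexive (≡.trans (≡.cong (λ x → when x i g) M0≡i) (when-≡ i g)))
                                                                (sum-zero λ v → when-≢ g λ eq → contradiction (inj zero (suc v) M0≡i eq) λ ()) ⟩
    g + 0#                                                 ≈⟨ +-identityʳ g ⟩
    g                                                      ∎
    where open ≤-Reasoning
  ... | inj₂ M0≢i = begin
    when (M zero) i g + sum (λ v → when (M (suc v)) i g)   ≈⟨ +-congʳ (when-≢ g M0≢i) ⟩
    0# + sum (λ v → when (M (suc v)) i g)                  ≈⟨ +-identityˡ _ ⟩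
    sum (λ v → when (M (suc v)) i g)                       ≤⟨ sum-when-injective (M ∘ suc) i 0≤g
                                                                (λ v v′ eq eq′ → Fin.suc-injective (inj (suc v) (suc v′) eq eq′)) ⟩
    g                                                      ∎
    where open ≤-Reasoning

  module Ratio {m n D : ℕ} {{m≢0 : NonZero m}} {{n≢0 : NonZero n}} {{D≢0 : NonZero D}} (table : Table m n D)
    {target p q : ℕ} {{q≢0 : NonZero q}} (guarantees : Table.Guarantees table target)
    (target≡ : target ℕ.* q ≡ p ℕ.* D ℕ.* (n ℕ.* m)) where

    module Graph (G : BipartiteGraph) (w : Fin (BipartiteGraph.nL G) → ℝ) (0≤w : ∀ v → 0# ≤ w v)
      (π : Permutation′ (BipartiteGraph.nR G)) (τ : Permutation′ (BipartiteGraph.nL G)) where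
      open Sharing G w 0≤w table π τ

      W : ℝ
      W = sum w

      totalWeight-bounded : ∀ M → 0# ≤ totalWeight M × totalWeight M ≤ W
      totalWeight-bounded M = sum-nonNegative (proj₁ ∘ bounds) , sum-mono (proj₂ ∘ bounds)
        where
        bounds : ∀ v → 0# ≤ (if is-just (M v) then w v else 0#) × (if is-just (M v) then w v else 0#) ≤ w v
        bounds v with is-just (M v)
        ... | true  = 0≤w v , ≤-refl
        ... | false = ≤-refl , 0≤w v

      -- Each matched weight `w z` is the sum of the share of `z` and what its partner receives for
      -- it. Shares are nonnegative, and the matching `M` collects each of them at most once.
      shares≤weight : ∀ s ρ (O M : Assignment) → (∀ z → ρ z ℕ.≤ n) → IsMatching M →
        sum (λ v → maybe′ (λ u → offlineShare s ρ O v + onlineShare s ρ O u) 0# (M v)) ≤ totalWeight O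
      shares≤weight s ρ O M ρ≤n matching = begin
        sum (λ v → maybe′ (λ u → off v + on u) 0# (M v))                ≤⟨ sum-mono split ⟩
        sum (λ v → off v + sum (λ u → when (M v) u (on u)))             ≈⟨ ∑-distrib-+ off _ ⟩
        sum off + sum (λ v → sum (λ u → when (M v) u (on u)))           ≈⟨ +-congˡ (∑-comm (λ v u → when (M v) u (on u))) ⟩
        sum off + sum (λ u → sum (λ v → when (M v) u (on u)))           ≤⟨ +-monoʳ-≤ _ (sum-mono λ u → sum-when-injective M u (0≤on u) λ v v′ → injective v v′ u) ⟩
        sum off + sum on                                                ≈⟨ +-congˡ (∑-comm (λ u z → when (O z) u (score s ρ u z))) ⟩
        sum off + sum (λ z → sum (λ u → when (O z) u (score s ρ u z)))  ≈⟨ ∑-distrib-+ off _ ⟨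
        sum (λ z → off z + sum (λ u → when (O z) u (score s ρ u z)))    ≈⟨ sum-cong-≋ both ⟩
        totalWeight O                                                   ∎
        where
        open ≤-Reasoning
        open IsMatching matching
        off : Fin nL → ℝ
        off = offlineShare s ρ O
        on : Fin nR → ℝ
        on = onlineShare s ρ O
        0≤on : ∀ u → 0# ≤ on u
        0≤on u = sum-nonNegative λ z → 0≤when (O z) u (*-nonNegative (0≤w z) (0≤1-value (s u) (ρ≤n z)))
        0≤off : ∀ v → 0# ≤ off v
        0≤off v = *-nonNegative (0≤w v) (*-nonNegative (0≤fromℕ (paidOffline s ρ O v)) (0≤/ℕ D))
        split : ∀ v → maybe′ (λ u → off v + on u) 0# (M v) ≤ off v + sum (λ u → when (M v) u (on u))
        split v with M v
        ... | nothing = +-nonNegative (0≤off v) (sum-nonNegative {nR} λ u → ≤-refl)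
        ... | just u  = +-monoʳ-≤ (off v) (≤-reflexive (≈-sym (sum-when u on)))
        both : ∀ z → off z + sum (λ u → when (O z) u (score s ρ u z)) ≈ (if is-just (O z) then w z else 0#)
        both z with O z
        ... | nothing = ≈-trans (+-cong (≈-trans (*-congˡ (zeroˡ _)) (zeroʳ (w z))) (sum-replicate-zero nR)) (+-identityˡ 0#)
        ... | just x  = ≈-trans (+-congˡ (sum-when x (λ u → score s ρ u z))) (≈-trans (≈-sym (distribˡ (w z) _ _))
          (≈-trans (*-congˡ (≈-trans (+-comm _ _) (x-y+y 1# (value (s x) (ρ z))))) (*-identityʳ (w z))))

      stages : Vec (Fin m) nR → Fin nR → ℕ
      stages σ x = toℕ (lookup σ x)

      ranks : Vec (Fin n) nL → Fin nL → ℕ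
      ranks κ z = toℕ (lookup κ z)

      ranks≤n : ∀ κ z → ranks κ z ℕ.≤ n
      ranks≤n κ z = ℕ.<⇒≤ (Fin.toℕ<n (lookup κ z))

      O : Vec (Fin m) nR → Vec (Fin n) nL → Assignment
      O σ κ = run (score (stages σ) (ranks κ)) ∅ (arrivals σ)

      Φ : Vec (Fin n) nL → ℝ
      Φ κ = mean nR m (λ σ → totalWeight (O σ κ))

      E : ℝ
      E = mean nL n Φ

      mean-bounded : ∀ (g : Vec (Fin m) nR → Assignment) → 0# ≤ mean nR m (totalWeight ∘ g) × mean nR m (totalWeight ∘ g) ≤ W
      mean-bounded g =
        ≤-trans (≤-reflexive (≈-sym (mean-const m nR 0#))) (mean-mono m nR (proj₁ ∘ totalWeight-bounded ∘ g)) ,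
        ≤-trans (mean-mono m nR (proj₂ ∘ totalWeight-bounded ∘ g)) (≤-reflexive (mean-const m nR W))

      -- Ranks from the same cells give identical scores and hence identical runs, so the integrand
      -- is a step function.
      isExpectedWeight : IsExpectedWeight E
      isExpectedWeight = step-integral n nL _ Φ W (sum-nonNegative 0≤w)
        (λ y → mean-bounded (λ σ → outcome σ y)) (λ κ → mean-bounded (λ σ → O σ κ))
        λ y κ in-cell → mean-cong m nR λ σ → ≈-reflexive (≡.cong totalWeight (run-cong ∅ (arrivals σ)
          (All.universal (λ x z → ≡.cong₂ (λ i k → w z * (1# - value i k)) (cell-÷ m (lookup σ x))
            (cell-fin n (lookup κ z) (proj₁ (in-cell z)) (proj₂ (in-cell z)))) (arrivals σ))))

      offlineShare-cong : ∀ {s s′ ρ ρ′} O v → (∀ x → s x ≡ s′ x) → (∀ z → ρ z ≡ ρ′ z) →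
                          offlineShare s ρ O v ≡ offlineShare s′ ρ′ O v
      offlineShare-cong O v s≗ ρ≗ with O v
      ... | nothing = ≡.refl
      ... | just x  = ≡.cong₂ (λ i k → w v * (fromℕ (a i k) /ℕ D)) (s≗ x) (ρ≗ v)

      onlineShare-cong : ∀ {s s′ ρ ρ′} O u → (∀ x → s x ≡ s′ x) → (∀ z → ρ z ≡ ρ′ z) →
                         onlineShare s ρ O u ≈ onlineShare s′ ρ′ O u
      onlineShare-cong O u s≗ ρ≗ = sum-cong-≋ λ z → ≈-reflexive
        (≡.cong₂ (λ i k → when (O z) u (w z * (1# - value i k))) (s≗ u) (ρ≗ z))

      X : Fin nR → Fin nL → Vec (Fin m) nR → Vec (Fin n) nL → ℝ
      X u v σ κ = offlineShare (stages σ) (ranks κ) (O σ κ) v + onlineShare (stages σ) (ranks κ) (O σ κ) u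

      c : ℝ
      c = p ÷ q

      module _ (u : Fin nR) (v : Fin nL) (edge≡ : edge v u ≡ true) where

        average : ∀ σ κ → c * w v ≤ avg m (λ j → avg n (λ k → X u v (σ [ u ]≔ j) (κ [ v ]≔ k)))
        average σ κ = begin
          c * w v                                              ≤⟨ ratio ⟩
          w v * (fromℕ target /ℕ D) /ℕ n /ℕ m                   ≤⟨ /ℕ-mono m (/ℕ-mono n (*-monoʳ-≤ (0≤w v) (/ℕ-mono D (fromℕ-mono-≤
                                                                    (guarantees θ β θ-mono (λ i → threshold-≤ (matched i) n) (λ j → threshold-≤ _ n)))))) ⟩
          w v * (fromℕ (Σ< m (λ j → Σ< n (g j))) /ℕ D) /ℕ n /ℕ m ≈⟨ expand ⟩
          avg m (λ j → avg n (λ k → w v * (fromℕ (g (toℕ j) (toℕ k)) /ℕ D)))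
                                                               ≤⟨ avg-mono m (λ j → avg-mono n (λ k → ≤-trans
                                                                    (Outcome.gain≤share (toℕ j) (toℕ k) (Fin.toℕ<n j) (Fin.toℕ<n k))
                                                                    (≤-reflexive (≈-sym (X≈share j k))))) ⟩
          avg m (λ j → avg n (λ k → X u v (σ [ u ]≔ j) (κ [ v ]≔ k))) ∎
          where
          open ≤-Reasoning
          open Resample u v edge≡ σ (ranks κ) (ranks≤n κ)
          g : ℕ → ℕ → ℕ
          g j k = gain θ (β j) j k
          ratio : c * w v ≤ w v * (fromℕ target /ℕ D) /ℕ n /ℕ m
          ratio = ≤-reflexive (≈-sym (begin-equality
            w v * (fromℕ target /ℕ D) /ℕ n /ℕ m           ≈⟨ *-congʳ (*-congʳ (*-congˡ (*-congʳ target≈))) ⟩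
            w v * (c * fromℕ D * (fromℕ n * fromℕ m) /ℕ D) /ℕ n /ℕ m
              ≈⟨ S.solve 8 (λ w c d n m d′ n′ m′ →
                   w S.:* (c S.:* d S.:* (n S.:* m) S.:* d′) S.:* n′ S.:* m′ S.:=
                   c S.:* w S.:* (d S.:* d′) S.:* (n S.:* n′) S.:* (m S.:* m′)) ≈-refl
                   (w v) c (fromℕ D) (fromℕ n) (fromℕ m) (fromℕ D ⁻¹) (fromℕ n ⁻¹) (fromℕ m ⁻¹) ⟩
            c * w v * (D ÷ D) * (n ÷ n) * (m ÷ m)          ≈⟨ *-cong (*-cong (*-congˡ (q÷q D)) (q÷q n)) (q÷q m) ⟩
            c * w v * 1# * 1# * 1#                        ≈⟨ ≈-trans (*-identityʳ _) (≈-trans (*-identityʳ _) (*-identityʳ _)) ⟩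
            c * w v                                       ∎))
            where
            target≈ : fromℕ target ≈ c * fromℕ D * (fromℕ n * fromℕ m)
            target≈ = *-cancelʳ-≈ q (begin-equality
              fromℕ target * fromℕ q                            ≈⟨ fromℕ-* target q ⟨
              fromℕ (target ℕ.* q)                              ≈⟨ ≈-reflexive (≡.cong fromℕ target≡) ⟩
              fromℕ (p ℕ.* D ℕ.* (n ℕ.* m))                     ≈⟨ ≈-trans (fromℕ-* (p ℕ.* D) (n ℕ.* m)) (*-cong (fromℕ-* p D) (fromℕ-* n m)) ⟩
              fromℕ p * fromℕ D * (fromℕ n * fromℕ m)           ≈⟨ *-congʳ (*-congʳ (/ℕ-cancel q (fromℕ p))) ⟨
              c * fromℕ q * fromℕ D * (fromℕ n * fromℕ m)       ≈⟨ S.solve 4 (λ c q d x → c S.:* q S.:* d S.:* x S.:= c S.:* d S.:* x S.:* q) ≈-refl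
                                                                     c (fromℕ q) (fromℕ D) (fromℕ n * fromℕ m) ⟩
              c * fromℕ D * (fromℕ n * fromℕ m) * fromℕ q       ∎)
          linear : ∀ l (x : Vector ℝ l) → sum (λ k → w v * (x k /ℕ D)) ≈ w v * (sum x /ℕ D)
          linear l x = ≈-trans (≈-sym (*-distribˡ-sum {l} (w v) (λ k → x k /ℕ D))) (*-congˡ (≈-sym (*-distribʳ-sum {l} (fromℕ D ⁻¹) x)))
          expand : w v * (fromℕ (Σ< m (λ j → Σ< n (g j))) /ℕ D) /ℕ n /ℕ m ≈
                   avg m (λ j → avg n (λ k → w v * (fromℕ (g (toℕ j) (toℕ k)) /ℕ D)))
          expand = *-congʳ (begin-equality
            w v * (fromℕ (Σ< m (λ j → Σ< n (g j))) /ℕ D) /ℕ n          ≈⟨ *-congʳ (*-congˡ (*-congʳ (fromℕ-Σ< m (λ j → Σ< n (g j))))) ⟩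
            w v * (sum {m} rows /ℕ D) /ℕ n                             ≈⟨ *-congʳ (linear m rows) ⟨
            sum {m} (λ j → w v * (rows j /ℕ D)) /ℕ n                   ≈⟨ *-distribʳ-sum {m} (fromℕ n ⁻¹) _ ⟩
            sum {m} (λ j → w v * (rows j /ℕ D) /ℕ n)                   ≈⟨ sum-cong-≋ {m} (λ j → *-congʳ (≈-trans
                                                                          (*-congˡ (*-congʳ (fromℕ-Σ< n (g (toℕ j)))))
                                                                          (≈-sym (linear n (λ k → fromℕ (g (toℕ j) (toℕ k))))))) ⟩
            sum {m} (λ j → avg n (λ k → w v * (fromℕ (g (toℕ j) (toℕ k)) /ℕ D))) ∎)
            where
            rows : Vector ℝ m
            rows j = fromℕ (Σ< n (g (toℕ j)))
          -- Replacing one entry of each vector gives the functions `stage` and `rank` of the edge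
          -- analysis, and `order-split` exposes the slot of `u`.
          X≈share : ∀ j k → X u v (σ [ u ]≔ j) (κ [ v ]≔ k) ≈ Outcome.share (toℕ j) (toℕ k) (Fin.toℕ<n j) (Fin.toℕ<n k)
          X≈share j k = ≈-trans (≈-reflexive (≡.cong (λ o → offlineShare (stages σ′) (ranks κ′) o v + onlineShare (stages σ′) (ranks κ′) o u) O≡))
            (+-cong (≈-reflexive (offlineShare-cong o v stages≗ ranks≗)) (onlineShare-cong o u stages≗ ranks≗))
            where
            σ′ : Vec (Fin m) nR
            σ′ = σ [ u ]≔ j
            κ′ : Vec (Fin n) nL
            κ′ = κ [ v ]≔ k
            o : Assignment
            o = Outcome.O (toℕ j) (toℕ k) (Fin.toℕ<n j) (Fin.toℕ<n k)
            arrivals′ : List (Fin nR)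
            arrivals′ = Split.pre π u σ (toℕ j) ++ u ∷ Split.post π u σ (toℕ j)
            stages≗ : ∀ x → stages σ′ x ≡ stage (toℕ j) x
            stages≗ x with x Fin.≟ u
            ... | yes ≡.refl = ≡.cong toℕ (lookup∘update x σ j)
            ... | no x≢u     = ≡.cong toℕ (lookup∘update′ x≢u σ j)
            ranks≗ : ∀ z → ranks κ′ z ≡ rank (toℕ k) z
            ranks≗ z with z Fin.≟ v
            ... | yes ≡.refl = ≡.cong toℕ (lookup∘update z κ k)
            ... | no z≢v     = ≡.cong toℕ (lookup∘update′ z≢v κ k)
            O≡ : O σ′ κ′ ≡ o
            O≡ = ≡.trans (≡.cong (run (score (stages σ′) (ranks κ′)) ∅) (Split.order-split π u σ j))
              (run-cong ∅ arrivals′ (All.universal (λ x z → ≡.cong₂ (λ i k → w z * (1# - value i k)) (stages≗ x) (ranks≗ z)) arrivals′))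

        -- Stages and ranks are drawn independently, so the stage of `u` and the rank of `v` can be
        -- resampled one after the other around the bound `average`.
        expectation : c * w v ≤ mean nL n (λ κ → mean nR m (λ σ → X u v σ κ))
        expectation = begin
          c * w v                                                           ≈⟨ mean-const n nL _ ⟨
          mean nL n (λ _ → c * w v)                                         ≤⟨ mean-mono n nL (λ κ → ≤-trans (≤-reflexive (≈-sym (mean-const m nR _))) (mean-mono m nR (λ σ → average σ κ))) ⟩
          mean nL n (λ κ → mean nR m (λ σ → avg m (λ j → avg n (λ k → X u v (σ [ u ]≔ j) (κ [ v ]≔ k)))))
                                                                            ≈⟨ mean-cong n nL (λ κ → mean-resample m nR u (λ σ → avg n (λ k → X u v σ (κ [ v ]≔ k)))) ⟨
          mean nL n (λ κ → mean nR m (λ σ → avg n (λ k → X u v σ (κ [ v ]≔ k)))) ≈⟨ mean-cong n nL (λ κ → mean-avg m nR n (λ k σ → X u v σ (κ [ v ]≔ k))) ⟩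
          mean nL n (λ κ → avg n (λ k → mean nR m (λ σ → X u v σ (κ [ v ]≔ k)))) ≈⟨ mean-resample n nL v (λ κ → mean nR m (λ σ → X u v σ κ)) ⟨
          mean nL n (λ κ → mean nR m (λ σ → X u v σ κ))                     ∎
          where open ≤-Reasoning

      competitive : ∀ M → IsMatching M → c * totalWeight M ≤ E
      competitive M matching = begin
        c * totalWeight M                                                      ≈⟨ *-distribˡ-sum {nL} c (λ v → if is-just (M v) then w v else 0#) ⟩
        sum (λ v → c * (if is-just (M v) then w v else 0#))                    ≤⟨ sum-mono per-vertex ⟩
        sum (λ v → mean nL n (λ κ → mean nR m (λ σ → Y v σ κ)))                ≈⟨ mean-sum n nL nL (λ v κ → mean nR m (λ σ → Y v σ κ)) ⟨
        mean nL n (λ κ → sum (λ v → mean nR m (λ σ → Y v σ κ)))                ≈⟨ mean-cong n nL (λ κ → mean-sum m nR nL (λ v σ → Y v σ κ)) ⟨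
        mean nL n (λ κ → mean nR m (λ σ → sum (λ v → Y v σ κ)))                ≤⟨ mean-mono n nL (λ κ → mean-mono m nR (λ σ →
                                                                                    shares≤weight (stages σ) (ranks κ) (O σ κ) M (ranks≤n κ) matching)) ⟩
        E                                                                      ∎
        where
        open ≤-Reasoning
        open IsMatching matching
        Y : Fin nL → Vec (Fin m) nR → Vec (Fin n) nL → ℝ
        Y v σ κ = maybe′ (λ u → X u v σ κ) 0# (M v)
        per-vertex : ∀ v → c * (if is-just (M v) then w v else 0#) ≤ mean nL n (λ κ → mean nR m (λ σ → Y v σ κ))
        per-vertex v with M v in eq
        ... | just u  = expectation u v (along-edges v u eq)
        ... | nothing = ≤-reflexive (≈-trans (zeroʳ c) (≈-sym (≈-trans (mean-cong n nL (λ κ → mean-const m nR 0#)) (mean-const n nL 0#))))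

    rankingIsCompetitive : RankingIsCompetitive m (p ÷ q)
    rankingIsCompetitive = TableFunction.f table , TableFunction.isRankingFunction table , λ G w 0≤w π τ →
      let open Graph G w 0≤w π τ in E , isExpectedWeight , λ M (matching , _) → competitive M matching

-- Near-optimal tables from a linear program over the values, with one constraint
-- for each choice of thresholds, rounded to multiples of 1/1000000.

twoStages : List (List ℕ)
twoStages =
    (424348 ∷ 426125 ∷ 427902 ∷ 429680 ∷ 431457 ∷ 433234 ∷ 435011 ∷ 436789 ∷ 438566 ∷ 440380 ∷ 442195 ∷
     444009 ∷ 445824 ∷ 447638 ∷ 449452 ∷ 451267 ∷ 453081 ∷ 454943 ∷ 456805 ∷ 458666 ∷ 460528 ∷ 462390 ∷
     464251 ∷ 466113 ∷ 467975 ∷ 469885 ∷ 471796 ∷ 473706 ∷ 475616 ∷ 477527 ∷ 479437 ∷ 481348 ∷ 483258 ∷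
     485192 ∷ 487126 ∷ 489060 ∷ 490995 ∷ 492929 ∷ 494863 ∷ 496797 ∷ 498731 ∷ 500739 ∷ 502748 ∷ 504756 ∷
     506765 ∷ 508773 ∷ 510782 ∷ 512790 ∷ 514799 ∷ 516880 ∷ 518961 ∷ 521043 ∷ 523124 ∷ 525205 ∷ 527286 ∷
     529367 ∷ 531449 ∷ 533652 ∷ 535856 ∷ 538059 ∷ 540263 ∷ 542466 ∷ 544670 ∷ 546874 ∷ 549077 ∷ 551437 ∷
     553797 ∷ 556157 ∷ 558517 ∷ 560877 ∷ 563238 ∷ 565598 ∷ 567958 ∷ 570374 ∷ 572790 ∷ 575206 ∷ 577622 ∷
     580038 ∷ 582454 ∷ 584870 ∷ 587286 ∷ 589222 ∷ 591159 ∷ 593095 ∷ 595032 ∷ 596969 ∷ 598905 ∷ 600842 ∷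
     602778 ∷ 604311 ∷ 605844 ∷ 607376 ∷ 608909 ∷ 610442 ∷ 611974 ∷ 613507 ∷ 615040 ∷ 616573 ∷ 618106 ∷
     619638 ∷ 621171 ∷ 622704 ∷ 624237 ∷ 625770 ∷ 627303 ∷ 628828 ∷ 630354 ∷ 631879 ∷ 633405 ∷ 634930 ∷
     636456 ∷ 637981 ∷ 639507 ∷ 641016 ∷ 642526 ∷ 644035 ∷ 645545 ∷ 647054 ∷ 648563 ∷ 650073 ∷ 651582 ∷
     653066 ∷ 654551 ∷ 656035 ∷ 657519 ∷ 659003 ∷ 660487 ∷ 661971 ∷ 663455 ∷ 664905 ∷ 666354 ∷ 667803 ∷
     669252 ∷ 670702 ∷ 672151 ∷ 673600 ∷ 675049 ∷ 676450 ∷ 677850 ∷ 679250 ∷ 680650 ∷ 682050 ∷ 683450 ∷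
     684850 ∷ 686250 ∷ 687906 ∷ 689562 ∷ 691218 ∷ 692874 ∷ 694531 ∷ 696187 ∷ 697843 ∷ 699499 ∷ 701557 ∷
     703615 ∷ 705673 ∷ 707731 ∷ 709789 ∷ 711846 ∷ 713904 ∷ 715962 ∷ 718357 ∷ 720751 ∷ 723145 ∷ 725540 ∷
     727934 ∷ 730328 ∷ 732723 ∷ 735117 ∷ 737988 ∷ 740860 ∷ 743731 ∷ 746602 ∷ 749474 ∷ 752345 ∷ 755216 ∷
     758088 ∷ 761357 ∷ 764626 ∷ 767896 ∷ 771165 ∷ 774435 ∷ 777704 ∷ 780973 ∷ 784243 ∷ 788062 ∷ 791882 ∷
     795701 ∷ 799521 ∷ 803340 ∷ 807160 ∷ 810979 ∷ 814798 ∷ 818991 ∷ 823184 ∷ 827377 ∷ 831570 ∷ 835763 ∷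
     839956 ∷ 844149 ∷ 848342 ∷ 851929 ∷ 855515 ∷ 859102 ∷ 862689 ∷ 866276 ∷ 869863 ∷ 873449 ∷ 877036 ∷
     880468 ∷ 883900 ∷ 887331 ∷ 890763 ∷ 894195 ∷ 897627 ∷ 901058 ∷ 904490 ∷ 908227 ∷ 911964 ∷ 915701 ∷
     919438 ∷ 923175 ∷ 926912 ∷ 930649 ∷ 934386 ∷ 938476 ∷ 942566 ∷ 946655 ∷ 950745 ∷ 954835 ∷ 958925 ∷
     963015 ∷ 967105 ∷ 971199 ∷ 975294 ∷ 979388 ∷ 983482 ∷ 987576 ∷ 991670 ∷ 995764 ∷ [])
  ∷ (244360 ∷ 245407 ∷ 246453 ∷ 247500 ∷ 248547 ∷ 249594 ∷ 250640 ∷ 251687 ∷ 252734 ∷ 253844 ∷ 254955 ∷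
     256066 ∷ 257177 ∷ 258287 ∷ 259398 ∷ 260509 ∷ 261619 ∷ 262801 ∷ 263982 ∷ 265163 ∷ 266344 ∷ 267525 ∷
     268706 ∷ 269887 ∷ 271069 ∷ 272322 ∷ 273575 ∷ 274829 ∷ 276082 ∷ 277335 ∷ 278589 ∷ 279842 ∷ 281095 ∷
     282418 ∷ 283740 ∷ 285063 ∷ 286385 ∷ 287707 ∷ 289030 ∷ 290352 ∷ 291674 ∷ 293097 ∷ 294519 ∷ 295941 ∷
     297363 ∷ 298785 ∷ 300208 ∷ 301630 ∷ 303052 ∷ 304540 ∷ 306029 ∷ 307517 ∷ 309006 ∷ 310494 ∷ 311983 ∷
     313471 ∷ 314960 ∷ 316567 ∷ 318174 ∷ 319781 ∷ 321387 ∷ 322994 ∷ 324601 ∷ 326208 ∷ 327815 ∷ 329504 ∷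
     331194 ∷ 332883 ∷ 334572 ∷ 336261 ∷ 337950 ∷ 339639 ∷ 341328 ∷ 343144 ∷ 344960 ∷ 346775 ∷ 348591 ∷
     350406 ∷ 352222 ∷ 354038 ∷ 355853 ∷ 357781 ∷ 359709 ∷ 361637 ∷ 363565 ∷ 365492 ∷ 367420 ∷ 369348 ∷
     371276 ∷ 373350 ∷ 375424 ∷ 377499 ∷ 379573 ∷ 381647 ∷ 383721 ∷ 385795 ∷ 387869 ∷ 390071 ∷ 392272 ∷
     394473 ∷ 396674 ∷ 398875 ∷ 401076 ∷ 403277 ∷ 405478 ∷ 407809 ∷ 410139 ∷ 412469 ∷ 414800 ∷ 417130 ∷
     419460 ∷ 421791 ∷ 424121 ∷ 426616 ∷ 429111 ∷ 431605 ∷ 434100 ∷ 436595 ∷ 439090 ∷ 441585 ∷ 444080 ∷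
     446710 ∷ 449340 ∷ 451970 ∷ 454600 ∷ 457230 ∷ 459860 ∷ 462490 ∷ 465120 ∷ 467884 ∷ 470647 ∷ 473410 ∷
     476174 ∷ 478937 ∷ 481700 ∷ 484464 ∷ 487227 ∷ 490127 ∷ 493027 ∷ 495927 ∷ 498828 ∷ 501728 ∷ 504628 ∷
     507528 ∷ 510428 ∷ 513585 ∷ 516743 ∷ 519900 ∷ 523057 ∷ 526214 ∷ 529372 ∷ 532529 ∷ 535686 ∷ 539024 ∷
     542363 ∷ 545701 ∷ 549039 ∷ 552378 ∷ 555716 ∷ 559054 ∷ 562392 ∷ 566101 ∷ 569809 ∷ 573518 ∷ 577226 ∷
     580935 ∷ 584643 ∷ 588352 ∷ 592060 ∷ 596152 ∷ 600244 ∷ 604336 ∷ 608428 ∷ 612520 ∷ 616612 ∷ 620703 ∷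
     624795 ∷ 629372 ∷ 633949 ∷ 638525 ∷ 643102 ∷ 647679 ∷ 652255 ∷ 656832 ∷ 661409 ∷ 666215 ∷ 671020 ∷
     675826 ∷ 680632 ∷ 685438 ∷ 690244 ∷ 695050 ∷ 699855 ∷ 705367 ∷ 710880 ∷ 716392 ∷ 721904 ∷ 727416 ∷
     732928 ∷ 738440 ∷ 743952 ∷ 749885 ∷ 755817 ∷ 761749 ∷ 767681 ∷ 773613 ∷ 779546 ∷ 785478 ∷ 791410 ∷
     797473 ∷ 803536 ∷ 809599 ∷ 815662 ∷ 821725 ∷ 827789 ∷ 833852 ∷ 839915 ∷ 846323 ∷ 852731 ∷ 859139 ∷
     865547 ∷ 871956 ∷ 878364 ∷ 884772 ∷ 891180 ∷ 897767 ∷ 904355 ∷ 910942 ∷ 917529 ∷ 924116 ∷ 930703 ∷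
     937291 ∷ 943878 ∷ 950880 ∷ 957882 ∷ 964883 ∷ 971885 ∷ 978887 ∷ 985889 ∷ 992891 ∷ []) ∷ []

threeStages : List (List ℕ)
threeStages =
    (447528 ∷ 452011 ∷ 456493 ∷ 460975 ∷ 465457 ∷ 469825 ∷ 474193 ∷ 478561 ∷ 482929 ∷ 487401 ∷ 491873 ∷
     496345 ∷ 500816 ∷ 505342 ∷ 509868 ∷ 514394 ∷ 518920 ∷ 523335 ∷ 527751 ∷ 532166 ∷ 536581 ∷ 540481 ∷
     544380 ∷ 548280 ∷ 552180 ∷ 556269 ∷ 560358 ∷ 564447 ∷ 568536 ∷ 572962 ∷ 577389 ∷ 581815 ∷ 586241 ∷
     590915 ∷ 595588 ∷ 600261 ∷ 604934 ∷ 610009 ∷ 615085 ∷ 620160 ∷ 625235 ∷ 630650 ∷ 636065 ∷ 641479 ∷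
     646894 ∷ 652811 ∷ 658728 ∷ 664645 ∷ 670563 ∷ 676959 ∷ 683355 ∷ 689751 ∷ 696147 ∷ 702897 ∷ 709647 ∷
     716396 ∷ 723146 ∷ 727581 ∷ 732015 ∷ 736449 ∷ 740884 ∷ 743922 ∷ 746960 ∷ 749998 ∷ 753036 ∷ 755476 ∷
     757916 ∷ 760356 ∷ 762796 ∷ 766532 ∷ 770269 ∷ 774005 ∷ 777741 ∷ 783726 ∷ 789711 ∷ 795696 ∷ 801681 ∷
     808120 ∷ 814560 ∷ 821000 ∷ 827440 ∷ 836700 ∷ 845961 ∷ 855222 ∷ 864482 ∷ 875938 ∷ 887394 ∷ 898850 ∷
     910306 ∷ 922970 ∷ 935634 ∷ 948298 ∷ 960962 ∷ 970091 ∷ 979220 ∷ 988348 ∷ [])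
  ∷ (322355 ∷ 325860 ∷ 329366 ∷ 332872 ∷ 336378 ∷ 340180 ∷ 343983 ∷ 347786 ∷ 351588 ∷ 355753 ∷ 359918 ∷
     364082 ∷ 368247 ∷ 372879 ∷ 377511 ∷ 382144 ∷ 386776 ∷ 391804 ∷ 396832 ∷ 401860 ∷ 406889 ∷ 412591 ∷
     418292 ∷ 423994 ∷ 429696 ∷ 435952 ∷ 442208 ∷ 448463 ∷ 454719 ∷ 461303 ∷ 467888 ∷ 474472 ∷ 481056 ∷
     483629 ∷ 486201 ∷ 488774 ∷ 491346 ∷ 493834 ∷ 496322 ∷ 498810 ∷ 501298 ∷ 504037 ∷ 506775 ∷ 509514 ∷
     512252 ∷ 516217 ∷ 520181 ∷ 524145 ∷ 528109 ∷ 532906 ∷ 537702 ∷ 542499 ∷ 547295 ∷ 553665 ∷ 560034 ∷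
     566404 ∷ 572773 ∷ 580243 ∷ 587712 ∷ 595182 ∷ 602651 ∷ 612164 ∷ 621676 ∷ 631188 ∷ 640701 ∷ 650745 ∷
     660789 ∷ 670833 ∷ 680877 ∷ 689593 ∷ 698309 ∷ 707025 ∷ 715741 ∷ 725037 ∷ 734332 ∷ 743627 ∷ 752923 ∷
     763474 ∷ 774026 ∷ 784577 ∷ 795129 ∷ 806558 ∷ 817988 ∷ 829417 ∷ 840847 ∷ 852781 ∷ 864716 ∷ 876650 ∷
     888584 ∷ 901927 ∷ 915269 ∷ 928612 ∷ 941954 ∷ 956401 ∷ 970848 ∷ 985294 ∷ [])
  ∷ (200887 ∷ 203067 ∷ 205246 ∷ 207425 ∷ 209604 ∷ 211993 ∷ 214381 ∷ 216769 ∷ 219158 ∷ 221749 ∷ 224340 ∷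
     226932 ∷ 229523 ∷ 232309 ∷ 235094 ∷ 237880 ∷ 240665 ∷ 243756 ∷ 246846 ∷ 249936 ∷ 253027 ∷ 256358 ∷
     259689 ∷ 263020 ∷ 266351 ∷ 270041 ∷ 273731 ∷ 277421 ∷ 281111 ∷ 285135 ∷ 289158 ∷ 293181 ∷ 297204 ∷
     301662 ∷ 306119 ∷ 310576 ∷ 315034 ∷ 319802 ∷ 324570 ∷ 329338 ∷ 334106 ∷ 339408 ∷ 344710 ∷ 350012 ∷
     355313 ∷ 361039 ∷ 366765 ∷ 372490 ∷ 378216 ∷ 384626 ∷ 391037 ∷ 397447 ∷ 403857 ∷ 410870 ∷ 417882 ∷
     424895 ∷ 431907 ∷ 439741 ∷ 447574 ∷ 455407 ∷ 463241 ∷ 471981 ∷ 480721 ∷ 489462 ∷ 498202 ∷ 508286 ∷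
     518370 ∷ 528453 ∷ 538537 ∷ 538537 ∷ 538537 ∷ 538537 ∷ 538537 ∷ 538537 ∷ 538537 ∷ 538537 ∷ 538537 ∷
     573106 ∷ 607676 ∷ 642245 ∷ 676814 ∷ 676814 ∷ 676814 ∷ 676814 ∷ 676814 ∷ 710655 ∷ 744496 ∷ 778336 ∷
     812177 ∷ 833002 ∷ 853827 ∷ 874652 ∷ 895477 ∷ 922085 ∷ 948692 ∷ 975300 ∷ []) ∷ []

-- The scan visits all nondecreasing tuples of thresholds in 0, ..., n: 29161 pairs for n = 240 and
-- 156849 triples for n = 96. The argument before the target is the permitted loss, the rest of m n
-- D.
module Two   = Verify 2 240 1000000 160512000 319488000 twoStages
module Three = Verify 3 96 1000000 93225600 194774400 threeStages

twoStages-increasing : Two.Increasing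
twoStages-increasing = toWitness {a? = Two.increasing?} tt

twoStages-decreasing : Two.Decreasing
twoStages-decreasing = toWitness {a? = Two.decreasing?} tt

threeStages-increasing : Three.Increasing
threeStages-increasing = toWitness {a? = Three.increasing?} tt

threeStages-decreasing : Three.Decreasing
threeStages-decreasing = toWitness {a? = Three.decreasing?} tt

-- 319488000 is 0.6656 * 2 * 240 * 1000000 and 194774400 is 0.6763 * 3 * 96 * 1000000.
twoStages-guarantee : Table.Guarantees (Two.table twoStages-increasing twoStages-decreasing) 319488000
twoStages-guarantee = Two.guarantees twoStages-increasing twoStages-decreasing ≡.refl ≡.refl

threeStages-guarantee : Table.Guarantees (Three.table threeStages-increasing threeStages-decreasing) 194774400
threeStages-guarantee = Three.guarantees threeStages-increasing threeStages-decreasing ≡.refl ≡.refl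

theorem1p3 : ExcludedMiddle 0ℓ → (reals : CompleteOrderedField) →
    let open CompleteOrderedField reals
        open Model reals
    in RankingIsCompetitive 2 (6656 ÷ 10000) × RankingIsCompetitive 3 (6763 ÷ 10000)
theorem1p3 em reals = Early-Late.rankingIsCompetitive , Early-Middle-Late.rankingIsCompetitive
  where
  open Competitive em reals
  module Early-Late = Ratio (Two.table twoStages-increasing twoStages-decreasing)
    {319488000} {6656} {10000} twoStages-guarantee ≡.refl
  module Early-Middle-Late = Ratio (Three.table threeStages-increasing threeStages-decreasing)
    {194774400} {6763} {10000} threeStages-guarantee ≡.refl
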